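{- Let $W$ be a finite real reflection group with root system $\Phi$, fixed positive system $\Phi^+\subset\Phi$, set of reflections $T$ and Coxeter element $\gamma$, and let $\lambda$ be the natural edge labeling of $\mathrm{NC}_W(\gamma)$. (i) For any total ordering of $T$ and any non-singleton interval $[u,v]$ in $\mathrm{NC}_W(\gamma)$ there is a unique lexicographically smallest maximal chain in $[u,v]$, and this chain is rising with respect to $\lambda$. (ii) If $T$ is totally ordered by a reflection ordering which is compatible with $\gamma$ and $W$ is a Weyl group, then $\lambda$ is an EL-labeling of $\mathrm{NC}_W(\gamma)$.
   Context: $W$ has rank $\ell$ and acts faithfully by orthogonal transformations on an $\ell$-dimensional Euclidean space $V$, generated by orthogonal reflections. $\Phi$ is a $W$-invariant set consisting of one pair $\{\alpha,-\alpha\}$ of nonzero vectors for each reflection in $W$, orthogonal to its reflecting hyperplane; $t_\alpha$ is the reflection in the hyperplane orthogonal to $\alpha$. $\Phi$ is crystallographic, and $W$ is a Weyl group, if $2(\alpha,\beta)/(\alpha,\alpha)\in\mathbb{Z}$ for all $\alpha,\beta\in\Phi$. A Coxeter element of $W$ is the product, in an arbitrary order, of the simple reflections for any choice of simple system for $\Phi$. For $w\in W$, $l_T(w)$ is the smallest $k$ such that $w$ is a product of $k$ elements of $T$; $u\preceq v$ if and only if $l_T(u)+l_T(u^{ -1}v)=l_T(v)$; $\mathrm{NC}_W(w)$ is the interval $[1,w]$ in $(W,\preceq)$, graded by $l_T$. Every covering relation $(u,v)$ of $\mathrm{NC}_W(\gamma)$ satisfies $u^{ -1}v\in T$; the natural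 edge labeling is $\lambda(u,v)=u^{ -1}v$, with label set $T$. Reflection ordering: a total ordering $<$ of $T$ such that whenever $\alpha,\alpha_1,\alpha_2\in\Phi^+$ are distinct and $\alpha$ is a positive linear combination of $\alpha_1,\alpha_2$, either $t_{\alpha_1}<t_\alpha<t_{\alpha_2}$ or $t_{\alpha_2}<t_\alpha<t_{\alpha_1}$. Compatibility: a rank 2 induced subsystem $\Phi'$ of $\Phi$ is the intersection of $\Phi$ with the linear span of two linearly independent roots; it is a root system with positive system $\Phi'\cap\Phi^+$, and is irreducible if and only if $\Phi'\cap\Phi^+$ has at least three roots. A reflection ordering $<$ is compatible with $\gamma$ if for every irreducible rank 2 induced subsystem $\Phi'\subseteq\Phi$: if $\alpha$ and $\beta$ are the simple roots of $\Phi'$ with respect to $\Phi'\cap\Phi^+$ and $t_\alpha t_\beta\in\mathrm{NC}_W(\gamma)$, then $t_\alpha<t_\beta$. Chains and EL-labelings: for a totally ordered label set, the label of an unrefinable chain $x_0<\cdots<x_r$ is $(\lambda(x_0,x_1),\dots,\lambda(x_{r-1},x_r))$; the chain is rising if its entries strictly increase; chains of equal length are compared by the lexicographic order on their labels. An edge labeling of a finite bounded graded poset is an EL-labeling if in every non-singleton interval there is a unique rising maximal chain and this chain is lexicographically smallest among all maximal chains of the interval. -}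

module Defs where

open import Algebra.Bundles using (CommutativeRing; Group)
open import Algebra.Module.Bundles using (Module)
open import Algebra.Module.Morphism.Structures using (IsModuleHomomorphism)
import Algebra.Definitions.RawMonoid as RawMonoidDefinitions
import Algebra.Properties.Group as GroupProperties
open import Data.Fin.Base using (Fin)
open import Data.Integer.Base using (ℤ; +_; -[1+_])
open import Data.List.Base using (List; []; _∷_; _++_; [_]; foldr; length)
open import Data.List.Properties using (length-++)
open import Data.List.Relation.Binary.Lex.Strict using (Lex-≤)
open import Data.List.Relation.Binary.Pointwise using (Pointwise)
open import Data.List.Relation.Unary.All using (All; []; _∷_)
open import Data.List.Relation.Unary.All.Properties using (++⁺)
open import Data.List.Relation.Unary.Enumerates.Setoid using (IsEnumeration)
open import Data.List.Relation.Unary.Linked using (Linked)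
open import Data.Nat.Base as ℕ using (ℕ; zero; suc; z≤n)
import Data.Nat.Properties as ℕ
open import Data.Product.Base using (Σ-syntax; ∃; ∃-syntax; _×_; _,_; proj₁; proj₂)
open import Data.Sum.Base using (_⊎_)
import Data.Vec.Functional as Vector
open import Data.Vec.Functional using (Vector)
open import Function.Base using (_on_)
open import Function.Bundles using (_⇔_; Equivalence)
open import Level using (0ℓ)
open import Relation.Binary.Bundles using (Poset; StrictTotalOrder)
open import Relation.Binary.Construct.Closure.ReflexiveTransitive using (Star; _◅_) renaming (ε to done)
open import Relation.Binary.Core using (Rel)
open import Relation.Binary.Definitions using (tri<; tri≈; tri>)
import Relation.Binary.Properties.Poset as PosetProperties
open import Relation.Binary.PropositionalEquality as ≡ using (_≡_)
open import Relation.Binary.Structures using (IsStrictTotalOrder)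
open import Relation.Nullary.Negation.Core using (¬_; contradiction)
open import Relation.Unary using (Pred; _∈_; _⊆_; _∩_; Satisfiable)

-- The real field, given by its characterization as a Dedekind-complete
-- ordered field.  As in classical mathematics the order is trichotomous.
-- The inverse is a total operation whose value at 0 is unspecified.

record Reals : Set₁ where
  infix 4 _<_
  infix 8 _⁻¹
  field
    commutativeRing : CommutativeRing 0ℓ 0ℓ
  open CommutativeRing commutativeRing public
  field
    _<_                : Rel Carrier 0ℓ
    isStrictTotalOrder : IsStrictTotalOrder _≈_ _<_
    0<1                : 0# < 1#
    +-monoʳ-<          : ∀ z {x y} → x < y → z + x < z + y
    *-pos              : ∀ {x y} → 0# < x → 0# < y → 0# < x * y
    _⁻¹                : Carrier → Carrier
    ⁻¹-cong            : ∀ {x y} → x ≈ y → x ⁻¹ ≈ y ⁻¹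
    ⁻¹-inverseʳ        : ∀ {x} → ¬ (x ≈ 0#) → x * x ⁻¹ ≈ 1#

  infix 4 _≤_
  _≤_ : Rel Carrier 0ℓ
  x ≤ y = x < y ⊎ x ≈ y

  UpperBound : Pred Carrier 0ℓ → Pred Carrier 0ℓ
  UpperBound S b = ∀ {x} → x ∈ S → x ≤ b

  field
    complete : ∀ (S : Pred Carrier 0ℓ) → Satisfiable S → Satisfiable (UpperBound S) →
               ∃[ s ] UpperBound S s × (∀ {b} → UpperBound S b → s ≤ b)

  2# : Carrier
  2# = 1# + 1#

  open RawMonoidDefinitions +-rawMonoid using () renaming (_×_ to _×ᴺ_)

  fromℤ : ℤ → Carrier
  fromℤ (+ n)    = n ×ᴺ 1#
  fromℤ -[1+ n ] = - (suc n ×ᴺ 1#)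


record EuclideanSpace (ℝ : Reals) (dim : ℕ) : Set₁ where
  open Reals ℝ
  field
    module′ : Module commutativeRing 0ℓ 0ℓ
  open Module module′ public
  V : Set
  V = Carrierᴹ

  open RawMonoidDefinitions +ᴹ-rawMonoid using () renaming (sum to sumᴹ) public

  combination : ∀ {n} → Vector Carrier n → Vector V n → V
  combination c v = sumᴹ (λ i → c i *ₗ v i)

  Independent : ∀ {n} → Pred (Vector V n) 0ℓ
  Independent v = ∀ c → combination c v ≈ᴹ 0ᴹ → ∀ i → c i ≈ 0#

  Span : ∀ {n} → Vector V n → Pred V 0ℓ
  Span v x = ∃[ c ] x ≈ᴹ combination c v

  Cone : ∀ {n} → Vector V n → Pred V 0ℓ
  Cone v x = ∃[ c ] (∀ i → 0# ≤ c i) × x ≈ᴹ combination c v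

  field
    ⟨_,_⟩      : V → V → Carrier
    ⟨⟩-cong    : ∀ {x x′ y y′} → x ≈ᴹ x′ → y ≈ᴹ y′ → ⟨ x , y ⟩ ≈ ⟨ x′ , y′ ⟩
    ⟨⟩-sym     : ∀ x y → ⟨ x , y ⟩ ≈ ⟨ y , x ⟩
    ⟨⟩-+ˡ      : ∀ x y z → ⟨ x +ᴹ y , z ⟩ ≈ ⟨ x , z ⟩ + ⟨ y , z ⟩
    ⟨⟩-*ˡ      : ∀ c x y → ⟨ c *ₗ x , y ⟩ ≈ c * ⟨ x , y ⟩
    ⟨⟩-nonneg  : ∀ x → 0# ≤ ⟨ x , x ⟩
    ⟨⟩-def     : ∀ {x} → ⟨ x , x ⟩ ≈ 0# → x ≈ᴹ 0ᴹ
    basis      : Vector V dim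
    basis-ind  : Independent basis
    basis-span : ∀ x → x ∈ Span basis

  -- Meaningful only for α ≠ 0.
  reflect : V → V → V
  reflect α x = x +ᴹ -ᴹ ((2# * ⟨ x , α ⟩ * ⟨ α , α ⟩ ⁻¹) *ₗ α)


-- W is an abstract group acting faithfully on V; its rank is constrained in
-- RootSystem below, by requiring that the roots span V.

record ReflectionGroup {ℝ : Reals} {dim : ℕ} (E : EuclideanSpace ℝ dim) : Set₁ where
  open Reals ℝ using () renaming (_≈_ to _≈ℝ_)
  open EuclideanSpace E
  field
    group : Group 0ℓ 0ℓ
  open Group group public
  W : Set
  W = Carrier

  infixr 8 _·_
  field
    elements     : List W
    finite       : IsEnumeration setoid elements
    _·_          : W → V → V
    ·-congˡ      : ∀ {u w} → u ≈ w → ∀ x → u · x ≈ᴹ w · x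
    ·-identity   : ∀ x → ε · x ≈ᴹ x
    ·-compose    : ∀ u w x → (u ∙ w) · x ≈ᴹ u · w · x
    ·-linear     : ∀ w → IsModuleHomomorphism rawModule rawModule (w ·_)
    ·-orthogonal : ∀ w x y → ⟨ w · x , w · y ⟩ ≈ℝ ⟨ x , y ⟩
    ·-faithful   : ∀ {u w} → (∀ x → u · x ≈ᴹ w · x) → u ≈ w

  infix 4 _ActsAsReflectionIn_
  _ActsAsReflectionIn_ : W → V → Set
  w ActsAsReflectionIn α = ∀ x → w · x ≈ᴹ reflect α x

  IsReflection : Pred W 0ℓ
  IsReflection w = ∃[ α ] ¬ (α ≈ᴹ 0ᴹ) × w ActsAsReflectionIn α

  field
    generated : ∀ w → ∃[ ts ] All IsReflection ts × w ≈ foldr _∙_ ε ts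

  T : Set
  T = ∃ IsReflection

  infix 4 _≈ᵀ_
  _≈ᵀ_ : Rel T 0ℓ
  _≈ᵀ_ = _≈_ on proj₁


record RootSystem {ℝ : Reals} {dim : ℕ} {E : EuclideanSpace ℝ dim}
                  (𝑾 : ReflectionGroup E) : Set₁ where
  open Reals ℝ using (_*_; 2#; fromℤ) renaming (_≈_ to _≈ℝ_; _⁻¹ to _⁻¹ℝ)
  open EuclideanSpace E
  open ReflectionGroup 𝑾
  field
    Φ            : Pred V 0ℓ
    Φ-resp       : ∀ {α β} → α ≈ᴹ β → α ∈ Φ → β ∈ Φ
    Φ-nonzero    : ∀ {α} → α ∈ Φ → ¬ (α ≈ᴹ 0ᴹ)
    Φ-neg        : ∀ {α} → α ∈ Φ → -ᴹ α ∈ Φ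
    Φ-invariant  : ∀ w {α} → α ∈ Φ → w · α ∈ Φ
    root⇒refl    : ∀ {α} → α ∈ Φ → ∃[ w ] w ActsAsReflectionIn α
    refl⇒root    : ∀ {w} → IsReflection w → ∃[ α ] α ∈ Φ × w ActsAsReflectionIn α
    one-pair     : ∀ {w α β} → α ∈ Φ → β ∈ Φ →
                   w ActsAsReflectionIn α → w ActsAsReflectionIn β →
                   β ≈ᴹ α ⊎ β ≈ᴹ -ᴹ α
    -- W has rank equal to the dimension of V.
    Φ-spans      : ∀ x → ∃[ n ] Σ[ v ∈ Vector V n ] (∀ i → v i ∈ Φ) × x ∈ Span v

  t : ∀ {α} → α ∈ Φ → T
  t p = proj₁ (root⇒refl p) , _ , Φ-nonzero p , proj₂ (root⇒refl p)

  Crystallographic : Set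
  Crystallographic = ∀ {α β} → α ∈ Φ → β ∈ Φ →
                     ∃[ k ] 2# * ⟨ α , β ⟩ * ⟨ α , α ⟩ ⁻¹ℝ ≈ℝ fromℤ k


module SimpleSystems {ℝ : Reals} {dim : ℕ} (E : EuclideanSpace ℝ dim) where
  open EuclideanSpace E

  record IsSimpleSystem (Ψ : Pred V 0ℓ) {n : ℕ} (Δ : Vector V n) : Set where
    field
      roots       : ∀ i → Δ i ∈ Ψ
      independent : Independent Δ
      same-sign   : ∀ {x} → x ∈ Ψ → x ∈ Cone Δ ⊎ -ᴹ x ∈ Cone Δ

  -- Δ is the simple system determined by the positive system Ψ⁺ of Ψ.
  record IsSimpleSystemOf (Ψ Ψ⁺ : Pred V 0ℓ) {n : ℕ} (Δ : Vector V n) : Set where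
    field
      isSimpleSystem : IsSimpleSystem Ψ Δ
      positive       : ∀ {x} → x ∈ Ψ⁺ ⇔ (x ∈ Ψ × x ∈ Cone Δ)

  IsPositiveSystem : (Ψ Ψ⁺ : Pred V 0ℓ) → Set
  IsPositiveSystem Ψ Ψ⁺ = ∃[ n ] Σ[ Δ ∈ Vector V n ] IsSimpleSystemOf Ψ Ψ⁺ Δ

  positive⇒root : ∀ {Ψ Ψ⁺} → IsPositiveSystem Ψ Ψ⁺ → Ψ⁺ ⊆ Ψ
  positive⇒root (_ , _ , s) p =
    proj₁ (Equivalence.to (IsSimpleSystemOf.positive s) p)

  module _ where
    open Reals ℝ using (0#) renaming (_≈_ to _≈ℝ_)

    -- A root system is irreducible if it is nonempty and is not the union of
    -- two nonempty, mutually orthogonal subsets.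
    Irreducible : Pred V 0ℓ → Set₁
    Irreducible Ψ = Satisfiable Ψ ×
      ¬ (Σ[ A ∈ Pred V 0ℓ ] Σ[ B ∈ Pred V 0ℓ ]
           A ⊆ Ψ × B ⊆ Ψ × Satisfiable A × Satisfiable B ×
           (∀ {x} → x ∈ Ψ → x ∈ A ⊎ x ∈ B) ×
           (∀ {x y} → x ∈ A → y ∈ B → ⟨ x , y ⟩ ≈ℝ 0#))


module Covering {a ℓ₁ ℓ₂} (P : Poset a ℓ₁ ℓ₂) where
  open Poset P renaming (Carrier to A)
  open PosetProperties P using (_<_)

  infix 4 _⋖_
  _⋖_ : Rel A _
  x ⋖ y = x < y × (∀ z → ¬ (x < z × z < y))

  -- Since all covers are covers in P, the saturated chains from u to v are
  -- exactly the maximal chains of the interval [u , v].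
  MaximalChain : Rel A _
  MaximalChain = Star _⋖_

  vertices : ∀ {u v} → MaximalChain u v → List A
  vertices {u} done     = [ u ]
  vertices {u} (_ ◅ xs) = u ∷ vertices xs

  infix 4 _≋_
  _≋_ : ∀ {u v} → Rel (MaximalChain u v) _
  c ≋ d = Pointwise _≈_ (vertices c) (vertices d)


-- The absolute order of a group G with respect to a set T of its elements.

module AbsoluteOrder (G : Group 0ℓ 0ℓ) (T : Pred (Group.Carrier G) 0ℓ) where
  open Group G
  open RawMonoidDefinitions rawMonoid using () renaming (sum to product) public

  infix 4 _IsProductOf_
  _IsProductOf_ : Carrier → ℕ → Set
  w IsProductOf k = ∃[ ts ] All T ts × length ts ≡ k × w ≈ foldr _∙_ ε ts

  -- The graph of l_T: the least k such that w is a product of k elements of T.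
  infix 4 lT[_]≡_
  lT[_]≡_ : Carrier → ℕ → Set
  lT[ w ]≡ k = w IsProductOf k × (∀ {j} → w IsProductOf j → k ℕ.≤ j)

  infix 4 _⪯_
  _⪯_ : Rel Carrier 0ℓ
  u ⪯ v = ∃[ a ] ∃[ b ] ∃[ c ]
          lT[ u ]≡ a × lT[ u ⁻¹ ∙ v ]≡ b × lT[ v ]≡ c × a ℕ.+ b ≡ c

  InNC : Carrier → Pred Carrier 0ℓ
  InNC w x = ε ⪯ x × x ⪯ w

  cancel : ∀ u v → u ∙ (u ⁻¹ ∙ v) ≈ v
  cancel u v = trans (sym (assoc u (u ⁻¹) v))
                     (trans (∙-congʳ (inverseʳ u)) (identityˡ v))

  cancel′ : ∀ u v → u ⁻¹ ∙ (u ∙ v) ≈ v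
  cancel′ u v = trans (sym (assoc (u ⁻¹) u v))
                      (trans (∙-congʳ (inverseˡ u)) (identityˡ v))

  telescope : ∀ u v w → (u ⁻¹ ∙ v) ∙ (v ⁻¹ ∙ w) ≈ u ⁻¹ ∙ w
  telescope u v w = trans (assoc _ _ _) (∙-congˡ (cancel v w))

  foldr-++ : ∀ us vs → foldr _∙_ ε us ∙ foldr _∙_ ε vs ≈ foldr _∙_ ε (us ++ vs)
  foldr-++ []       vs = identityˡ _
  foldr-++ (x ∷ us) vs = trans (assoc _ _ _) (∙-congˡ (foldr-++ us vs))

  prod-resp : ∀ {u v k} → u ≈ v → u IsProductOf k → v IsProductOf k
  prod-resp e (ts , a , l , p) = ts , a , l , trans (sym e) p

  prod-∙ : ∀ {u v i j} → u IsProductOf i → v IsProductOf j → u ∙ v IsProductOf (i ℕ.+ j)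
  prod-∙ (us , a , ≡.refl , p) (vs , b , ≡.refl , q) =
    us ++ vs , ++⁺ a b , length-++ us , trans (∙-cong p q) (foldr-++ us vs)

  prod-quot : ∀ {u v i j} → u IsProductOf i → u ⁻¹ ∙ v IsProductOf j → v IsProductOf (i ℕ.+ j)
  prod-quot p q = prod-resp (cancel _ _) (prod-∙ p q)

  length-resp : ∀ {u v k} → u ≈ v → lT[ u ]≡ k → lT[ v ]≡ k
  length-resp e (p , m) = prod-resp e p , λ q → m (prod-resp (sym e) q)

  length-unique : ∀ {u j k} → lT[ u ]≡ j → lT[ u ]≡ k → j ≡ k
  length-unique (p , m) (q , n) = ℕ.≤-antisym (m q) (n p)

  length-ε : lT[ ε ]≡ 0
  length-ε = ([] , [] , ≡.refl , refl) , λ _ → z≤n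

  length-0 : ∀ {u} → lT[ u ]≡ 0 → u ≈ ε
  length-0 (([] , _ , _ , p) , _) = p

  quot-ε : ∀ {u v} → u ⁻¹ ∙ v ≈ ε → u ≈ v
  quot-ε {u} {v} e = trans (sym (identityʳ u)) (trans (∙-congˡ (sym e)) (cancel u v))

  ε⪯ : ∀ {x a} → lT[ x ]≡ a → ε ⪯ x
  ε⪯ {x} {a} p = 0 , a , a , length-ε , length-resp (sym e) p , p , ≡.refl
    where
    e : ε ⁻¹ ∙ x ≈ x
    e = trans (sym (identityˡ _)) (cancel ε x)

  ⪯-refl : ∀ {x y a} → lT[ x ]≡ a → x ≈ y → x ⪯ y
  ⪯-refl {x} {y} {a} p e =
    a , 0 , a , p , length-resp (sym (trans (∙-congˡ (sym e)) (inverseˡ x))) length-ε ,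
    length-resp e p , ℕ.+-identityʳ a

  ⪯-trans : ∀ {x y z} → x ⪯ y → y ⪯ z → x ⪯ z
  ⪯-trans {x} {y} {z} (a , b , c , p , q , r , e) (a′ , b′ , c′ , p′ , q′ , r′ , e′)
    with length-unique r p′
  ... | ≡.refl = a , b ℕ.+ b′ , c′ , p ,
        (prod-resp (telescope x y z) (prod-∙ (proj₁ q) (proj₁ q′)) , minimal) , r′ , total
    where
    total : a ℕ.+ (b ℕ.+ b′) ≡ c′
    total = ≡.trans (≡.sym (ℕ.+-assoc a b b′)) (≡.trans (≡.cong (ℕ._+ b′) e) e′)
    minimal : ∀ {j} → x ⁻¹ ∙ z IsProductOf j → b ℕ.+ b′ ℕ.≤ j
    minimal {j} s = ℕ.+-cancelˡ-≤ a (b ℕ.+ b′) j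
      (≡.subst (ℕ._≤ a ℕ.+ j) (≡.sym total) (proj₂ r′ (prod-quot (proj₁ p) s)))

  ⪯-antisym : ∀ {x y} → x ⪯ y → y ⪯ x → x ≈ y
  ⪯-antisym (a , b , c , p , q , r , e) (a′ , b′ , c′ , p′ , q′ , r′ , e′)
    with length-unique r p′ | length-unique p r′
  ... | ≡.refl | ≡.refl = quot-ε (length-0 (≡.subst (lT[ _ ]≡_) b≡0 q))
    where
    b≡0 : b ≡ 0
    b≡0 = ℕ.m+n≡0⇒m≡0 b (ℕ.+-cancelˡ-≡ a (b ℕ.+ b′) 0
      (≡.trans (≡.sym (ℕ.+-assoc a b b′))
      (≡.trans (≡.cong (ℕ._+ b′) e) (≡.trans e′ (≡.sym (ℕ.+-identityʳ a))))))

  NC : Carrier → Poset 0ℓ 0ℓ 0ℓ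
  NC w = record
    { Carrier        = ∃ (InNC w)
    ; _≈_            = _≈_ on proj₁
    ; _≤_            = _⪯_ on proj₁
    ; isPartialOrder = record
      { isPreorder = record
        { isEquivalence = record { refl = refl ; sym = sym ; trans = trans }
        ; reflexive     = λ { {_ , _ , _ , _ , _ , p , _} → ⪯-refl p }
        ; trans         = ⪯-trans
        }
      ; antisym    = ⪯-antisym
      }
    }


  module _ (T-resp : ∀ {x y} → x ≈ y → T x → T y)
           (≈-stable : ∀ {x y} → ¬ ¬ (x ≈ y) → x ≈ y)
           where

    private
      first-step : ∀ {w} (x y : ∃ (InNC w)) → Covering._⋖_ (NC w) x y →
                   (ts : List Carrier) → All T ts →
                   ∀ {a c} → lT[ proj₁ x ]≡ a → lT[ proj₁ y ]≡ c → a ℕ.+ length ts ≡ c →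
                   proj₁ x ⁻¹ ∙ proj₁ y ≈ foldr _∙_ ε ts → T (proj₁ x ⁻¹ ∙ proj₁ y)
      first-step _ _ ((_ , x≉y) , _) [] _ _ _ _ e = contradiction (quot-ε e) x≉y
      first-step {w} (x , _ , x⪯w) (y , _ , y⪯w) (_ , none) (t ∷ ts) (t∈T ∷ ts∈T) {a} {c} p r l e =
        T-resp (trans (sym (cancel′ x t)) (∙-congˡ z≈y)) t∈T
        where
        b : ℕ
        b = length ts

        z : Carrier
        z = x ∙ t

        t-prod : x ⁻¹ ∙ z IsProductOf 1
        t-prod = t ∷ [] , t∈T ∷ [] , ≡.refl ,
                 trans (cancel′ x t) (sym (identityʳ t))

        ts-prod : z ⁻¹ ∙ y IsProductOf b
        ts-prod = ts , ts∈T , ≡.refl ,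
          trans (∙-congˡ (trans (sym (cancel x y)) (trans (∙-congˡ e) (sym (assoc x t _)))))
                (cancel′ z (foldr _∙_ ε ts))

        l′ : (a ℕ.+ 1) ℕ.+ b ≡ c
        l′ = ≡.trans (ℕ.+-assoc a 1 b) l

        lz : lT[ z ]≡ (a ℕ.+ 1)
        lz = prod-quot (proj₁ p) t-prod , λ {j} s →
          ℕ.+-cancelʳ-≤ b (a ℕ.+ 1) j
            (≡.subst (ℕ._≤ j ℕ.+ b) (≡.sym l′) (proj₂ r (prod-quot s ts-prod)))

        lt : lT[ x ⁻¹ ∙ z ]≡ 1
        lt = t-prod , λ {j} s → ℕ.+-cancelˡ-≤ a 1 j (proj₂ lz (prod-quot (proj₁ p) s))

        lts : lT[ z ⁻¹ ∙ y ]≡ b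
        lts = ts-prod , λ {j} s → ℕ.+-cancelˡ-≤ (a ℕ.+ 1) b j
          (≡.subst (ℕ._≤ (a ℕ.+ 1) ℕ.+ j) (≡.sym l′) (proj₂ r (prod-quot (proj₁ lz) s)))

        x⪯z : x ⪯ z
        x⪯z = a , 1 , a ℕ.+ 1 , p , lt , lz , ≡.refl

        z⪯y : z ⪯ y
        z⪯y = a ℕ.+ 1 , b , c , lz , lts , r , l′

        x≉z : ¬ (x ≈ z)
        x≉z q = ℕ.m+1+n≢m a (≡.sym (length-unique (length-resp q p) lz))

        z≈y : z ≈ y
        z≈y = ≈-stable λ z≉y →
          none (z , ε⪯ lz , ⪯-trans z⪯y y⪯w) ((x⪯z , x≉z) , (z⪯y , z≉y))

    cover-label : ∀ {w x y} → Covering._⋖_ (NC w) x y → T (proj₁ x ⁻¹ ∙ proj₁ y)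
    cover-label {x = x} {y} e@(((_ , _ , _ , p , ((ts , ts∈T , ≡.refl , q) , _) , r , l) , _) , _) =
      first-step x y e ts ts∈T p r l q


module EdgeLabelings {a ℓ₁ ℓ₂ b ℓ₃ ℓ₄} (P : Poset a ℓ₁ ℓ₂) (L : StrictTotalOrder b ℓ₃ ℓ₄)
                     (label : ∀ x y → Covering._⋖_ P x y → StrictTotalOrder.Carrier L) where
  open Poset P using () renaming (Carrier to A)
  open PosetProperties P using (_<_)
  open StrictTotalOrder L using () renaming (Carrier to Λ; _≈_ to _≈ᴸ_; _<_ to _<ᴸ_)
  open Covering P

  labels : ∀ {u v} → MaximalChain u v → List Λ
  labels done                     = []
  labels {u} (_◅_ {j = x} e xs) = label u x e ∷ labels xs

  Rising : ∀ {u v} → Pred (MaximalChain u v) _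
  Rising c = Linked _<ᴸ_ (labels c)

  infix 4 _≤ˡᵉˣ_
  _≤ˡᵉˣ_ : ∀ {u v} → Rel (MaximalChain u v) _
  c ≤ˡᵉˣ d = Lex-≤ _≈ᴸ_ _<ᴸ_ (labels c) (labels d)

  LexSmallest : ∀ {u v} → Pred (MaximalChain u v) _
  LexSmallest {u} {v} c = ∀ (d : MaximalChain u v) → c ≤ˡᵉˣ d

  -- The notion is meant for finite bounded graded P, where all maximal chains
  -- of an interval have the same length.  [u , v] is non-singleton exactly
  -- when u < v.
  IsELLabeling : Set _
  IsELLabeling = ∀ {u v} → u < v → Σ[ c ∈ MaximalChain u v ]
    Rising c × (∀ d → Rising d → d ≋ c) × LexSmallest c


-- For a root system Φ of W with positive system Φ⁺.

module NoncrossingPartitions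
  {ℝ : Reals} {dim : ℕ} {E : EuclideanSpace ℝ dim} {𝑾 : ReflectionGroup E}
  (𝚽 : RootSystem 𝑾)
  where
  open Reals ℝ using (0#) renaming (_≈_ to _≈ℝ_; _<_ to _<ℝ_)
  open EuclideanSpace E
  open ReflectionGroup 𝑾
  open RootSystem 𝚽
  open SimpleSystems E
  open AbsoluteOrder group IsReflection public

  private
    ≈ᴹ-stable : ∀ {x y} → ¬ ¬ (x ≈ᴹ y) → x ≈ᴹ y
    ≈ᴹ-stable {x} {y} ¬¬e =
      ≈ᴹ-trans (inverseʳ-unique (-ᴹ y) x (≈ᴹ-trans (+ᴹ-comm (-ᴹ y) x) (⟨⟩-def d²≈0)))
               (⁻¹-involutive y)
      where
      module ℝ = Reals ℝ
      open GroupProperties +ᴹ-group using (inverseʳ-unique; ⁻¹-involutive)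

      d : V
      d = x +ᴹ -ᴹ y

      0²≈0 : ⟨ 0ᴹ , 0ᴹ ⟩ ≈ℝ 0#
      0²≈0 = ℝ.trans (⟨⟩-cong (≈ᴹ-sym (*ₗ-zeroˡ 0ᴹ)) ≈ᴹ-refl)
                     (ℝ.trans (⟨⟩-*ˡ 0# 0ᴹ 0ᴹ) (ℝ.zeroˡ _))

      d²-eq : x ≈ᴹ y → ⟨ d , d ⟩ ≈ℝ 0#
      d²-eq e = ℝ.trans (⟨⟩-cong d≈0 d≈0) 0²≈0
        where
        d≈0 : d ≈ᴹ 0ᴹ
        d≈0 = ≈ᴹ-trans (+ᴹ-congʳ e) (-ᴹ‿inverseʳ y)

      d²≈0 : ⟨ d , d ⟩ ≈ℝ 0#
      d²≈0 with IsStrictTotalOrder.compare ℝ.isStrictTotalOrder ⟨ d , d ⟩ 0#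
      ... | tri< _ d²≉0 _ = contradiction (λ e → d²≉0 (d²-eq e)) ¬¬e
      ... | tri≈ _ e    _ = e
      ... | tri> _ d²≉0 _ = contradiction (λ e → d²≉0 (d²-eq e)) ¬¬e

  -- Every covering relation of NC is labeled by a reflection.
  natural : ∀ γ u v → Covering._⋖_ (NC γ) u v → T
  natural γ u v u⋖v = proj₁ u ⁻¹ ∙ proj₁ v , cover-label
    (λ { x≈y (α , α≉0 , r) → α , α≉0 , λ z → ≈ᴹ-trans (·-congˡ (sym x≈y) z) (r z) })
    (λ ¬¬e → ·-faithful λ z → ≈ᴹ-stable λ ne → ¬¬e λ x≈y → ne (·-congˡ x≈y z))
    {γ} {u} {v} u⋖v

  T-strictTotalOrder : {_<_ : Rel T 0ℓ} → IsStrictTotalOrder _≈ᵀ_ _<_ → StrictTotalOrder 0ℓ 0ℓ 0ℓ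
  T-strictTotalOrder isTotal = record { isStrictTotalOrder = isTotal }

  -- The order of the factors is arbitrary because Δ is an arbitrary
  -- enumeration of the simple roots.
  IsCoxeterElement : Pred W 0ℓ
  IsCoxeterElement γ =
    ∃[ n ] Σ[ Δ ∈ Vector V n ] Σ[ s ∈ IsSimpleSystem Φ Δ ]
      γ ≈ product (λ i → proj₁ (t (IsSimpleSystem.roots s i)))

  module _ {Φ⁺ : Pred V 0ℓ} (Φ⁺⊆Φ : Φ⁺ ⊆ Φ) (_<_ : Rel T 0ℓ) where

    IsReflectionOrdering : Set
    IsReflectionOrdering =
      ∀ {α α₁ α₂} (p : α ∈ Φ⁺) (p₁ : α₁ ∈ Φ⁺) (p₂ : α₂ ∈ Φ⁺) →
      ¬ (α ≈ᴹ α₁) → ¬ (α ≈ᴹ α₂) → ¬ (α₁ ≈ᴹ α₂) →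
      ∀ {c₁ c₂} → 0# <ℝ c₁ → 0# <ℝ c₂ → α ≈ᴹ c₁ *ₗ α₁ +ᴹ c₂ *ₗ α₂ →
      let t₀ = t (Φ⁺⊆Φ p) ; t₁ = t (Φ⁺⊆Φ p₁) ; t₂ = t (Φ⁺⊆Φ p₂) in
      (t₁ < t₀ × t₀ < t₂) ⊎ (t₂ < t₀ × t₀ < t₁)

    -- Φ′ runs over the rank 2 induced subsystems.
    IsCompatible : W → Set₁
    IsCompatible γ =
      ∀ {β₁ β₂} → β₁ ∈ Φ → β₂ ∈ Φ → Independent (β₁ Vector.∷ β₂ Vector.∷ Vector.[]) →
      let Φ′ = Φ ∩ Span (β₁ Vector.∷ β₂ Vector.∷ Vector.[]) in
      Irreducible Φ′ →
      ∀ {α β} (p : α ∈ Φ⁺) (q : β ∈ Φ⁺) →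
      IsSimpleSystemOf Φ′ (Φ′ ∩ Φ⁺) (α Vector.∷ β Vector.∷ Vector.[]) →
      let tα = t (Φ⁺⊆Φ p) ; tβ = t (Φ⁺⊆Φ q) in
      InNC γ (proj₁ tα ∙ proj₁ tβ) → tα < tβ

{-# OPTIONS --safe #-}

-- Maximal chains of an interval [u , v] are the shortest factorizations of
-- w = u⁻¹ v into reflections.  A descent t > t′ can be replaced by the
-- lexicographically smaller t′ (t′⁻¹ t t′), so the smallest factorization rises.
--
-- For the uniqueness of rising factorizations, extend them to shortest
-- factorizations of γ = s₁ ⋯ sₙ.  As γ has no nonzero fixed vector, their roots
-- form a basis of V.  By comparing the triangular systems that express 1 - γ in
-- terms of these roots and of the simple roots, they form a ℤ-basis of the root
-- lattice, and their coroots one of the coroot lattice.  Compatibility forces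
-- the positive roots of a rising factorization to be pairwise obtuse.  Together
-- with integrality this makes all roots in their span nonnegative or nonpositive
-- combinations of them.  So the roots of two rising factorizations of w are
-- nonnegative combinations of each other, hence agree up to order, and the
-- order is determined by rising.

module Submission where

open import Defs
open import Algebra.Bundles using (Group)
open import Algebra.Module.Morphism.Structures using (module IsModuleHomomorphism)
import Algebra.Properties.Group as GroupProperties
import Algebra.Properties.Monoid.Mult.TCOptimised as OptimisedMult
import Algebra.Properties.Ring
import Algebra.Properties.Semiring.Mult
import Algebra.Properties.Semiring.Sum
import Algebra.Solver.Ring
open import Algebra.Solver.Ring.AlmostCommutativeRing using (fromCommutativeRing; _-Raw-AlmostCommutative⟶_)
open import Data.Empty using (⊥)
open import Data.Fin.Base using (Fin; zero; suc; punchIn; punchOut)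
import Data.Fin.Induction as FinInduction
open import Data.Fin.Properties using (any?; all?; ¬∀⟶∃¬; punchIn-punchOut; suc-injective) renaming (_≟_ to _≟ᶠ_)
open import Data.Integer.Base as ℤ using (ℤ; +_; -[1+_])
import Data.Integer.Properties as ℤ
open import Data.List.Base using (List; []; _∷_; _++_; [_]; foldr; length; lookup; map)
open import Data.List.Membership.Propositional.Properties using (∈-lookup)
open import Data.List.Properties using (length-++; length-map)
open import Data.List.Relation.Binary.Lex.Strict as Lex using (Lex-≤; this; next; base)
open import Data.List.Relation.Binary.Pointwise as Pointwise using (Pointwise; []; _∷_)
open import Data.List.Relation.Unary.All as All using (All; []; _∷_)
open import Data.List.Relation.Unary.AllPairs as AllPairs using (AllPairs; []; _∷_)
open import Data.List.Relation.Unary.Any as Any using (Any; here; there)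
open import Data.List.Relation.Unary.Linked as Linked using (Linked; []; [-]; _∷_)
open import Data.List.Relation.Unary.Linked.Properties using (Linked⇒AllPairs)
open import Data.Maybe.Base as Maybe using (Maybe)
open import Data.Nat.Base as ℕ using (ℕ; zero; suc; s≤s)
import Data.Nat.Properties as ℕ
open import Data.Product.Base using (Σ-syntax; ∃; ∃-syntax; _×_; _,_; proj₁; proj₂)
open import Data.Sum.Base using (_⊎_; inj₁; inj₂)
import Data.Vec.Functional as Vector
open import Data.Vec.Functional using (Vector)
open import Function.Base using (_on_; _∘_)
open import Function.Bundles using (Equivalence; mk⇔)
open import Induction.WellFounded using (WellFounded; Acc; acc)
open import Level using (0ℓ)
open import Relation.Binary.Bundles using (StrictTotalOrder)
open import Relation.Binary.Construct.Closure.ReflexiveTransitive using (_◅_) renaming (ε to done)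
open import Relation.Binary.Core using (Rel)
open import Relation.Binary.Definitions using (Tri; tri<; tri≈; tri>; Decidable)
import Relation.Binary.Properties.Poset as PosetProperties
open import Relation.Binary.PropositionalEquality as ≡ using (_≡_)
open import Relation.Binary.Structures using (IsStrictTotalOrder; IsStrictPartialOrder)
open import Relation.Nullary.Decidable using (Dec; yes; no; map′; dec⇒maybe; decidable-stable; ¬?)
open import Relation.Nullary.Negation.Core using (¬_; contradiction)
open import Relation.Unary using (Pred; _∈_; _⊆_; _∩_)

-- An obtuse basis consisting of roots need not be a simple system, even if it generates the root
-- lattice: in type B2 the short roots `e1`, `e2` are orthogonal and span the root lattice over ℤ,
-- yet `e1 - e2` is a root of mixed sign. Hence the coroot lattice is carried along throughout. If a
-- root `x` has integral coordinates `c i` along roots `α i`, and `coroot x` has integral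
-- coordinates `c′ i` along their coroots, then `c i ⟨ α i , α i ⟩ = c′ i ⟨ x , x ⟩`. So the
-- positive and negative parts of `x` have square lengths that are integral multiples of
-- `⟨ x , x ⟩`, which rules out mixed signs.
--
-- Only the roots of `w` are known to be obtuse, not those added to reach `γ`. The dual vectors
-- belonging to the added roots are orthogonal to the roots of `w`, hence fixed by `w`, hence
-- orthogonal to the roots of any other shortest factorization of `w`; so the added roots never
-- enter a coordinate that matters. For this comparison both factorizations of `w` are completed by
-- the same list.

-- Arithmetic of the ordered field: signs, finite sums, integers.

module OrderedField (ℝ : Reals) where
  open Reals ℝ public hiding (zero)
  open IsStrictTotalOrder isStrictTotalOrder public
    using (compare; _≟_; <-respˡ-≈; <-respʳ-≈) renaming (trans to <-trans; irrefl to <-irrefl)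
  open Algebra.Properties.Ring ring public
    using (-‿involutive; -0#≈0#; -‿distribˡ-*; -‿distribʳ-*; -‿+-comm; x∙y⁻¹≈ε⇒x≈y)
  open Algebra.Properties.Semiring.Mult semiring
    using (×-homo-+; ×1-homo-*) renaming (_×_ to _×ᴺ_)
  open OptimisedMult +-monoid using (×ᵤ≈×) renaming (_×_ to _×′_)
  open import Algebra.Properties.Semiring.Sum semiring public
    using (sum; sum-cong-≋; ∑-distrib-+; *-distribˡ-sum)
  open import Relation.Binary.Reasoning.Setoid setoid

  fromℤ-⊖ : ∀ m n → fromℤ (m ℤ.⊖ n) ≈ m ×ᴺ 1# + - (n ×ᴺ 1#)
  fromℤ-⊖ zero    zero    = sym (-‿inverseʳ 0#)
  fromℤ-⊖ zero    (suc n) = sym (+-identityˡ _)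
  fromℤ-⊖ (suc m) zero    = sym (trans (+-congˡ -0#≈0#) (+-identityʳ _))
  fromℤ-⊖ (suc m) (suc n) = begin
    fromℤ (suc m ℤ.⊖ suc n)               ≡⟨ ≡.cong fromℤ (ℤ.[1+m]⊖[1+n]≡m⊖n m n) ⟩
    fromℤ (m ℤ.⊖ n)                       ≈⟨ fromℤ-⊖ m n ⟩
    p + - q                               ≈⟨ +-identityˡ _ ⟨
    0# + (p + - q)                        ≈⟨ +-congʳ (-‿inverseʳ 1#) ⟨
    (1# + - 1#) + (p + - q)               ≈⟨ +-assoc _ _ _ ⟩
    1# + (- 1# + (p + - q))               ≈⟨ +-congˡ (+-assoc _ _ _) ⟨
    1# + ((- 1# + p) + - q)               ≈⟨ +-congˡ (+-congʳ (+-comm _ _)) ⟩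
    1# + ((p + - 1#) + - q)               ≈⟨ +-congˡ (+-assoc _ _ _) ⟩
    1# + (p + (- 1# + - q))               ≈⟨ +-assoc _ _ _ ⟨
    (1# + p) + (- 1# + - q)               ≈⟨ +-congˡ (-‿+-comm 1# q) ⟩
    (1# + p) + - (1# + q)                 ∎
    where
    p = m ×ᴺ 1#
    q = n ×ᴺ 1#

  fromℤ-+ : ∀ i j → fromℤ (i ℤ.+ j) ≈ fromℤ i + fromℤ j
  fromℤ-+ (+ m)    (+ n)    = ×-homo-+ 1# m n
  fromℤ-+ (+ m)    -[1+ n ] = fromℤ-⊖ m (suc n)
  fromℤ-+ -[1+ m ] (+ n)    = trans (fromℤ-⊖ n (suc m)) (+-comm _ _)
  fromℤ-+ -[1+ m ] -[1+ n ] = begin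
    - (1# + (1# + (m ℕ.+ n) ×ᴺ 1#))       ≈⟨ -‿cong (+-congˡ (×-homo-+ 1# (suc m) n)) ⟩
    - (1# + (suc m ×ᴺ 1# + n ×ᴺ 1#))      ≈⟨ -‿cong (trans (+-comm _ _) (+-assoc _ _ _)) ⟩
    - (suc m ×ᴺ 1# + (n ×ᴺ 1# + 1#))      ≈⟨ -‿cong (+-congˡ (+-comm _ _)) ⟩
    - (suc m ×ᴺ 1# + suc n ×ᴺ 1#)         ≈⟨ -‿+-comm _ _ ⟨
    - (suc m ×ᴺ 1#) + - (suc n ×ᴺ 1#)     ∎

  fromℤ-neg : ∀ i → fromℤ (ℤ.- i) ≈ - fromℤ i
  fromℤ-neg (+ zero)  = sym -0#≈0#
  fromℤ-neg (+ suc n) = refl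
  fromℤ-neg -[1+ n ]  = sym (-‿involutive _)

  private
    fromℤ-*⁺ : ∀ m j → fromℤ (+ m ℤ.* j) ≈ fromℤ (+ m) * fromℤ j
    fromℤ-*⁺ m (+ n)    = trans (reflexive (≡.cong fromℤ (≡.sym (ℤ.pos-* m n)))) (×1-homo-* m n)
    fromℤ-*⁺ m -[1+ n ] = begin
      fromℤ (+ m ℤ.* -[1+ n ])             ≡⟨ ≡.cong fromℤ (ℤ.neg-distribʳ-* (+ m) (+ suc n)) ⟨
      fromℤ (ℤ.- (+ m ℤ.* + suc n))        ≈⟨ fromℤ-neg (+ m ℤ.* + suc n) ⟩
      - fromℤ (+ m ℤ.* + suc n)            ≈⟨ -‿cong (fromℤ-*⁺ m (+ suc n)) ⟩
      - (fromℤ (+ m) * fromℤ (+ suc n))    ≈⟨ -‿distribʳ-* _ _ ⟩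
      fromℤ (+ m) * fromℤ -[1+ n ]         ∎

  fromℤ-* : ∀ i j → fromℤ (i ℤ.* j) ≈ fromℤ i * fromℤ j
  fromℤ-* (+ m)    j = fromℤ-*⁺ m j
  fromℤ-* -[1+ m ] j = begin
    fromℤ (-[1+ m ] ℤ.* j)                 ≡⟨ ≡.cong fromℤ (ℤ.neg-distribˡ-* (+ suc m) j) ⟨
    fromℤ (ℤ.- (+ suc m ℤ.* j))            ≈⟨ fromℤ-neg (+ suc m ℤ.* j) ⟩
    - fromℤ (+ suc m ℤ.* j)                ≈⟨ -‿cong (fromℤ-*⁺ (suc m) j) ⟩
    - (fromℤ (+ suc m) * fromℤ j)          ≈⟨ -‿distribˡ-* _ _ ⟩
    fromℤ -[1+ m ] * fromℤ j               ∎

  -- The values of the coefficients 1 and 2 are literally 1# and 2#, which is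
  -- not the case for fromℤ.
  private
    coefficient : ℤ → Carrier
    coefficient (+ n)    = n ×′ 1#
    coefficient -[1+ n ] = - (suc n ×′ 1#)

    coefficient≈ : ∀ i → coefficient i ≈ fromℤ i
    coefficient≈ (+ n)    = sym (×ᵤ≈× n 1#)
    coefficient≈ -[1+ n ] = -‿cong (sym (×ᵤ≈× (suc n) 1#))

    hom : ℤ.+-*-rawRing -Raw-AlmostCommutative⟶ fromCommutativeRing commutativeRing
    hom = record
      { ⟦_⟧    = coefficient
      ; +-homo = λ i j → trans (coefficient≈ (i ℤ.+ j))
          (trans (fromℤ-+ i j) (sym (+-cong (coefficient≈ i) (coefficient≈ j))))
      ; *-homo = λ i j → trans (coefficient≈ (i ℤ.* j))
          (trans (fromℤ-* i j) (sym (*-cong (coefficient≈ i) (coefficient≈ j))))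
      ; -‿homo = λ i → trans (coefficient≈ (ℤ.- i))
          (trans (fromℤ-neg i) (-‿cong (sym (coefficient≈ i))))
      ; 0-homo = refl
      ; 1-homo = refl
      }

    coefficient-≟ : ∀ i j → Maybe (coefficient i ≈ coefficient j)
    coefficient-≟ i j = Maybe.map (reflexive ∘ ≡.cong coefficient) (dec⇒maybe (i ℤ.≟ j))

  open Algebra.Solver.Ring ℤ.+-*-rawRing (fromCommutativeRing commutativeRing) hom coefficient-≟
    public using (solve; _:=_; con; _:+_; _:*_; _:-_; :-_)

  0≤1 : 0# ≤ 1#
  0≤1 = inj₁ 0<1

  ≤-respʳ : ∀ {x y z} → y ≈ z → x ≤ y → x ≤ z
  ≤-respʳ y≈z (inj₁ x<y) = inj₁ (<-respʳ-≈ y≈z x<y)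
  ≤-respʳ y≈z (inj₂ x≈y) = inj₂ (trans x≈y y≈z)

  ≤-respˡ : ∀ {x y z} → x ≈ y → x ≤ z → y ≤ z
  ≤-respˡ x≈y (inj₁ x<z) = inj₁ (<-respˡ-≈ x≈y x<z)
  ≤-respˡ x≈y (inj₂ x≈z) = inj₂ (trans (sym x≈y) x≈z)

  <-≤-trans : ∀ {x y z} → x < y → y ≤ z → x < z
  <-≤-trans x<y (inj₁ y<z) = <-trans x<y y<z
  <-≤-trans x<y (inj₂ y≈z) = <-respʳ-≈ y≈z x<y

  ≤⇒≯ : ∀ {x y} → x ≤ y → ¬ (y < x)
  ≤⇒≯ x≤y y<x = <-irrefl refl (<-≤-trans y<x x≤y)

  ≤-antisym : ∀ {x y} → x ≤ y → y ≤ x → x ≈ y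
  ≤-antisym (inj₂ x≈y) _   = x≈y
  ≤-antisym (inj₁ x<y) y≤x = contradiction x<y (≤⇒≯ y≤x)

  <⇒≉ : ∀ {x} → 0# < x → ¬ (x ≈ 0#)
  <⇒≉ 0<x x≈0 = <-irrefl (sym x≈0) 0<x

  ≮⇒≥ : ∀ {x y} → ¬ (x < y) → y ≤ x
  ≮⇒≥ {x} {y} x≮y with compare x y
  ... | tri< x<y _ _ = contradiction x<y x≮y
  ... | tri≈ _ x≈y _ = inj₂ (sym x≈y)
  ... | tri> _ _ y<x = inj₁ y<x

  _<?_ : Decidable _<_
  x <? y with compare x y
  ... | tri< x<y _ _ = yes x<y
  ... | tri≈ x≮y _ _ = no x≮y
  ... | tri> x≮y _ _ = no x≮y

  +-pos : ∀ {x y} → 0# < x → 0# ≤ y → 0# < x + y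
  +-pos {x} {y} 0<x (inj₂ 0≈y) = <-respʳ-≈ (trans (sym (+-identityʳ x)) (+-congˡ 0≈y)) 0<x
  +-pos {x} {y} 0<x (inj₁ 0<y) = <-trans 0<x (<-respˡ-≈ (+-identityʳ x) (+-monoʳ-< x 0<y))

  +-nonneg : ∀ {x y} → 0# ≤ x → 0# ≤ y → 0# ≤ x + y
  +-nonneg (inj₁ 0<x) 0≤y = inj₁ (+-pos 0<x 0≤y)
  +-nonneg {x} {y} (inj₂ 0≈x) 0≤y = ≤-respʳ (trans (sym (+-identityˡ y)) (+-congʳ 0≈x)) 0≤y

  *-nonneg : ∀ {x y} → 0# ≤ x → 0# ≤ y → 0# ≤ x * y
  *-nonneg (inj₁ 0<x) (inj₁ 0<y) = inj₁ (*-pos 0<x 0<y)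
  *-nonneg {x} _ (inj₂ 0≈y) = inj₂ (sym (trans (*-congˡ (sym 0≈y)) (zeroʳ x)))
  *-nonneg {_} {y} (inj₂ 0≈x) _ = inj₂ (sym (trans (*-congʳ (sym 0≈x)) (zeroˡ y)))

  x<y⇒0<y-x : ∀ {x y} → x < y → 0# < y - x
  x<y⇒0<y-x {x} {y} x<y =
    <-respˡ-≈ (-‿inverseˡ x) (<-respʳ-≈ (+-comm (- x) y) (+-monoʳ-< (- x) x<y))

  0<y-x⇒x<y : ∀ {x y} → 0# < y - x → x < y
  0<y-x⇒x<y {x} {y} 0<y-x = <-respˡ-≈ (+-identityʳ x)
    (<-respʳ-≈ (solve 2 (λ x y → x :+ (y :- x) := y) refl x y) (+-monoʳ-< x 0<y-x))

  neg-pos : ∀ {x} → x < 0# → 0# < - x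
  neg-pos x<0 = <-respʳ-≈ (+-identityˡ _) (x<y⇒0<y-x x<0)

  pos-neg : ∀ {x} → 0# < x → - x < 0#
  pos-neg {x} 0<x = 0<y-x⇒x<y (<-respʳ-≈ (solve 1 (λ x → x := con (+ 0) :- (:- x)) refl x) 0<x)

  nonpos⇒neg-nonneg : ∀ {x} → x ≤ 0# → 0# ≤ - x
  nonpos⇒neg-nonneg (inj₁ x<0) = inj₁ (neg-pos x<0)
  nonpos⇒neg-nonneg (inj₂ x≈0) = inj₂ (sym (trans (-‿cong x≈0) -0#≈0#))

  nonneg⇒neg-nonpos : ∀ {x} → 0# ≤ x → - x ≤ 0#
  nonneg⇒neg-nonpos (inj₁ 0<x) = inj₁ (pos-neg 0<x)
  nonneg⇒neg-nonpos (inj₂ 0≈x) = inj₂ (trans (-‿cong (sym 0≈x)) -0#≈0#)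

  neg-nonneg⇒nonpos : ∀ {x} → 0# ≤ - x → x ≤ 0#
  neg-nonneg⇒nonpos {x} 0≤-x with nonneg⇒neg-nonpos 0≤-x
  ... | inj₁ lt = inj₁ (<-respˡ-≈ (-‿involutive x) lt)
  ... | inj₂ eq = inj₂ (trans (sym (-‿involutive x)) eq)

  *-nonneg-nonpos : ∀ {x y} → 0# ≤ x → y ≤ 0# → x * y ≤ 0#
  *-nonneg-nonpos {x} {y} 0≤x y≤0 = neg-nonneg⇒nonpos
    (≤-respʳ (sym (-‿distribʳ-* x y)) (*-nonneg 0≤x (nonpos⇒neg-nonneg y≤0)))

  0<2 : 0# < 2#
  0<2 = +-pos 0<1 0≤1

  x*y≈0⇒y≈0 : ∀ {x y} → ¬ (x ≈ 0#) → x * y ≈ 0# → y ≈ 0#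
  x*y≈0⇒y≈0 {x} {y} x≉0 xy≈0 = begin
    y                ≈⟨ *-identityˡ y ⟨
    1# * y           ≈⟨ *-congʳ (⁻¹-inverseʳ x≉0) ⟨
    x * x ⁻¹ * y     ≈⟨ solve 3 (λ x x′ y → x :* x′ :* y := x′ :* (x :* y)) refl x (x ⁻¹) y ⟩
    x ⁻¹ * (x * y)   ≈⟨ *-congˡ xy≈0 ⟩
    x ⁻¹ * 0#        ≈⟨ zeroʳ _ ⟩
    0#               ∎

  *-cancelˡ-pos : ∀ {x y} → 0# < x → 0# < x * y → 0# < y
  *-cancelˡ-pos {x} {y} 0<x 0<xy with compare 0# y
  ... | tri< 0<y _ _ = 0<y
  ... | tri≈ _ 0≈y _ = contradiction (trans (*-congˡ (sym 0≈y)) (zeroʳ x)) (<⇒≉ 0<xy)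
  ... | tri> _ _ y<0 = contradiction 0<xy (≤⇒≯ (*-nonneg-nonpos (inj₁ 0<x) (inj₁ y<0)))

  ⁻¹-pos : ∀ {x} → 0# < x → 0# < x ⁻¹
  ⁻¹-pos 0<x = *-cancelˡ-pos 0<x (<-respʳ-≈ (sym (⁻¹-inverseʳ (<⇒≉ 0<x))) 0<1)

  sum-zero : ∀ {n} (f : Vector Carrier n) → (∀ i → f i ≈ 0#) → sum f ≈ 0#
  sum-zero {zero}  f f≈0 = refl
  sum-zero {suc n} f f≈0 = trans (+-cong (f≈0 zero) (sum-zero (f ∘ suc) (f≈0 ∘ suc))) (+-identityˡ 0#)

  sum-nonneg : ∀ {n} (f : Vector Carrier n) → (∀ i → 0# ≤ f i) → 0# ≤ sum f
  sum-nonneg {zero}  f 0≤f = inj₂ refl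
  sum-nonneg {suc n} f 0≤f = +-nonneg (0≤f zero) (sum-nonneg (f ∘ suc) (0≤f ∘ suc))

  sum-nonpos : ∀ {n} (f : Vector Carrier n) → (∀ i → f i ≤ 0#) → sum f ≤ 0#
  sum-nonpos {zero}  f f≤0 = inj₂ refl
  sum-nonpos {suc n} f f≤0 = neg-nonneg⇒nonpos (≤-respʳ (-‿+-comm _ _)
    (+-nonneg (nonpos⇒neg-nonneg (f≤0 zero))
              (nonpos⇒neg-nonneg (sum-nonpos (f ∘ suc) (f≤0 ∘ suc)))))

  sum-nonneg-zero : ∀ {n} (f : Vector Carrier n) → (∀ i → 0# ≤ f i) → sum f ≈ 0# → ∀ i → f i ≈ 0#
  sum-nonneg-zero {suc n} f 0≤f Σ≈0 i with 0≤f zero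
  ... | inj₁ 0<f₀ = contradiction Σ≈0 (<⇒≉ (+-pos 0<f₀ (sum-nonneg (f ∘ suc) (0≤f ∘ suc))))
  sum-nonneg-zero {suc n} f 0≤f Σ≈0 zero    | inj₂ 0≈f₀ = sym 0≈f₀
  sum-nonneg-zero {suc n} f 0≤f Σ≈0 (suc i) | inj₂ 0≈f₀ =
    sum-nonneg-zero (f ∘ suc) (0≤f ∘ suc)
      (trans (sym (+-identityˡ _)) (trans (+-congʳ 0≈f₀) Σ≈0)) i

  sum-single : ∀ {n} (f : Vector Carrier n) i → (∀ j → ¬ (j ≡ i) → f j ≈ 0#) → sum f ≈ f i
  sum-single {suc n} f zero    f≈0 =
    trans (+-congˡ (sum-zero (f ∘ suc) (λ j → f≈0 (suc j) (λ ())))) (+-identityʳ _)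
  sum-single {suc n} f (suc i) f≈0 =
    trans (+-cong (f≈0 zero (λ ())) (sum-single (f ∘ suc) i (λ j j≢i → f≈0 (suc j) (λ { ≡.refl → j≢i ≡.refl }))))
          (+-identityˡ _)

  IsInteger : Carrier → Set
  IsInteger x = ∃[ k ] x ≈ fromℤ k

  Int-resp : ∀ {x y} → x ≈ y → IsInteger x → IsInteger y
  Int-resp x≈y (k , x≈k) = k , trans (sym x≈y) x≈k

  Int-0 : IsInteger 0#
  Int-0 = + 0 , refl

  Int-1 : IsInteger 1#
  Int-1 = + 1 , sym (+-identityʳ 1#)

  Int-+ : ∀ {x y} → IsInteger x → IsInteger y → IsInteger (x + y)
  Int-+ (i , x≈i) (j , y≈j) = i ℤ.+ j , trans (+-cong x≈i y≈j) (sym (fromℤ-+ i j))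

  Int-* : ∀ {x y} → IsInteger x → IsInteger y → IsInteger (x * y)
  Int-* (i , x≈i) (j , y≈j) = i ℤ.* j , trans (*-cong x≈i y≈j) (sym (fromℤ-* i j))

  Int-neg : ∀ {x} → IsInteger x → IsInteger (- x)
  Int-neg (i , x≈i) = ℤ.- i , trans (-‿cong x≈i) (sym (fromℤ-neg i))

  Int-sum : ∀ {n} (f : Vector Carrier n) → (∀ i → IsInteger (f i)) → IsInteger (sum f)
  Int-sum {zero}  f int = Int-0
  Int-sum {suc n} f int = Int-+ (int zero) (Int-sum (f ∘ suc) (int ∘ suc))

  private
    ×1-nonneg : ∀ n → 0# ≤ n ×ᴺ 1#
    ×1-nonneg zero    = inj₂ refl
    ×1-nonneg (suc n) = +-nonneg 0≤1 (×1-nonneg n)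

  -- Discreteness of ℤ. It provides the gap in `obtuse⇒same-sign`: a positive integral multiple of
  -- `⟨ x , x ⟩` is at least `⟨ x , x ⟩`.
  Int-pos⇒1≤ : ∀ {x} → IsInteger x → 0# < x → 0# ≤ x - 1#
  Int-pos⇒1≤ (+ zero , x≈0) 0<x = contradiction x≈0 (<⇒≉ 0<x)
  Int-pos⇒1≤ {x} (+ suc n , x≈1+n) _ = ≤-respʳ (begin
    n ×ᴺ 1#                  ≈⟨ solve 2 (λ a b → a := (b :+ a) :- b) refl (n ×ᴺ 1#) 1# ⟩
    (1# + n ×ᴺ 1#) - 1#      ≈⟨ +-congʳ x≈1+n ⟨
    x - 1#                   ∎) (×1-nonneg n)
  Int-pos⇒1≤ (-[1+ n ] , x≈) 0<x = contradiction (<-respʳ-≈ x≈ 0<x)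
    (≤⇒≯ (nonneg⇒neg-nonpos (×1-nonneg (suc n))))

-- Linear algebra by pairings: elimination and dual bases.

module EuclideanLemmas {ℝ : Reals} {dim : ℕ} (E : EuclideanSpace ℝ dim) where
  open OrderedField ℝ
  open EuclideanSpace E

  ⟨⟩-zeroˡ : ∀ y → ⟨ 0ᴹ , y ⟩ ≈ 0#
  ⟨⟩-zeroˡ y = trans (⟨⟩-cong (≈ᴹ-sym (*ₗ-zeroˡ y)) ≈ᴹ-refl) (trans (⟨⟩-*ˡ 0# y y) (zeroˡ _))

  ⟨⟩-negˡ : ∀ x y → ⟨ -ᴹ x , y ⟩ ≈ - ⟨ x , y ⟩
  ⟨⟩-negˡ x y = trans (solve 2 (λ a b → a := (a :+ b) :- b) refl ⟨ -ᴹ x , y ⟩ ⟨ x , y ⟩)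
    (trans (+-congʳ (trans (sym (⟨⟩-+ˡ (-ᴹ x) x y)) (trans (⟨⟩-cong (-ᴹ‿inverseˡ x) ≈ᴹ-refl) (⟨⟩-zeroˡ y))))
           (+-identityˡ _))

  -- Vector identities are proved by pairing both sides with an arbitrary
  -- vector, which turns them into identities of scalars.
  data Expr : Set where
    ‵_  : V → Expr
    _⊕_ : Expr → Expr → Expr
    ⊖_  : Expr → Expr
    _⊛_ : Carrier → Expr → Expr

  infix  9 ‵_
  infixr 8 _⊛_
  infix  8 ⊖_
  infixl 6 _⊕_

  ⟦_⟧ : Expr → V
  ⟦ ‵ x ⟧    = x
  ⟦ e ⊕ f ⟧  = ⟦ e ⟧ +ᴹ ⟦ f ⟧
  ⟦ ⊖ e ⟧    = -ᴹ ⟦ e ⟧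
  ⟦ c ⊛ e ⟧  = c *ₗ ⟦ e ⟧

  pairing : Expr → V → Carrier
  pairing (‵ x)   z = ⟨ x , z ⟩
  pairing (e ⊕ f) z = pairing e z + pairing f z
  pairing (⊖ e)   z = - pairing e z
  pairing (c ⊛ e) z = c * pairing e z

  ⟨⟦_⟧,_⟩ : ∀ e z → ⟨ ⟦ e ⟧ , z ⟩ ≈ pairing e z
  ⟨⟦ ‵ x   ⟧, z ⟩ = refl
  ⟨⟦ e ⊕ f ⟧, z ⟩ = trans (⟨⟩-+ˡ _ _ z) (+-cong ⟨⟦ e ⟧, z ⟩ ⟨⟦ f ⟧, z ⟩)
  ⟨⟦ ⊖ e   ⟧, z ⟩ = trans (⟨⟩-negˡ _ z) (-‿cong ⟨⟦ e ⟧, z ⟩)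
  ⟨⟦ c ⊛ e ⟧, z ⟩ = trans (⟨⟩-*ˡ c _ z) (*-congˡ ⟨⟦ e ⟧, z ⟩)

  ⟨_,⟦_⟧⟩ : ∀ z e → ⟨ z , ⟦ e ⟧ ⟩ ≈ pairing e z
  ⟨ z ,⟦ e ⟧⟩ = trans (⟨⟩-sym z ⟦ e ⟧) ⟨⟦ e ⟧, z ⟩

  x-y≈0⇒x≈y : ∀ {x y} → x +ᴹ -ᴹ y ≈ᴹ 0ᴹ → x ≈ᴹ y
  x-y≈0⇒x≈y {x} {y} x-y≈0 = ≈ᴹ-trans (≈ᴹ-sym (+ᴹ-identityʳ x)) (≈ᴹ-trans (+ᴹ-congˡ (≈ᴹ-sym (-ᴹ‿inverseˡ y)))
    (≈ᴹ-trans (≈ᴹ-sym (+ᴹ-assoc x (-ᴹ y) y)) (≈ᴹ-trans (+ᴹ-congʳ x-y≈0) (+ᴹ-identityˡ y))))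

  ⟨⟩-ext : ∀ {x y} → (∀ z → ⟨ x , z ⟩ ≈ ⟨ y , z ⟩) → x ≈ᴹ y
  ⟨⟩-ext {x} {y} eq = x-y≈0⇒x≈y (⟨⟩-def (trans ⟨⟦ ‵ x ⊕ ⊖ ‵ y ⟧, x +ᴹ -ᴹ y ⟩
    (trans (+-congʳ (eq _)) (-‿inverseʳ _))))

  vector-≈ : ∀ e f → (∀ z → pairing e z ≈ pairing f z) → ⟦ e ⟧ ≈ᴹ ⟦ f ⟧
  vector-≈ e f eq = ⟨⟩-ext λ z → trans ⟨⟦ e ⟧, z ⟩ (trans (eq z) (sym ⟨⟦ f ⟧, z ⟩))

  _≟ᴹ_ : ∀ x y → Dec (x ≈ᴹ y)
  x ≟ᴹ y = map′ (λ z → x-y≈0⇒x≈y (⟨⟩-def z))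
    (λ x≈y → trans ⟨⟦ ‵ x ⊕ ⊖ ‵ y ⟧, x +ᴹ -ᴹ y ⟩ (trans (+-congʳ (⟨⟩-cong x≈y ≈ᴹ-refl)) (-‿inverseʳ _)))
    (⟨ x +ᴹ -ᴹ y , x +ᴹ -ᴹ y ⟩ ≟ 0#)

  norm-pos : ∀ {x} → ¬ (x ≈ᴹ 0ᴹ) → 0# < ⟨ x , x ⟩
  norm-pos {x} x≉0 with ⟨⟩-nonneg x
  ... | inj₁ 0<‖x‖ = 0<‖x‖
  ... | inj₂ 0≈‖x‖ = contradiction (⟨⟩-def (sym 0≈‖x‖)) x≉0

  ⟨⟩-combinationˡ : ∀ {n} c (v : Vector V n) z → ⟨ combination c v , z ⟩ ≈ sum (λ i → c i * ⟨ v i , z ⟩)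
  ⟨⟩-combinationˡ {zero}  c v z = ⟨⟩-zeroˡ z
  ⟨⟩-combinationˡ {suc n} c v z =
    trans (⟨⟩-+ˡ _ _ z) (+-cong (⟨⟩-*ˡ _ _ z) (⟨⟩-combinationˡ (c ∘ suc) (v ∘ suc) z))

  ⟨⟩-combinationʳ : ∀ {n} c (v : Vector V n) z → ⟨ z , combination c v ⟩ ≈ sum (λ i → c i * ⟨ z , v i ⟩)
  ⟨⟩-combinationʳ c v z = trans (⟨⟩-sym z _) (trans (⟨⟩-combinationˡ c v z)
    (sum-cong-≋ λ i → *-congˡ (⟨⟩-sym (v i) z)))

  combination-≈ : ∀ {n} {c d} (v : Vector V n) → (∀ i → c i ≈ d i) → combination c v ≈ᴹ combination d v
  combination-≈ {zero}  v c≈d = ≈ᴹ-refl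
  combination-≈ {suc n} v c≈d = +ᴹ-cong (*ₗ-congʳ (c≈d zero)) (combination-≈ (v ∘ suc) (c≈d ∘ suc))

  combination-single : ∀ {n} c (v : Vector V n) i → (∀ j → ¬ (j ≡ i) → c j ≈ 0#) → combination c v ≈ᴹ c i *ₗ v i
  combination-single c v i c≈0 = ⟨⟩-ext λ z → trans (⟨⟩-combinationˡ c v z)
    (trans (sum-single _ i (λ j j≢i → trans (*-congʳ (c≈0 j j≢i)) (zeroˡ _))) (sym (⟨⟩-*ˡ _ _ z)))

  Independent⇒nonzero : ∀ {n} {v : Vector V (suc n)} → Independent v → ¬ (v zero ≈ᴹ 0ᴹ)
  Independent⇒nonzero {n} {v} ind v₀≈0 = <-irrefl (sym (ind c c·v≈0 zero)) 0<1
    where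
    c : Vector Carrier (suc n)
    c zero    = 1#
    c (suc _) = 0#

    c·v≈0 : combination c v ≈ᴹ 0ᴹ
    c·v≈0 = ≈ᴹ-trans (combination-single c v zero λ { zero 0≢0 → contradiction ≡.refl 0≢0 ; (suc _) _ → refl })
      (≈ᴹ-trans (*ₗ-identityˡ _) v₀≈0)

  private
    -- The pivot step of Gaussian elimination: subtracting multiples of `u` changes a combination
    -- only by a multiple of `u`, so independence survives in `common-kernel`.
    combination-shear : ∀ {n} (c : Vector Carrier n) (w : Vector V n) (r : Vector Carrier n) u z →
      ⟨ combination c (λ i → w i +ᴹ -ᴹ (r i *ₗ u)) , z ⟩ ≈
      - sum (λ i → c i * r i) * ⟨ u , z ⟩ + ⟨ combination c w , z ⟩
    combination-shear {zero}  c w r u z = trans (⟨⟩-zeroˡ z)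
      (trans (solve 1 (λ x → con (+ 0) := :- con (+ 0) :* x :+ con (+ 0)) refl ⟨ u , z ⟩) (+-congˡ (sym (⟨⟩-zeroˡ z))))
    combination-shear {suc n} c w r u z = trans
      (trans ⟨⟦ c zero ⊛ (‵ w zero ⊕ ⊖ r zero ⊛ ‵ u) ⊕ ‵ _ ⟧, z ⟩
             (+-congˡ (combination-shear (c ∘ suc) (w ∘ suc) (r ∘ suc) u z)))
      (trans (solve 6 (λ c w r u s t → c :* (w :- r :* u) :+ (:- s :* u :+ t)
                         := :- (c :* r :+ s) :* u :+ (c :* w :+ t)) refl
               (c zero) ⟨ w zero , z ⟩ (r zero) ⟨ u , z ⟩ (sum (λ i → c (suc i) * r (suc i)))
               ⟨ combination (c ∘ suc) (w ∘ suc) , z ⟩)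
             (+-congˡ (sym ⟨⟦ c zero ⊛ ‵ w zero ⊕ ‵ _ ⟧, z ⟩)))

  -- The last clause says that x lies in the span of v, described as the double
  -- orthogonal complement.
  common-kernel : ∀ {n m} (f : Vector V n) (v : Vector V m) → Independent v → n ℕ.< m →
    ∃[ x ] ¬ (x ≈ᴹ 0ᴹ) × (∀ i → ⟨ x , f i ⟩ ≈ 0#) ×
           (∀ g → (∀ j → ⟨ v j , g ⟩ ≈ 0#) → ⟨ x , g ⟩ ≈ 0#)
  common-kernel {m = suc m} f v ind n<m with all? (λ i → ⟨ v zero , f i ⟩ ≟ 0#)
  common-kernel {n} {suc m} f v ind n<m | yes v₀⊥f =
    v zero , Independent⇒nonzero {v = v} ind , v₀⊥f , λ g v⊥g → v⊥g zero
  common-kernel {n} {suc m} f v ind n<m | no v₀⊥̸f with ¬∀⟶∃¬ n _ (λ i → ⟨ v zero , f i ⟩ ≟ 0#) v₀⊥̸f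
  common-kernel {suc n} {suc m} f v ind (s≤s n<m) | no _ | i , v₀fᵢ≉0
    with common-kernel (f ∘ punchIn i) v′ ind′ n<m
    where
    -- This multiplier makes `v′ j` orthogonal to `f i`. One constraint and one vector are
    -- eliminated together, which preserves `n < m`.
    r : Vector Carrier m
    r j = ⟨ v (suc j) , f i ⟩ * ⟨ v zero , f i ⟩ ⁻¹

    v′ : Vector V m
    v′ j = v (suc j) +ᴹ -ᴹ (r j *ₗ v zero)

    ind′ : Independent v′
    ind′ c c·v′≈0 j = ind (λ { zero → - sum (λ j → c j * r j) ; (suc j) → c j })
      (⟨⟩-ext λ z → trans ⟨⟦ (- sum (λ j → c j * r j)) ⊛ ‵ v zero ⊕ ‵ _ ⟧, z ⟩
        (trans (sym (combination-shear c (v ∘ suc) r (v zero) z)) (⟨⟩-cong c·v′≈0 ≈ᴹ-refl))) (suc j)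
  ... | x , x≉0 , x⊥f′ , x∈v′ = x , x≉0 , x⊥f , x∈v
    where
    v₀fᵢ⁻¹ : Carrier
    v₀fᵢ⁻¹ = ⟨ v zero , f i ⟩ ⁻¹

    x⊥f : ∀ j → ⟨ x , f j ⟩ ≈ 0#
    x⊥f j with i ≟ᶠ j
    ... | no  i≢j    = ≡.subst (λ j → ⟨ x , f j ⟩ ≈ 0#) (punchIn-punchOut i≢j) (x⊥f′ (punchOut i≢j))
    -- All `v′ j` are orthogonal to `f i`, so the span clause with `g = f i` yields the constraint
    -- left out of the recursion.
    ... | yes ≡.refl = x∈v′ (f i) λ j → trans ⟨⟦ ‵ v (suc j) ⊕ ⊖ _ ⊛ ‵ v zero ⟧, f i ⟩
      (trans (solve 3 (λ a b b′ → a :- a :* b′ :* b := a :* (con (+ 1) :- b :* b′)) refl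
               ⟨ v (suc j) , f i ⟩ ⟨ v zero , f i ⟩ v₀fᵢ⁻¹)
      (trans (*-congˡ (trans (+-congˡ (-‿cong (⁻¹-inverseʳ v₀fᵢ≉0))) (-‿inverseʳ 1#))) (zeroʳ _)))

    x∈v : ∀ g → (∀ j → ⟨ v j , g ⟩ ≈ 0#) → ⟨ x , g ⟩ ≈ 0#
    x∈v g v⊥g = x∈v′ g λ j → trans ⟨⟦ ‵ v (suc j) ⊕ ⊖ _ ⊛ ‵ v zero ⟧, g ⟩
      (trans (+-cong (v⊥g (suc j)) (-‿cong (trans (*-congˡ (v⊥g zero)) (zeroʳ _))))
             (trans (+-identityˡ _) -0#≈0#))

  module _ {n} (v φ : Vector V n) (diagonal : ∀ i → ⟨ φ i , v i ⟩ ≈ 1#)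
    (offdiag : ∀ i j → ¬ (j ≡ i) → ⟨ φ i , v j ⟩ ≈ 0#) where

    biorthogonal-coordinate : ∀ c i → ⟨ combination c v , φ i ⟩ ≈ c i
    biorthogonal-coordinate c i = trans (⟨⟩-combinationˡ c v (φ i)) (trans
      (sum-single _ i λ j j≢i → trans (*-congˡ (trans (⟨⟩-sym _ _) (offdiag i j j≢i))) (zeroʳ _))
      (trans (*-congˡ (trans (⟨⟩-sym _ _) (diagonal i))) (*-identityʳ _)))

    biorthogonal⇒independent : Independent v
    biorthogonal⇒independent c c·v≈0 i =
      trans (sym (biorthogonal-coordinate c i)) (trans (⟨⟩-cong c·v≈0 ≈ᴹ-refl) (⟨⟩-zeroˡ _))

  -- Spanning is expressed by `perp⇒0`, the form in which the absence of fixed vectors of `γ`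
  -- delivers it; `expand` turns it into coordinates.
  record DualBasis {n} (f : Vector V n) : Set where
    field
      ω          : Vector V n
      ω-diagonal : ∀ i → ⟨ ω i , f i ⟩ ≈ 1#
      ω-offdiag  : ∀ i j → ¬ (j ≡ i) → ⟨ ω i , f j ⟩ ≈ 0#
      perp⇒0     : ∀ x → (∀ i → ⟨ x , f i ⟩ ≈ 0#) → x ≈ᴹ 0ᴹ

    coordinate : ∀ c i → ⟨ combination c f , ω i ⟩ ≈ c i
    coordinate = biorthogonal-coordinate f ω ω-diagonal ω-offdiag

    f-independent : Independent f
    f-independent = biorthogonal⇒independent f ω ω-diagonal ω-offdiag

    -- The error `z` is orthogonal to every `ω i`. By `perp⇒0` it is also a combination of the
    -- `ω i`, hence orthogonal to itself.
    expand : ∀ y → y ≈ᴹ combination (λ i → ⟨ y , ω i ⟩) f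
    expand y = x-y≈0⇒x≈y (⟨⟩-def (trans (⟨⟩-cong z≈ω ≈ᴹ-refl)
      (trans (⟨⟩-combinationˡ _ ω z)
             (sum-zero _ λ i → trans (*-congˡ (trans (⟨⟩-sym _ _) (z⊥ω i))) (zeroʳ _)))))
      where
      y′ z : V
      y′ = combination (λ i → ⟨ y , ω i ⟩) f
      z  = y +ᴹ -ᴹ y′

      z⊥ω : ∀ i → ⟨ z , ω i ⟩ ≈ 0#
      z⊥ω i = trans ⟨⟦ ‵ y ⊕ ⊖ ‵ y′ ⟧, ω i ⟩ (trans (+-congˡ (-‿cong (coordinate _ i))) (-‿inverseʳ _))

      z≈ω : z ≈ᴹ combination (λ i → ⟨ z , f i ⟩) ω
      z≈ω = x-y≈0⇒x≈y (perp⇒0 _ λ i → trans ⟨⟦ ‵ z ⊕ ⊖ ‵ _ ⟧, f i ⟩ (trans (+-congˡ (-‿cong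
        (trans (⟨⟩-combinationˡ _ ω (f i)) (trans
          (sum-single _ i λ j j≢i → trans (*-congˡ (ω-offdiag j i (j≢i ∘ ≡.sym))) (zeroʳ _))
          (trans (*-congˡ (ω-diagonal i)) (*-identityʳ _))))))
        (-‿inverseʳ _)))

    ⟨⟩-expand : ∀ y z → ⟨ y , z ⟩ ≈ sum (λ i → ⟨ y , ω i ⟩ * ⟨ f i , z ⟩)
    ⟨⟩-expand y z = trans (⟨⟩-cong (expand y) ≈ᴹ-refl) (⟨⟩-combinationˡ _ f z)

  -- Fewer than `m` constraints on the span of `m` independent vectors leave a nonzero `x i`
  -- orthogonal to all `f j` with `j` other than `i`. By `f⊥⇒0` it is not orthogonal to `f i` as
  -- well, so it can be scaled to `ω i`.
  dualBasis : ∀ {n m} (f : Vector V n) (v : Vector V m) → Independent v → n ℕ.≤ m →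
    (∀ x → (∀ i → ⟨ x , f i ⟩ ≈ 0#) → x ≈ᴹ 0ᴹ) → DualBasis f
  dualBasis {zero} f v ind _ f⊥⇒0 = record
    { ω = λ () ; ω-diagonal = λ () ; ω-offdiag = λ () ; perp⇒0 = f⊥⇒0 }
  dualBasis {suc n} f v ind n<m f⊥⇒0 = record
    { ω          = λ i → ⟨ x i , f i ⟩ ⁻¹ *ₗ x i
    ; ω-diagonal = λ i → trans (⟨⟩-*ˡ _ _ _) (trans (*-comm _ _) (⁻¹-inverseʳ (xf≉0 i)))
    ; ω-offdiag  = λ i j j≢i → trans (⟨⟩-*ˡ _ _ _) (trans (*-congˡ (x⊥f i j j≢i)) (zeroʳ _))
    ; perp⇒0     = f⊥⇒0
    }
    where
    kernel = λ i → common-kernel (f ∘ punchIn i) v ind n<m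

    x : Vector V (suc n)
    x i = proj₁ (kernel i)

    x⊥f : ∀ i j → ¬ (j ≡ i) → ⟨ x i , f j ⟩ ≈ 0#
    x⊥f i j j≢i = ≡.subst (λ j → ⟨ x i , f j ⟩ ≈ 0#) (punchIn-punchOut (j≢i ∘ ≡.sym))
      (proj₁ (proj₂ (proj₂ (kernel i))) (punchOut (j≢i ∘ ≡.sym)))

    xf≉0 : ∀ i → ¬ (⟨ x i , f i ⟩ ≈ 0#)
    xf≉0 i xf≈0 = proj₁ (proj₂ (kernel i)) (f⊥⇒0 (x i) x⊥)
      where
      x⊥ : ∀ j → ⟨ x i , f j ⟩ ≈ 0#
      x⊥ j with j ≟ᶠ i
      ... | yes ≡.refl = xf≈0
      ... | no  j≢i    = x⊥f i j j≢i

-- Integral spans and products of transvections.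

module ReflectionProducts {ℝ : Reals} {dim : ℕ} (E : EuclideanSpace ℝ dim) where
  open OrderedField ℝ
  open EuclideanSpace E
  open EuclideanLemmas E

  combination-+ : ∀ {n} c d (v : Vector V n) →
    combination (λ i → c i + d i) v ≈ᴹ combination c v +ᴹ combination d v
  combination-+ c d v = ⟨⟩-ext λ z → trans (⟨⟩-combinationˡ _ v z)
    (trans (sum-cong-≋ λ i → distribʳ _ (c i) (d i))
    (trans (∑-distrib-+ (λ i → c i * ⟨ v i , z ⟩) (λ i → d i * ⟨ v i , z ⟩))
    (sym (trans (⟨⟩-+ˡ _ _ z) (+-cong (⟨⟩-combinationˡ c v z) (⟨⟩-combinationˡ d v z))))))

  combination-* : ∀ {n} r c (v : Vector V n) → combination (λ i → r * c i) v ≈ᴹ r *ₗ combination c v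
  combination-* r c v = ⟨⟩-ext λ z → trans (⟨⟩-combinationˡ _ v z)
    (trans (sum-cong-≋ λ i → *-assoc r (c i) _)
    (trans (sym (*-distribˡ-sum r (λ i → c i * ⟨ v i , z ⟩)))
    (sym (trans (⟨⟩-*ˡ r _ z) (*-congˡ (⟨⟩-combinationˡ c v z))))))

  combination-0 : ∀ {n} {c} (v : Vector V n) → (∀ i → c i ≈ 0#) → combination c v ≈ᴹ 0ᴹ
  combination-0 v c≈0 = ⟨⟩-ext λ z → trans (⟨⟩-combinationˡ _ v z)
    (trans (sum-zero _ λ i → trans (*-congʳ (c≈0 i)) (zeroˡ _)) (sym (⟨⟩-zeroˡ z)))

  Independent⇒unique : ∀ {n} (v : Vector V n) → Independent v →
    ∀ c d → combination c v ≈ᴹ combination d v → ∀ i → c i ≈ d i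
  Independent⇒unique v ind c d c·v≈d·v i = x∙y⁻¹≈ε⇒x≈y _ _ (ind (λ i → c i - d i)
    (≈ᴹ-trans (combination-+ c (λ i → - d i) v)
    (≈ᴹ-trans (+ᴹ-congʳ c·v≈d·v)
    (≈ᴹ-trans (≈ᴹ-sym (combination-+ d (λ i → - d i) v))
              (combination-0 v λ i → -‿inverseʳ (d i))))) i)

  IntegerSpan : ∀ {n} → Vector V n → Pred V 0ℓ
  IntegerSpan v x = ∃[ k ] (∀ i → IsInteger (k i)) × x ≈ᴹ combination k v

  module _ {n} {v : Vector V n} where

    IntegerSpan-resp : ∀ {x y} → x ≈ᴹ y → IntegerSpan v x → IntegerSpan v y
    IntegerSpan-resp x≈y (k , int , x≈kv) = k , int , ≈ᴹ-trans (≈ᴹ-sym x≈y) x≈kv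

    IntegerSpan-0 : IntegerSpan v 0ᴹ
    IntegerSpan-0 = (λ _ → 0#) , (λ _ → Int-0) , ≈ᴹ-sym (combination-0 v λ _ → refl)

    IntegerSpan-+ : ∀ {x y} → IntegerSpan v x → IntegerSpan v y → IntegerSpan v (x +ᴹ y)
    IntegerSpan-+ (k , k-int , x≈) (l , l-int , y≈) = (λ i → k i + l i) , (λ i → Int-+ (k-int i) (l-int i)) ,
      ≈ᴹ-trans (+ᴹ-cong x≈ y≈) (≈ᴹ-sym (combination-+ k l v))

    IntegerSpan-* : ∀ {r x} → IsInteger r → IntegerSpan v x → IntegerSpan v (r *ₗ x)
    IntegerSpan-* {r} r-int (k , k-int , x≈) = (λ i → r * k i) , (λ i → Int-* r-int (k-int i)) ,
      ≈ᴹ-trans (*ₗ-congˡ x≈) (≈ᴹ-sym (combination-* r k v))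

    IntegerSpan-combination : ∀ {m} k (w : Vector V m) → (∀ i → IsInteger (k i)) →
      (∀ i → IntegerSpan v (w i)) → IntegerSpan v (combination k w)
    IntegerSpan-combination {zero}  k w k-int w∈ = IntegerSpan-0
    IntegerSpan-combination {suc m} k w k-int w∈ = IntegerSpan-+
      (IntegerSpan-* (k-int zero) (w∈ zero))
      (IntegerSpan-combination (k ∘ suc) (w ∘ suc) (k-int ∘ suc) (w∈ ∘ suc))

    IntegerSpan-basis : ∀ i → IntegerSpan v (v i)
    IntegerSpan-basis i = e , e-int , ≈ᴹ-sym (≈ᴹ-trans (combination-single e v i e-off) (e-diag))
      where
      e : Vector Carrier n
      e j with j ≟ᶠ i
      ... | yes _ = 1#
      ... | no  _ = 0#
      e-int : ∀ j → IsInteger (e j)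
      e-int j with j ≟ᶠ i
      ... | yes _ = Int-1
      ... | no  _ = Int-0
      e-off : ∀ j → ¬ (j ≡ i) → e j ≈ 0#
      e-off j j≢i with j ≟ᶠ i
      ... | yes j≡i = contradiction j≡i j≢i
      ... | no  _   = refl
      e-diag : e i *ₗ v i ≈ᴹ v i
      e-diag with i ≟ᶠ i
      ... | yes _   = *ₗ-identityˡ _
      ... | no  i≢i = contradiction ≡.refl i≢i

    IntegerSpan-pairing : ∀ {x y} → IntegerSpan v x → (∀ i → IsInteger ⟨ v i , y ⟩) → IsInteger ⟨ x , y ⟩
    IntegerSpan-pairing {y = y} (k , k-int , x≈) int =
      Int-resp (sym (trans (⟨⟩-cong x≈ ≈ᴹ-refl) (⟨⟩-combinationˡ k v y)))
               (Int-sum _ λ i → Int-* (k-int i) (int i))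

  -- A reflection when one of `a`, `b` is a root and the other its coroot. Keeping the two apart
  -- lets one argument treat both lattices.
  transvection : V → V → V → V
  transvection a b x = x +ᴹ -ᴹ (⟨ x , a ⟩ *ₗ b)

  transvections : ∀ {n} → Vector V n → Vector V n → V → V
  transvections {zero}  a b x = x
  transvections {suc n} a b x = transvection (a zero) (b zero) (transvections (a ∘ suc) (b ∘ suc) x)

  -- Entry `i` is the multiple of `b i` subtracted when factor `i` is applied; the last factor acts
  -- first.
  displacement : ∀ {n} → Vector V n → Vector V n → V → Vector Carrier n
  displacement a b x zero    = ⟨ transvections (a ∘ suc) (b ∘ suc) x , a zero ⟩
  displacement a b x (suc i) = displacement (a ∘ suc) (b ∘ suc) x i

  transvections-displacement : ∀ {n} (a b : Vector V n) x →
    transvections a b x +ᴹ combination (displacement a b x) b ≈ᴹ x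
  transvections-displacement {zero}  a b x = +ᴹ-identityʳ x
  transvections-displacement {suc n} a b x = ≈ᴹ-trans
    (vector-≈ ((‵ y ⊕ ⊖ m ⊛ ‵ b zero) ⊕ (m ⊛ ‵ b zero ⊕ ‵ ys)) (‵ y ⊕ ‵ ys)
      λ z → solve 4 (λ y m b s → (y :- m :* b) :+ (m :* b :+ s) := y :+ s) refl _ _ _ _)
    (transvections-displacement (a ∘ suc) (b ∘ suc) x)
    where
    y  = transvections (a ∘ suc) (b ∘ suc) x
    m  = ⟨ y , a zero ⟩
    ys = combination (displacement (a ∘ suc) (b ∘ suc) x) (b ∘ suc)

  transvections-fix : ∀ {n} (a b : Vector V n) {x} → (∀ i → ⟨ x , a i ⟩ ≈ 0#) → transvections a b x ≈ᴹ x
  transvections-fix {zero}  a b x⊥a = ≈ᴹ-refl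
  transvections-fix {suc n} a b {x} x⊥a = ≈ᴹ-trans (+ᴹ-cong y≈x
      (-ᴹ‿cong (≈ᴹ-trans (*ₗ-congʳ (trans (⟨⟩-cong y≈x ≈ᴹ-refl) (x⊥a zero))) (*ₗ-zeroˡ _))))
    (vector-≈ (‵ x ⊕ ⊖ ‵ 0ᴹ) (‵ x) λ z → trans (+-congˡ (trans (-‿cong (⟨⟩-zeroˡ z)) -0#≈0#)) (+-identityʳ _))
    where
    y≈x = transvections-fix (a ∘ suc) (b ∘ suc) (x⊥a ∘ suc)

  -- The displacements are obtained from the pairings with the a i by a
  -- unitriangular system whose coefficients are the numbers ⟨ b i , a j ⟩.
  module Displacement (R S : Pred Carrier 0ℓ)
    (S-resp : ∀ {x y} → x ≈ y → S x → S y) (S-0 : S 0#)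
    (S-+ : ∀ {x y} → S x → S y → S (x + y)) (S-neg : ∀ {x} → S x → S (- x))
    (S-* : ∀ {x y} → S x → R y → S (x * y)) where

    private
      S-sum : ∀ {n} (f : Vector Carrier n) → (∀ i → S (f i)) → S (sum f)
      S-sum {zero}  f Sf = S-0
      S-sum {suc n} f Sf = S-+ (Sf zero) (S-sum (f ∘ suc) (Sf ∘ suc))

      S-shift : ∀ {n} (c : Vector Carrier n) b y → (∀ i → S (c i)) → (∀ i → R ⟨ b i , y ⟩) →
                S ⟨ combination c b , y ⟩
      S-shift c b y Sc Rb = S-resp (sym (⟨⟩-combinationˡ c b y)) (S-sum _ λ i → S-* (Sc i) (Rb i))

    -- `x` is the vector reaching the first factor plus the later displacements, so `⟨ x , a zero ⟩`
    -- is the first displacement plus a combination of the later ones. The predicate `S` is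
    -- instantiated by vanishing and by integrality.
    displacement⇒pairing : ∀ {n} (a b : Vector V n) x → (∀ i j → R ⟨ b i , a j ⟩) →
      (∀ i → S (displacement a b x i)) → ∀ i → S ⟨ x , a i ⟩
    displacement⇒pairing a b x Rba Sm zero = S-resp
      (trans (sym (⟨⟩-+ˡ _ _ _)) (⟨⟩-cong (transvections-displacement (a ∘ suc) (b ∘ suc) x) ≈ᴹ-refl))
      (S-+ (Sm zero) (S-shift _ (b ∘ suc) (a zero) (Sm ∘ suc) (λ i → Rba (suc i) zero)))
    displacement⇒pairing a b x Rba Sm (suc i) =
      displacement⇒pairing (a ∘ suc) (b ∘ suc) x (λ i j → Rba (suc i) (suc j)) (Sm ∘ suc) i

    -- Back substitution in the same system: the later displacements are found first and their
    -- contribution is subtracted from `⟨ x , a zero ⟩`.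
    pairing⇒displacement : ∀ {n} (a b : Vector V n) x → (∀ i j → R ⟨ b i , a j ⟩) →
      (∀ i → S ⟨ x , a i ⟩) → ∀ i → S (displacement a b x i)
    pairing⇒displacement a b x Rba Sx (suc i) =
      pairing⇒displacement (a ∘ suc) (b ∘ suc) x (λ i j → Rba (suc i) (suc j)) (Sx ∘ suc) i
    pairing⇒displacement a b x Rba Sx zero = S-resp
      (trans (+-congʳ (trans (⟨⟩-cong (≈ᴹ-sym (transvections-displacement (a ∘ suc) (b ∘ suc) x)) ≈ᴹ-refl) (⟨⟩-+ˡ _ _ _)))
             (solve 2 (λ y s → (y :+ s) :- s := y) refl _ _))
      (S-+ (Sx zero) (S-neg (S-shift _ (b ∘ suc) (a zero)
        (pairing⇒displacement (a ∘ suc) (b ∘ suc) x (λ i j → Rba (suc i) (suc j)) (Sx ∘ suc))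
        (λ i → Rba (suc i) zero))))

  displacement-0⇒pairing-0 : ∀ {n} (a b : Vector V n) x → (∀ i → displacement a b x i ≈ 0#) →
    ∀ i → ⟨ x , a i ⟩ ≈ 0#
  displacement-0⇒pairing-0 a b x = displacement⇒pairing a b x (λ _ _ → refl)
    where
    open Displacement (λ x → x ≈ x) (_≈ 0#) (λ x≈y x≈0 → trans (sym x≈y) x≈0) refl
      (λ x≈0 y≈0 → trans (+-cong x≈0 y≈0) (+-identityʳ 0#))
      (λ x≈0 → trans (-‿cong x≈0) -0#≈0#) (λ x≈0 _ → trans (*-congʳ x≈0) (zeroˡ _))

  -- By independence, `x - w x = 0` forces all displacements to vanish. For reflections this says
  -- that a product over independent roots fixes only the intersection of the hyperplanes.
  fixed⇒perp : ∀ {n} (a b : Vector V n) {x} → Independent b → transvections a b x ≈ᴹ x →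
    ∀ i → ⟨ x , a i ⟩ ≈ 0#
  fixed⇒perp a b {x} b-ind fix = displacement-0⇒pairing-0 a b x (b-ind (displacement a b x)
    (≈ᴹ-trans (vector-≈ (‵ d) ((‵ tx ⊕ ‵ d) ⊕ ⊖ ‵ tx)
        λ z → solve 2 (λ d t → d := t :+ d :- t) refl ⟨ d , z ⟩ ⟨ tx , z ⟩)
      (≈ᴹ-trans (+ᴹ-cong (transvections-displacement a b x) (-ᴹ‿cong fix)) (-ᴹ‿inverseʳ x))))
    where
    d tx : V
    d  = combination (displacement a b x) b
    tx = transvections a b x

  -- Both lattices spanned by b and b′ are related to 1 - w: on a vector x
  -- pairing integrally with a′, the displacement x - w x lies in the lattice
  -- of b′, hence of b, and the unitriangular system can be solved for the
  -- pairings of x with a.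
  integral-transfer : ∀ {n n′} (a b : Vector V n) (a′ b′ : Vector V n′) →
    (∀ x → transvections a b x ≈ᴹ transvections a′ b′ x) →
    Independent b → (∀ i → IntegerSpan b (b′ i)) →
    (∀ i j → IsInteger ⟨ b i , a j ⟩) → (∀ i j → IsInteger ⟨ b′ i , a′ j ⟩) →
    ∀ x → (∀ i → IsInteger ⟨ x , a′ i ⟩) → ∀ i → IsInteger ⟨ x , a i ⟩
  integral-transfer a b a′ b′ eq b-ind b′∈b ba b′a′ x xa′ =
    displacement⇒pairing a b x ba λ i → Int-resp (sym (m≈k i)) (proj₁ (proj₂ span) i)
    where
    open Displacement IsInteger IsInteger Int-resp Int-0 Int-+ Int-neg Int-*

    m = displacement a b x
    m′ = displacement a′ b′ x

    span : IntegerSpan b (combination m′ b′)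
    span = IntegerSpan-combination m′ b′ (pairing⇒displacement a′ b′ x b′a′ xa′) b′∈b

    k = proj₁ span

    tx : V
    tx = transvections a b x

    m·b≈k·b : combination m b ≈ᴹ combination k b
    m·b≈k·b = ≈ᴹ-trans (vector-≈ (‵ combination m b) ((‵ tx ⊕ ‵ combination m b) ⊕ ⊖ ‵ tx)
                         λ z → solve 2 (λ d t → d := t :+ d :- t) refl _ ⟨ tx , z ⟩)
      (≈ᴹ-trans (+ᴹ-cong (≈ᴹ-trans (transvections-displacement a b x)
                                    (≈ᴹ-sym (transvections-displacement a′ b′ x))) (-ᴹ‿cong (eq x)))
      (≈ᴹ-trans (vector-≈ ((‵ tx′ ⊕ ‵ combination m′ b′) ⊕ ⊖ ‵ tx′) (‵ combination m′ b′)
                         λ z → solve 2 (λ d t → t :+ d :- t := d) refl _ ⟨ tx′ , z ⟩)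
      (proj₂ (proj₂ span))))
      where
      tx′ : V
      tx′ = transvections a′ b′ x

    m≈k : ∀ i → m i ≈ k i
    m≈k = Independent⇒unique b b-ind m k m·b≈k·b

-- Coroots, and signs of integral coordinates along obtuse roots.

module RootGeometry {ℝ : Reals} {dim : ℕ} (E : EuclideanSpace ℝ dim) where
  open OrderedField ℝ
  open EuclideanSpace E
  open EuclideanLemmas E
  open ReflectionProducts E

  coroot : V → V
  coroot α = (2# * ⟨ α , α ⟩ ⁻¹) *ₗ α

  reflect≈transvection : ∀ α x → reflect α x ≈ᴹ transvection (coroot α) α x
  reflect≈transvection α x = vector-≈ (‵ x ⊕ ⊖ (2# * ⟨ x , α ⟩ * ⟨ α , α ⟩ ⁻¹) ⊛ ‵ α) (‵ x ⊕ ⊖ ⟨ x , coroot α ⟩ ⊛ ‵ α)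
    λ z → +-congˡ (-‿cong (*-congʳ (trans (solve 3 (λ t xa b → t :* xa :* b := t :* b :* xa) refl 2# ⟨ x , α ⟩ (⟨ α , α ⟩ ⁻¹))
      (sym (trans ⟨ x ,⟦ _ ⊛ ‵ α ⟧⟩ (*-congˡ (⟨⟩-sym α x)))))))

  -- With root and coroot exchanged, displacements run along coroots and are computed from pairings
  -- with roots.
  reflect≈transvectionᵛ : ∀ α x → reflect α x ≈ᴹ transvection α (coroot α) x
  reflect≈transvectionᵛ α x = vector-≈ (‵ x ⊕ ⊖ (2# * ⟨ x , α ⟩ * ⟨ α , α ⟩ ⁻¹) ⊛ ‵ α) (‵ x ⊕ ⊖ ⟨ x , α ⟩ ⊛ (2# * ⟨ α , α ⟩ ⁻¹) ⊛ ‵ α)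
    λ z → +-congˡ (-‿cong (solve 4 (λ t xa b az → t :* xa :* b :* az := xa :* (t :* b :* az)) refl 2# ⟨ x , α ⟩ (⟨ α , α ⟩ ⁻¹) ⟨ α , z ⟩))

  ⟨⟩-corootʳ : ∀ x α → ⟨ x , coroot α ⟩ ≈ 2# * ⟨ α , α ⟩ ⁻¹ * ⟨ x , α ⟩
  ⟨⟩-corootʳ x α = trans ⟨ x ,⟦ _ ⊛ ‵ α ⟧⟩ (*-congˡ (⟨⟩-sym α x))

  coroot-norm : ∀ x {α} → ¬ (α ≈ᴹ 0ᴹ) → ⟨ x , coroot α ⟩ * ⟨ α , α ⟩ ≈ 2# * ⟨ x , α ⟩
  coroot-norm x {α} α≉0 = trans (*-congʳ (⟨⟩-corootʳ x α))
    (trans (solve 4 (λ t n xa n′ → t :* n′ :* xa :* n := (n :* n′) :* (t :* xa)) refl 2# ⟨ α , α ⟩ ⟨ x , α ⟩ (⟨ α , α ⟩ ⁻¹))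
    (trans (*-congʳ (⁻¹-inverseʳ (<⇒≉ (norm-pos α≉0)))) (*-identityˡ _)))

  -- Adding a term `c₀ α₀` to `p` contributes the square `c₀ c₀ A = c₀ c₀′ X` and the cross term
  -- `2 c₀ ⟨ p , α₀ ⟩ = c₀ ν A = ν c₀′ X`, where `ν` is an integral combination of Cartan integers.
  norm-multiple : ∀ {n} (α : Vector V n) (c c′ : Vector Carrier n) X →
    (∀ i → ¬ (α i ≈ᴹ 0ᴹ)) → (∀ i j → IsInteger ⟨ α j , coroot (α i) ⟩) →
    (∀ i → IsInteger (c i)) → (∀ i → IsInteger (c′ i)) →
    (∀ i → c i * ⟨ α i , α i ⟩ ≈ c′ i * X) →
    ∃[ N ] IsInteger N × ⟨ combination c α , combination c α ⟩ ≈ N * X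
  norm-multiple {zero} α c c′ X _ _ _ _ _ = 0# , Int-0 , trans (⟨⟩-zeroˡ 0ᴹ) (sym (zeroˡ X))
  norm-multiple {suc n} α c c′ X α≉0 cartan c-int c′-int c≈c′ with
    norm-multiple (α ∘ suc) (c ∘ suc) (c′ ∘ suc) X (α≉0 ∘ suc) (λ i j → cartan (suc i) (suc j))
      (c-int ∘ suc) (c′-int ∘ suc) (c≈c′ ∘ suc)
  ... | N , N-int , p²≈NX = c₀ * c₀′ + ν * c₀′ + N , Int-+ (Int-+ (Int-* (c-int zero) (c′-int zero))
                                                             (Int-* ν-int (c′-int zero))) N-int , (begin
      ⟨ c₀ *ₗ α₀ +ᴹ p , c₀ *ₗ α₀ +ᴹ p ⟩         ≈⟨ ⟨⟦ c₀ ⊛ ‵ α₀ ⊕ ‵ p ⟧, c₀ *ₗ α₀ +ᴹ p ⟩ ⟩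
      c₀ * ⟨ α₀ , c₀ *ₗ α₀ +ᴹ p ⟩ + ⟨ p , c₀ *ₗ α₀ +ᴹ p ⟩
        ≈⟨ +-cong (*-congˡ ⟨ α₀ ,⟦ c₀ ⊛ ‵ α₀ ⊕ ‵ p ⟧⟩) ⟨ p ,⟦ c₀ ⊛ ‵ α₀ ⊕ ‵ p ⟧⟩ ⟩
      c₀ * (c₀ * A + ⟨ p , α₀ ⟩) + (c₀ * ⟨ α₀ , p ⟩ + ⟨ p , p ⟩)
        ≈⟨ +-congˡ (+-congʳ (*-congˡ (⟨⟩-sym α₀ p))) ⟩
      c₀ * (c₀ * A + ⟨ p , α₀ ⟩) + (c₀ * ⟨ p , α₀ ⟩ + ⟨ p , p ⟩)
        ≈⟨ solve 4 (λ c A q pp → c :* (c :* A :+ q) :+ (c :* q :+ pp) :=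
             c :* (c :* A) :+ c :* ((con (+ 2)) :* q) :+ pp) refl c₀ A ⟨ p , α₀ ⟩ ⟨ p , p ⟩ ⟩
      c₀ * (c₀ * A) + c₀ * (2# * ⟨ p , α₀ ⟩) + ⟨ p , p ⟩
        ≈⟨ +-cong (+-congˡ (*-congˡ (sym (coroot-norm p (α≉0 zero))))) p²≈NX ⟩
      c₀ * (c₀ * A) + c₀ * (ν * A) + N * X
        ≈⟨ solve 5 (λ c A ν N X → c :* (c :* A) :+ c :* (ν :* A) :+ N :* X := (c :+ ν) :* (c :* A) :+ N :* X) refl c₀ A ν N X ⟩
      (c₀ + ν) * (c₀ * A) + N * X
        ≈⟨ +-congʳ (*-congˡ (c≈c′ zero)) ⟩
      (c₀ + ν) * (c₀′ * X) + N * X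
        ≈⟨ solve 5 (λ c c′ ν N X → (c :+ ν) :* (c′ :* X) :+ N :* X := (c :* c′ :+ ν :* c′ :+ N) :* X) refl c₀ c₀′ ν N X ⟩
      (c₀ * c₀′ + ν * c₀′ + N) * X              ∎)
    where
    open import Relation.Binary.Reasoning.Setoid setoid
    c₀ c₀′ A ν : Carrier
    α₀ p : V
    c₀  = c zero
    c₀′ = c′ zero
    α₀  = α zero
    A   = ⟨ α₀ , α₀ ⟩
    p   = combination (c ∘ suc) (α ∘ suc)
    ν   = ⟨ p , coroot α₀ ⟩
    ν-int : IsInteger ν
    ν-int = Int-resp (sym (⟨⟩-combinationˡ (c ∘ suc) (α ∘ suc) _)) (Int-sum _ λ i → Int-* (c-int (suc i)) (cartan zero (suc i)))

  -- Writing x = p - q with p and q the positive and negative parts, ⟨ p , q ⟩ ≤ 0,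
  -- and ⟨ p , p ⟩ and ⟨ q , q ⟩ are integral multiples of ⟨ x , x ⟩, so that
  -- ⟨ x , x ⟩ ≥ 2 ⟨ x , x ⟩ unless p or q vanishes.
  obtuse⇒same-sign : ∀ {n} (α : Vector V n) (c c′ : Vector Carrier n) {x} →
    ¬ (x ≈ᴹ 0ᴹ) → Independent α → x ≈ᴹ combination c α →
    (∀ i → ¬ (α i ≈ᴹ 0ᴹ)) → (∀ i j → IsInteger ⟨ α j , coroot (α i) ⟩) →
    (∀ i → IsInteger (c i)) → (∀ i → IsInteger (c′ i)) →
    (∀ i → c i * ⟨ α i , α i ⟩ ≈ c′ i * ⟨ x , x ⟩) →
    (∀ i j → ¬ (i ≡ j) → ¬ (c i ≈ 0#) → ¬ (c j ≈ 0#) → ⟨ α i , α j ⟩ ≤ 0#) →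
    (∀ i → 0# ≤ c i) ⊎ (∀ i → c i ≤ 0#)
  obtuse⇒same-sign {n} α c c′ {x} x≉0 α-ind x≈cα α≉0 cartan c-int c′-int c≈c′ obtuse
    with any? (λ i → 0# <? c i) | any? (λ i → c i <? 0#)
  ... | no ∄pos | _       = inj₂ λ i → ≮⇒≥ λ 0<c → ∄pos (i , 0<c)
  ... | yes _   | no ∄neg = inj₁ λ i → ≮⇒≥ λ c<0 → ∄neg (i , c<0)
  ... | yes (i₊ , 0<c₊) | yes (i₋ , c₋<0) = contradiction total (<⇒≉ total-pos)
    where
    X : Carrier
    X = ⟨ x , x ⟩

    0<X : 0# < X
    0<X = norm-pos x≉0

    mask : Carrier → Carrier
    mask y with 0# <? y
    ... | yes _ = 1#
    ... | no  _ = 0#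

    mask-cases : ∀ y → (0# < y × mask y ≡ 1#) ⊎ (y ≤ 0# × mask y ≡ 0#)
    mask-cases y with 0# <? y
    ... | yes 0<y = inj₁ (0<y , ≡.refl)
    ... | no  0≮y = inj₂ (≮⇒≥ 0≮y , ≡.refl)

    mask-int : ∀ y → IsInteger (mask y)
    mask-int y with mask-cases y
    ... | inj₁ (_ , e≡1) = Int-resp (reflexive (≡.sym e≡1)) Int-1
    ... | inj₂ (_ , e≡0) = Int-resp (reflexive (≡.sym e≡0)) Int-0

    -- `e` selects the positive coordinates, so `p` is the positive part of `c` and `q = (e - 1) c`
    -- the negated remainder. The selectors are integers, hence `norm-multiple` applies to both
    -- parts.
    e e-1 : Vector Carrier n
    e   i = mask (c i)
    e-1 i = e i - 1#

    p q : Vector Carrier n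
    p i = e i * c i
    q i = e-1 i * c i

    P Q : V
    P = combination p α
    Q = combination q α

    scaled : ∀ (s : Vector Carrier n) i → s i * c i * ⟨ α i , α i ⟩ ≈ s i * c′ i * X
    scaled s i = trans (*-assoc _ _ _) (trans (*-congˡ (c≈c′ i)) (sym (*-assoc _ _ _)))

    multiple : ∀ (s : Vector Carrier n) → (∀ i → IsInteger (s i)) → let S = combination (λ i → s i * c i) α in
      ∃[ N ] IsInteger N × ⟨ S , S ⟩ ≈ N * X
    multiple s s-int = norm-multiple α _ (λ i → s i * c′ i) X α≉0 cartan
      (λ i → Int-* (s-int i) (c-int i)) (λ i → Int-* (s-int i) (c′-int i)) (scaled s)

    P-mult = multiple e (λ i → mask-int (c i))
    Q-mult = multiple e-1 (λ i → Int-+ (mask-int (c i)) (Int-neg Int-1))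
    N M : Carrier
    N = proj₁ P-mult
    M = proj₁ Q-mult

    at-least-1 : ∀ (s : Vector Carrier n) (m : ∃[ N ] IsInteger N × ⟨ combination s α , combination s α ⟩ ≈ N * X) →
      ∀ i → ¬ (s i ≈ 0#) → 0# ≤ proj₁ m - 1#
    at-least-1 s (N , N-int , eq) i sᵢ≉0 = Int-pos⇒1≤ N-int (*-cancelˡ-pos 0<X
      (<-respʳ-≈ (trans eq (*-comm N X)) (norm-pos λ sα≈0 → sᵢ≉0 (α-ind s sα≈0 i))))

    1≤N : 0# ≤ N - 1#
    1≤N = at-least-1 p P-mult i₊ p₊≉0
      where
      p₊≉0 : ¬ (p i₊ ≈ 0#)
      p₊≉0 p≈0 with mask-cases (c i₊)
      ... | inj₁ (_ , e≡1) = <⇒≉ 0<c₊ (trans (sym (trans (*-congʳ (reflexive e≡1)) (*-identityˡ _))) p≈0)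
      ... | inj₂ (c≤0 , _) = ≤⇒≯ c≤0 0<c₊

    1≤M : 0# ≤ M - 1#
    1≤M = at-least-1 q Q-mult i₋ q₋≉0
      where
      q₋≉0 : ¬ (q i₋ ≈ 0#)
      q₋≉0 q≈0 with mask-cases (c i₋)
      ... | inj₁ (0<c , _) = <-irrefl refl (<-trans 0<c c₋<0)
      ... | inj₂ (_ , e≡0) = <-irrefl (trans (solve 1 (λ c → c := :- ((con (+ 0) :- con (+ 1)) :* c)) refl (c i₋))
        (trans (-‿cong (trans (*-congʳ (+-congʳ (reflexive (≡.sym e≡0)))) q≈0)) -0#≈0#)) c₋<0

    part-≤0 : ∀ i j → p i * (q j * ⟨ α i , α j ⟩) ≤ 0#
    part-≤0 i j with mask-cases (c i) | mask-cases (c j)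
    ... | inj₂ (_ , e≡0) | _ = inj₂ (trans (*-congʳ (trans (*-congʳ (reflexive e≡0)) (zeroˡ _))) (zeroˡ _))
    ... | _ | inj₁ (_ , e≡1) = inj₂ (trans (*-congˡ (trans (*-congʳ (trans (*-congʳ (trans
      (+-congʳ (reflexive e≡1)) (-‿inverseʳ 1#))) (zeroˡ _))) (zeroˡ _))) (zeroʳ _))
    -- Obtuseness is assumed only between indices with nonzero coordinates, so `c j ≈ 0#` is split
    -- off.
    ... | inj₁ (0<cᵢ , e≡1) | inj₂ (cⱼ≤0 , e≡0) with c j ≟ 0#
    ... | yes cⱼ≈0 = inj₂ (trans (*-congˡ (trans (*-congʳ (trans (*-congˡ cⱼ≈0) (zeroʳ _))) (zeroˡ _))) (zeroʳ _))
    ... | no  cⱼ≉0 = *-nonneg-nonpos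
      (≤-respʳ (sym (trans (*-congʳ (reflexive e≡1)) (*-identityˡ _))) (inj₁ 0<cᵢ))
      (*-nonneg-nonpos (≤-respʳ (trans (solve 1 (λ c → :- c := (con (+ 0) :- con (+ 1)) :* c) refl (c j))
                                       (*-congʳ (+-congʳ (reflexive (≡.sym e≡0))))) (nonpos⇒neg-nonneg cⱼ≤0))
        (obtuse i j (λ { ≡.refl → ≤⇒≯ cⱼ≤0 0<cᵢ }) (<⇒≉ 0<cᵢ) cⱼ≉0))

    PQ≤0 : ⟨ P , Q ⟩ ≤ 0#
    PQ≤0 = ≤-respˡ (sym (trans (⟨⟩-combinationˡ p α Q) (sum-cong-≋ λ i → *-congˡ (⟨⟩-combinationʳ q α (α i)))))
      (sum-nonpos _ λ i → ≤-respˡ (sym (*-distribˡ-sum (p i) (λ j → q j * ⟨ α i , α j ⟩))) (sum-nonpos _ (part-≤0 i)))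

    x≈P-Q : x ≈ᴹ P +ᴹ -ᴹ Q
    x≈P-Q = ≈ᴹ-trans (vector-≈ (‵ x) ((‵ x ⊕ ‵ Q) ⊕ ⊖ ‵ Q) λ z → solve 2 (λ x q → x := x :+ q :- q) refl ⟨ x , z ⟩ ⟨ Q , z ⟩)
      (+ᴹ-congʳ (≈ᴹ-trans (+ᴹ-congʳ x≈cα) (≈ᴹ-trans (≈ᴹ-sym (combination-+ c q α))
        (combination-≈ α λ i → solve 2 (λ e c → c :+ (e :- con (+ 1)) :* c := e :* c) refl (e i) (c i)))))

    -- This is `X = N X + M X - 2 ⟨ P , Q ⟩`, rearranged so that every summand is nonnegative and
    -- the last one positive.
    total : (N - 1#) * X + (M - 1#) * X + - (2# * ⟨ P , Q ⟩) + X ≈ 0#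
    total = begin
      (N - 1#) * X + (M - 1#) * X + - (2# * ⟨ P , Q ⟩) + X
        ≈⟨ solve 4 (λ N M s X → (N :- con (+ 1)) :* X :+ (M :- con (+ 1)) :* X :+ :- (con (+ 2) :* s) :+ X
                      := (N :* X :- s) :+ (M :* X :- s) :- X) refl N M ⟨ P , Q ⟩ X ⟩
      (N * X - ⟨ P , Q ⟩) + (M * X - ⟨ P , Q ⟩) - X
        ≈⟨ +-congʳ (+-cong (+-congʳ (sym (proj₂ (proj₂ P-mult)))) (+-cong (sym (proj₂ (proj₂ Q-mult))) (-‿cong (⟨⟩-sym P Q)))) ⟩
      (⟨ P , P ⟩ - ⟨ P , Q ⟩) + (⟨ Q , Q ⟩ - ⟨ Q , P ⟩) - X
        ≈⟨ solve 5 (λ a b c d X → (a :- b) :+ (c :- d) :- X := (a :- b) :- (d :- c) :- X) refl _ _ _ _ _ ⟩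
      (⟨ P , P ⟩ - ⟨ P , Q ⟩) - (⟨ Q , P ⟩ - ⟨ Q , Q ⟩) - X
        ≈⟨ +-congʳ (+-cong (sym (⟨ P ,⟦P-Q⟧⟩)) (-‿cong (sym ⟨ Q ,⟦P-Q⟧⟩))) ⟩
      ⟨ P , P +ᴹ -ᴹ Q ⟩ - ⟨ Q , P +ᴹ -ᴹ Q ⟩ - X
        ≈⟨ +-congʳ (sym ⟨⟦ ‵ P ⊕ ⊖ ‵ Q ⟧, P +ᴹ -ᴹ Q ⟩) ⟩
      ⟨ P +ᴹ -ᴹ Q , P +ᴹ -ᴹ Q ⟩ - X
        ≈⟨ +-congʳ (⟨⟩-cong (≈ᴹ-sym x≈P-Q) (≈ᴹ-sym x≈P-Q)) ⟩
      X - X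
        ≈⟨ -‿inverseʳ X ⟩
      0# ∎
      where
      open import Relation.Binary.Reasoning.Setoid setoid
      ⟨_,⟦P-Q⟧⟩ : ∀ y → ⟨ y , P +ᴹ -ᴹ Q ⟩ ≈ ⟨ y , P ⟩ - ⟨ y , Q ⟩
      ⟨ y ,⟦P-Q⟧⟩ = trans ⟨ y ,⟦ ‵ P ⊕ ⊖ ‵ Q ⟧⟩ (+-cong (⟨⟩-sym P y) (-‿cong (⟨⟩-sym Q y)))

    total-pos : 0# < (N - 1#) * X + (M - 1#) * X + - (2# * ⟨ P , Q ⟩) + X
    total-pos = <-respʳ-≈ (+-comm _ _) (+-pos 0<X (+-nonneg (+-nonneg (*-nonneg 1≤N (inj₁ 0<X)) (*-nonneg 1≤M (inj₁ 0<X)))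
      (nonpos⇒neg-nonneg (*-nonneg-nonpos (inj₁ 0<2) PQ≤0))))

-- Decidable equality in `W` and the finite list of its reflections.

module ReflectionGroupLemmas {ℝ : Reals} {dim : ℕ} {E : EuclideanSpace ℝ dim} (𝑾 : ReflectionGroup E) where
  open OrderedField ℝ using (Carrier; _≈_; 1#; 2#; _*_; -_; _⁻¹; -‿cong; -0#≈0#; *-cong; *-congˡ; *-congʳ;
    *-identityˡ; +-congˡ; sum-cong-≋; ⁻¹-inverseʳ; <⇒≉; solve; _:=_; con; _:+_; _:*_; _:-_; :-_)
  private module ℝ = OrderedField ℝ
  open EuclideanSpace E
  open EuclideanLemmas E
  open ReflectionProducts E
  open RootGeometry E
  open ReflectionGroup 𝑾 hiding (Carrier; _≈_; _⁻¹)
  open ReflectionGroup 𝑾 using () renaming (_≈_ to _≈ᵂ_; _⁻¹ to _⁻¹ᵂ) public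

  ·-cong : ∀ w {x y} → x ≈ᴹ y → w · x ≈ᴹ w · y
  ·-cong w = IsModuleHomomorphism.⟦⟧-cong (·-linear w)

  act-inverse : ∀ w x → w · (w ⁻¹ᵂ) · x ≈ᴹ x
  act-inverse w x = ≈ᴹ-trans (≈ᴹ-sym (·-compose w (w ⁻¹ᵂ) x))
    (≈ᴹ-trans (·-congˡ (inverseʳ w) x) (·-identity x))

  ·-adjoint : ∀ w x z → ⟨ w · x , z ⟩ ≈ ⟨ x , (w ⁻¹ᵂ) · z ⟩
  ·-adjoint w x z = ℝ.trans (⟨⟩-cong ≈ᴹ-refl (≈ᴹ-sym (act-inverse w z))) (·-orthogonal w x ((w ⁻¹ᵂ) · z))

  transvection-adjoint : ∀ a b x z → ⟨ transvection a b x , z ⟩ ≈ ⟨ x , transvection b a z ⟩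
  transvection-adjoint a b x z = ℝ.trans ⟨⟦ ‵ x ⊕ ⊖ ⟨ x , a ⟩ ⊛ ‵ b ⟧, z ⟩ (ℝ.trans
    (ℝ.+-cong (⟨⟩-sym x z) (-‿cong (ℝ.trans (*-cong (⟨⟩-sym x a) (⟨⟩-sym b z)) (ℝ.*-comm _ _))))
    (ℝ.sym ⟨ x ,⟦ ‵ z ⊕ ⊖ ⟨ z , b ⟩ ⊛ ‵ a ⟧⟩))

  reflect-cong : ∀ α {x y} → x ≈ᴹ y → reflect α x ≈ᴹ reflect α y
  reflect-cong α x≈y = +ᴹ-cong x≈y (-ᴹ‿cong (*ₗ-congʳ (*-congʳ (*-congˡ (⟨⟩-cong x≈y ≈ᴹ-refl)))))

  reflect-adjoint : ∀ α x z → ⟨ reflect α x , z ⟩ ≈ ⟨ x , transvection α (coroot α) z ⟩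
  reflect-adjoint α x z = ℝ.trans (⟨⟩-cong (reflect≈transvection α x) ≈ᴹ-refl) (transvection-adjoint _ _ x z)

  -- An adjoint takes the place of linearity: `⟨ f x , z ⟩ = ⟨ x , f* z ⟩` can be expanded along the
  -- basis in `x`. Equality of group elements and reflections thus reduces to finitely many
  -- decidable tests.
  agree-on-basis : ∀ {f f* g g* : V → V} →
    (∀ x z → ⟨ f x , z ⟩ ≈ ⟨ x , f* z ⟩) → (∀ x z → ⟨ g x , z ⟩ ≈ ⟨ x , g* z ⟩) →
    (∀ i → f (basis i) ≈ᴹ g (basis i)) → ∀ x → f x ≈ᴹ g x
  agree-on-basis {f} {f*} {g} {g*} f-adj g-adj f≈g x with basis-span x
  ... | c , x≈c = ⟨⟩-ext λ z → ℝ.trans (f-adj x z) (ℝ.trans (pair (f* z)) (ℝ.trans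
        (sum-cong-≋ λ i → *-congˡ (ℝ.trans (ℝ.sym (f-adj (basis i) z))
          (ℝ.trans (⟨⟩-cong (f≈g i) ≈ᴹ-refl) (g-adj (basis i) z))))
        (ℝ.sym (ℝ.trans (g-adj x z) (pair (g* z))))))
    where
    pair : ∀ z → ⟨ x , z ⟩ ≈ ℝ.sum (λ i → c i * ⟨ basis i , z ⟩)
    pair z = ℝ.trans (⟨⟩-cong x≈c ≈ᴹ-refl) (⟨⟩-combinationˡ c basis z)

  _≟ᵂ_ : ∀ u w → Dec (u ≈ᵂ w)
  u ≟ᵂ w = map′ (λ eq → ·-faithful (agree-on-basis (·-adjoint u) (·-adjoint w) eq))
    (λ u≈w i → ·-congˡ u≈w (basis i)) (all? λ i → (u · basis i) ≟ᴹ (w · basis i))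

  reflect-parallel : ∀ {α β k} → ¬ (α ≈ᴹ 0ᴹ) → α ≈ᴹ k *ₗ β → ∀ x → reflect α x ≈ᴹ reflect β x
  reflect-parallel {α} {β} {k} α≉0 α≈kβ x = +ᴹ-congˡ (-ᴹ‿cong
    (≈ᴹ-trans (*ₗ-cong coefficient α≈kβ) (vector-≈ (_ ⊛ k ⊛ ‵ β) (_ ⊛ ‵ β) λ z →
      ℝ.trans (solve 6 (λ t k xb n b bb → t :* (k :* xb) :* n :* (k :* b) := t :* xb :* (k :* k :* n) :* b) ℝ.refl
                2# k ⟨ x , β ⟩ (⟨ α , α ⟩ ⁻¹) ⟨ β , z ⟩ ⟨ β , β ⟩)
        (*-congʳ (*-congˡ k²n⁻¹≈m⁻¹)))))
    where
    open import Relation.Binary.Reasoning.Setoid ℝ.setoid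
    n m : Carrier
    n = ⟨ α , α ⟩
    m = ⟨ β , β ⟩

    coefficient : 2# * ⟨ x , α ⟩ * n ⁻¹ ≈ 2# * (k * ⟨ x , β ⟩) * n ⁻¹
    coefficient = *-congʳ (*-congˡ (ℝ.trans (⟨⟩-cong ≈ᴹ-refl α≈kβ) (ℝ.trans ⟨ x ,⟦ k ⊛ ‵ β ⟧⟩ (*-congˡ (⟨⟩-sym β x)))))

    β≉0 : ¬ (β ≈ᴹ 0ᴹ)
    β≉0 β≈0 = α≉0 (≈ᴹ-trans α≈kβ (≈ᴹ-trans (*ₗ-congˡ β≈0) (*ₗ-zeroʳ k)))

    n≈k²m : n ≈ k * k * m
    n≈k²m = ℝ.trans (⟨⟩-cong α≈kβ α≈kβ) (ℝ.trans (⟨⟩-*ˡ k β _)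
      (ℝ.trans (*-congˡ ⟨ β ,⟦ k ⊛ ‵ β ⟧⟩) (ℝ.sym (ℝ.*-assoc k k m))))

    k²n⁻¹≈m⁻¹ : k * k * n ⁻¹ ≈ m ⁻¹
    k²n⁻¹≈m⁻¹ = begin
      k * k * n ⁻¹                  ≈⟨ *-identityˡ _ ⟨
      1# * (k * k * n ⁻¹)           ≈⟨ *-congʳ (⁻¹-inverseʳ (<⇒≉ (norm-pos β≉0))) ⟨
      m * m ⁻¹ * (k * k * n ⁻¹)     ≈⟨ solve 4 (λ m m′ k n′ → m :* m′ :* (k :* k :* n′) := m′ :* (k :* k :* m :* n′)) ℝ.refl m (m ⁻¹) k (n ⁻¹) ⟩
      m ⁻¹ * (k * k * m * n ⁻¹)     ≈⟨ *-congˡ (*-congʳ n≈k²m) ⟨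
      m ⁻¹ * (n * n ⁻¹)             ≈⟨ *-congˡ (⁻¹-inverseʳ (<⇒≉ (norm-pos α≉0))) ⟩
      m ⁻¹ * 1#                     ≈⟨ ℝ.*-identityʳ _ ⟩
      m ⁻¹                          ∎

  reflect-displacement : ∀ α x → reflect α x +ᴹ -ᴹ x ≈ᴹ (- ⟨ x , coroot α ⟩) *ₗ α
  reflect-displacement α x = ≈ᴹ-trans (+ᴹ-congʳ (reflect≈transvection α x))
    (vector-≈ ((‵ x ⊕ ⊖ ⟨ x , coroot α ⟩ ⊛ ‵ α) ⊕ ⊖ ‵ x) ((- ⟨ x , coroot α ⟩) ⊛ ‵ α)
      λ z → solve 3 (λ x m a → x :- m :* a :- x := (:- m) :* a) ℝ.refl ⟨ x , z ⟩ ⟨ x , coroot α ⟩ ⟨ α , z ⟩)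

  coroot-self : ∀ {α} → ¬ (α ≈ᴹ 0ᴹ) → ⟨ α , coroot α ⟩ ≈ 2#
  coroot-self {α} α≉0 = ℝ.trans (⟨⟩-corootʳ α α) (ℝ.trans
    (solve 3 (λ t n n′ → t :* n′ :* n := t :* (n :* n′)) ℝ.refl 2# ⟨ α , α ⟩ (⟨ α , α ⟩ ⁻¹))
    (ℝ.trans (*-congˡ (⁻¹-inverseʳ (<⇒≉ (norm-pos α≉0)))) (ℝ.*-identityʳ 2#)))

  -- A reflection moves each vector by a multiple of its root. So if `w` moves a basis vector, the
  -- displacement is the only candidate root up to scaling, and it is tested on the basis. If `w`
  -- fixes the basis, it is the identity, which negates no nonzero vector.
  isReflection? : ∀ w → Dec (IsReflection w)
  isReflection? w with any? (λ i → ¬? ((w · basis i) ≟ᴹ basis i))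
  ... | no fixes-basis = no λ (α , α≉0 , w-acts) →
    let α-fixed : w · α ≈ᴹ α
        α-fixed = agree-on-basis {g = λ x → x} (·-adjoint w) (λ _ _ → ℝ.refl)
                    (λ i → stable i (λ ne → fixes-basis (i , ne))) α
        -2α≈0 : (- ⟨ α , coroot α ⟩) *ₗ α ≈ᴹ 0ᴹ
        -2α≈0 = ≈ᴹ-trans (≈ᴹ-sym (reflect-displacement α α))
                  (≈ᴹ-trans (+ᴹ-congʳ (≈ᴹ-trans (≈ᴹ-sym (w-acts α)) α-fixed)) (-ᴹ‿inverseʳ α))
        -2*norm≈0 = ℝ.trans (ℝ.sym (⟨⟩-*ˡ _ α α)) (ℝ.trans (⟨⟩-cong -2α≈0 ≈ᴹ-refl) (⟨⟩-zeroˡ α))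
    in <⇒≉ (ℝ.*-pos ℝ.0<2 (norm-pos α≉0)) (ℝ.trans
         (solve 2 (λ t n → t :* n := :- (:- t :* n)) ℝ.refl 2# ⟨ α , α ⟩)
         (ℝ.trans (-‿cong (ℝ.trans (*-congʳ (-‿cong (ℝ.sym (coroot-self α≉0)))) -2*norm≈0)) -0#≈0#))
    where
    stable : ∀ i → ¬ ¬ (w · basis i ≈ᴹ basis i) → w · basis i ≈ᴹ basis i
    stable i ¬¬eq with (w · basis i) ≟ᴹ basis i
    ... | yes eq = eq
    ... | no  ne = contradiction ne ¬¬eq
  ... | yes (i , moved) = map′
      (λ eq → α , α≉0 , agree-on-basis (·-adjoint w) (reflect-adjoint α) eq)
      (λ { (β , β≉0 , w-acts) j → ≈ᴹ-trans (w-acts (basis j)) (≈ᴹ-sym (reflect-parallel α≉0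
             (≈ᴹ-trans (+ᴹ-congʳ (w-acts (basis i))) (reflect-displacement β (basis i))) (basis j))) })
      (all? λ j → (w · basis j) ≟ᴹ reflect α (basis j))
    where
    α : V
    α = w · basis i +ᴹ -ᴹ basis i
    α≉0 : ¬ (α ≈ᴹ 0ᴹ)
    α≉0 α≈0 = moved (x-y≈0⇒x≈y α≈0)

  private
    collect : List W → List T
    collect [] = []
    collect (w ∷ ws) with isReflection? w
    ... | yes w∈T = (w , w∈T) ∷ collect ws
    ... | no  _   = collect ws

  reflections : List T
  reflections = collect elements

  IsReflection-resp : ∀ {u w} → u ≈ᵂ w → IsReflection u → IsReflection w
  IsReflection-resp u≈w (α , α≉0 , acts) = α , α≉0 , λ x → ≈ᴹ-trans (·-congˡ (sym u≈w) x) (acts x)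

  reflections-complete : ∀ (τ : T) → Any (τ ≈ᵀ_) reflections
  reflections-complete (w , w∈T) = go elements (finite w)
    where
    go : ∀ ws → Any (w ≈ᵂ_) ws → Any ((w , w∈T) ≈ᵀ_) (collect ws)
    go (x ∷ ws) p with isReflection? x
    go (x ∷ ws) (here w≈x) | yes _ = here w≈x
    go (x ∷ ws) (there p)  | yes _ = there (go ws p)
    go (x ∷ ws) (here w≈x) | no x∉T = contradiction (IsReflection-resp w≈x w∈T) x∉T
    go (x ∷ ws) (there p)  | no _ = go ws p

  acts-conjugate : ∀ u {w α} → w ActsAsReflectionIn α → (u ∙ w ∙ u ⁻¹ᵂ) ActsAsReflectionIn (u · α)
  acts-conjugate u {w} {α} acts x = ≈ᴹ-trans (·-compose (u ∙ w) (u ⁻¹ᵂ) x)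
    (≈ᴹ-trans (·-compose u w ((u ⁻¹ᵂ) · x)) (≈ᴹ-trans (·-cong u (acts ((u ⁻¹ᵂ) · x)))
    (⟨⟩-ext λ z → ℝ.trans (·-adjoint u _ z) (ℝ.trans
      ⟨⟦ ‵ ((u ⁻¹ᵂ) · x) ⊕ ⊖ (2# * ⟨ (u ⁻¹ᵂ) · x , α ⟩ * ⟨ α , α ⟩ ⁻¹) ⊛ ‵ α ⟧, (u ⁻¹ᵂ) · z ⟩
      (ℝ.trans (ℝ.+-cong (ℝ.trans (ℝ.sym (·-adjoint u _ z)) (⟨⟩-cong (act-inverse u x) ≈ᴹ-refl))
        (-‿cong (*-cong (*-cong (*-congˡ (ℝ.trans (ℝ.sym (·-orthogonal u _ α)) (⟨⟩-cong (act-inverse u x) ≈ᴹ-refl)))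
                                (ℝ.⁻¹-cong (ℝ.sym (·-orthogonal u α α))))
                        (ℝ.sym (·-adjoint u α z)))))
      (ℝ.sym ⟨⟦ ‵ x ⊕ ⊖ (2# * ⟨ x , u · α ⟩ * ⟨ u · α , u · α ⟩ ⁻¹) ⊛ ‵ (u · α) ⟧, z ⟩))))))

  ·-nonzero : ∀ u {α} → ¬ (α ≈ᴹ 0ᴹ) → ¬ (u · α ≈ᴹ 0ᴹ)
  ·-nonzero u {α} α≉0 uα≈0 = <⇒≉ (norm-pos α≉0) (ℝ.trans (ℝ.sym (·-orthogonal u α α))
    (ℝ.trans (⟨⟩-cong uα≈0 ≈ᴹ-refl) (⟨⟩-zeroˡ _)))

  IsReflection-conjugate : ∀ u {w} → IsReflection w → IsReflection (u ∙ w ∙ u ⁻¹ᵂ)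
  IsReflection-conjugate u (α , α≉0 , acts) = u · α , ·-nonzero u α≉0 , acts-conjugate u acts

  reflect-involutive : ∀ {α} → ¬ (α ≈ᴹ 0ᴹ) → ∀ x → reflect α (reflect α x) ≈ᴹ x
  reflect-involutive {α} α≉0 x = ≈ᴹ-trans (reflect≈transvection α (reflect α x))
    (≈ᴹ-trans (+ᴹ-cong (reflect≈transvection α x) (-ᴹ‿cong (*ₗ-congʳ m′≈-m)))
    (vector-≈ ((‵ x ⊕ ⊖ m ⊛ ‵ α) ⊕ ⊖ (- m) ⊛ ‵ α) (‵ x)
      λ z → solve 3 (λ x m a → x :- m :* a :- (:- m) :* a := x) ℝ.refl ⟨ x , z ⟩ m ⟨ α , z ⟩))
    where
    m : Carrier
    m = ⟨ x , coroot α ⟩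
    m′≈-m : ⟨ reflect α x , coroot α ⟩ ≈ - m
    m′≈-m = ℝ.trans (⟨⟩-cong (reflect≈transvection α x) ≈ᴹ-refl)
      (ℝ.trans ⟨⟦ ‵ x ⊕ ⊖ m ⊛ ‵ α ⟧, coroot α ⟩
      (ℝ.trans (+-congˡ (-‿cong (*-congˡ (coroot-self α≉0))))
               (solve 1 (λ m → m :- m :* con (+ 2) := :- m) ℝ.refl m)))

  reflection-involutive : ∀ {w} → IsReflection w → w ∙ w ≈ᵂ ε
  reflection-involutive {w} (α , α≉0 , acts) = ·-faithful λ x → ≈ᴹ-trans (·-compose w w x)
    (≈ᴹ-trans (acts (w · x)) (≈ᴹ-trans (reflect-cong α (acts x))
    (≈ᴹ-trans (reflect-involutive α≉0 x) (≈ᴹ-sym (·-identity x)))))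

-- Reflection factorizations and maximal chains of noncrossing partitions.

module ReflectionFactorizations (G : Group 0ℓ 0ℓ) (IsRefl : Pred (Group.Carrier G) 0ℓ) where
  open Group G

  private
    T : Set
    T = ∃ IsRefl

    infix 4 _≈ᵀ_
    _≈ᵀ_ : Rel T 0ℓ
    _≈ᵀ_ = _≈_ on proj₁

  module Enumerated
    (conjugate-refl : ∀ u {w} → IsRefl w → IsRefl (u ∙ w ∙ u ⁻¹)) (_≟_ : ∀ u w → Dec (u ≈ w))
    (reflections : List T) (complete : ∀ τ → Any (τ ≈ᵀ_) reflections)
    (_<_ : Rel T 0ℓ) (isTotal : IsStrictTotalOrder _≈ᵀ_ _<_)
    where
    open AbsoluteOrder G IsRefl
    open GroupProperties G using (⁻¹-involutive; ⁻¹-anti-homo-∙)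
    open IsStrictTotalOrder isTotal using (compare; <-resp-≈; <-respˡ-≈; <-respʳ-≈)
      renaming (trans to <-trans; irrefl to <-irrefl; asym to <-asym; module Eq to ≈ᵀ)
    open import Relation.Binary.Reasoning.Setoid setoid

    prod : List T → Carrier
    prod ts = foldr _∙_ ε (map proj₁ ts)

    prod-++ : ∀ ts us → prod (ts ++ us) ≈ prod ts ∙ prod us
    prod-++ []       us = sym (identityˡ _)
    prod-++ (t ∷ ts) us = trans (∙-congˡ (prod-++ ts us)) (sym (assoc _ _ _))

    prod-cong : ∀ {ts us} → Pointwise _≈ᵀ_ ts us → prod ts ≈ prod us
    prod-cong []       = refl
    prod-cong (e ∷ es) = ∙-cong e (prod-cong es)

    conjugate : Carrier → T → T
    conjugate u (w , w∈T) = u ∙ w ∙ u ⁻¹ , conjugate-refl u w∈T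

    prod-conjugate : ∀ u ts → prod (map (conjugate u) ts) ≈ u ∙ prod ts ∙ u ⁻¹
    prod-conjugate u []       = sym (trans (∙-congʳ (identityʳ u)) (inverseʳ u))
    prod-conjugate u (t ∷ ts) = begin
      (u ∙ proj₁ t ∙ u ⁻¹) ∙ prod (map (conjugate u) ts)   ≈⟨ ∙-congˡ (prod-conjugate u ts) ⟩
      (u ∙ proj₁ t ∙ u ⁻¹) ∙ (u ∙ prod ts ∙ u ⁻¹)          ≈⟨ assoc _ _ _ ⟩
      (u ∙ proj₁ t) ∙ (u ⁻¹ ∙ (u ∙ prod ts ∙ u ⁻¹))        ≈⟨ ∙-congˡ (∙-congˡ (assoc _ _ _)) ⟩
      (u ∙ proj₁ t) ∙ (u ⁻¹ ∙ (u ∙ (prod ts ∙ u ⁻¹)))      ≈⟨ ∙-congˡ (cancel′ u _) ⟩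
      (u ∙ proj₁ t) ∙ (prod ts ∙ u ⁻¹)                     ≈⟨ assoc _ _ _ ⟨
      (u ∙ proj₁ t) ∙ prod ts ∙ u ⁻¹                       ≈⟨ ∙-congʳ (assoc _ _ _) ⟩
      u ∙ (proj₁ t ∙ prod ts) ∙ u ⁻¹                       ∎

    swap-conjugate : ∀ u t → u ∙ proj₁ (conjugate (u ⁻¹) t) ≈ proj₁ t ∙ u
    swap-conjugate u t = begin
      u ∙ (u ⁻¹ ∙ proj₁ t ∙ u ⁻¹ ⁻¹)     ≈⟨ ∙-congˡ (∙-congˡ (⁻¹-involutive u)) ⟩
      u ∙ (u ⁻¹ ∙ proj₁ t ∙ u)           ≈⟨ ∙-congˡ (assoc _ _ _) ⟩
      u ∙ (u ⁻¹ ∙ (proj₁ t ∙ u))         ≈⟨ cancel u _ ⟩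
      proj₁ t ∙ u                        ∎

    FactorsInto : Carrier → ℕ → Set
    FactorsInto w k = ∃[ ts ] length ts ≡ k × prod ts ≈ w

    IsProductOf⇒FactorsInto : ∀ {w k} → w IsProductOf k → FactorsInto w k
    IsProductOf⇒FactorsInto (ws , ws∈T , ≡.refl , e) =
      proj₁ (attach ws ws∈T) , proj₁ (proj₂ (attach ws ws∈T)) , trans (proj₂ (proj₂ (attach ws ws∈T))) (sym e)
      where
      attach : ∀ ws → All IsRefl ws → Σ[ ts ∈ List T ] length ts ≡ length ws × prod ts ≈ foldr _∙_ ε ws
      attach []       []          = [] , ≡.refl , refl
      attach (w ∷ ws) (p ∷ ps) with attach ws ps
      ... | ts , l , e = (w , p) ∷ ts , ≡.cong suc l , ∙-congˡ e

    prod-IsProductOf : ∀ ts → prod ts IsProductOf length ts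
    prod-IsProductOf ts = map proj₁ ts , forget ts , length-map proj₁ ts , refl
      where
      forget : ∀ (ts : List T) → All IsRefl (map proj₁ ts)
      forget []       = []
      forget (t ∷ ts) = proj₂ t ∷ forget ts

    FactorsInto-resp : ∀ {u w k} → u ≈ w → FactorsInto u k → FactorsInto w k
    FactorsInto-resp u≈w (ts , l , e) = ts , l , trans e u≈w

    -- The first factor may be sought in the finite list `reflections`. Decidability permits the
    -- choice of a least first factor in `lexMinimal`.
    FactorsInto? : ∀ k w → Dec (FactorsInto w k)
    FactorsInto? zero w = map′ (λ ε≈w → [] , ≡.refl , ε≈w) (λ { ([] , _ , e) → e }) (ε ≟ w)
    FactorsInto? (suc k) w = map′ to from (Any.any? (λ t → FactorsInto? k (proj₁ t ⁻¹ ∙ w)) reflections)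
      where
      to : Any (λ t → FactorsInto (proj₁ t ⁻¹ ∙ w) k) reflections → FactorsInto w (suc k)
      to any with Any.satisfied any
      ... | t , ts , l , e = t ∷ ts , ≡.cong suc l , trans (∙-congˡ e) (cancel (proj₁ t) w)
      from : FactorsInto w (suc k) → Any (λ t → FactorsInto (proj₁ t ⁻¹ ∙ w) k) reflections
      from (t ∷ ts , l , e) = Any.map (λ t≈s → ts , ℕ.suc-injective l ,
        trans (sym (cancel′ (proj₁ t) (prod ts))) (∙-cong (⁻¹-cong t≈s) e)) (complete t)

    minimum : ∀ {P : T → Set} → (∀ t → Dec (P t)) → (∀ {t s} → t ≈ᵀ s → P t → P s) → ∀ ts → Any P ts →
      ∃[ m ] P m × (∀ t → Any (t ≈ᵀ_) ts → P t → ¬ (t < m))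
    minimum P? P-resp (t ∷ ts) any with Any.any? P? ts
    minimum P? P-resp (t ∷ ts) (here Pt)   | no ∄P = t , Pt , λ
      { s (here s≈t)   Ps s<t → <-irrefl s≈t s<t
      ; s (there s∈ts) Ps _   → ∄P (Any.map (λ s≈x → P-resp s≈x Ps) s∈ts) }
    minimum P? P-resp (t ∷ ts) (there any) | no ∄P = contradiction any ∄P
    minimum P? P-resp (t ∷ ts) _ | yes any with minimum P? P-resp ts any | P? t
    ... | m , Pm , least | no ¬Pt = m , Pm , λ
      { s (here s≈t)   Ps → contradiction (P-resp s≈t Ps) ¬Pt
      ; s (there s∈ts) Ps → least s s∈ts Ps }
    ... | m , Pm , least | yes Pt with compare t m
    ... | tri< t<m _ _ = t , Pt , λ
      { s (here s≈t)   Ps s<t → <-irrefl s≈t s<t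
      ; s (there s∈ts) Ps s<t → least s s∈ts Ps (<-trans s<t t<m) }
    ... | tri≈ t≮m _ _ = m , Pm , λ
      { s (here s≈t)   Ps s<m → t≮m (<-respˡ-≈ s≈t s<m)
      ; s (there s∈ts) Ps → least s s∈ts Ps }
    ... | tri> t≮m _ _ = m , Pm , λ
      { s (here s≈t)   Ps s<m → t≮m (<-respˡ-≈ s≈t s<m)
      ; s (there s∈ts) Ps → least s s∈ts Ps }

    LexMinimal Reduced : Pred (List T) 0ℓ
    LexMinimal ts = ∀ us → length us ≡ length ts → prod us ≈ prod ts → Lex-≤ _≈ᵀ_ _<_ ts us
    Reduced ts = ∀ us → prod us ≈ prod ts → length ts ℕ.≤ length us

    -- Greedy construction: the least first factor whose quotient still factors into `k`
    -- reflections, followed by a minimal factorization of that quotient.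
    lexMinimal : ∀ k w → FactorsInto w k → ∃[ ts ] length ts ≡ k × prod ts ≈ w × LexMinimal ts
    lexMinimal zero    w ([] , l , e) = [] , l , e , λ { [] _ _ → base _ }
    lexMinimal (suc k) w (t ∷ ts , l , e)
      with minimum (λ t → FactorsInto? k (proj₁ t ⁻¹ ∙ w))
             (λ t≈s → FactorsInto-resp (∙-congʳ (⁻¹-cong t≈s))) reflections
             (Any.map (λ t≈s → ts , ℕ.suc-injective l ,
               trans (sym (cancel′ (proj₁ t) (prod ts))) (∙-cong (⁻¹-cong t≈s) e)) (complete t))
    ... | m , m-factors , least with lexMinimal k (proj₁ m ⁻¹ ∙ w) m-factors
    ... | ts′ , ≡.refl , e′ , min′ = m ∷ ts′ , ≡.refl , m∷ts′≈w , min
      where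
      m∷ts′≈w : proj₁ m ∙ prod ts′ ≈ w
      m∷ts′≈w = trans (∙-congˡ e′) (cancel (proj₁ m) w)

      min : LexMinimal (m ∷ ts′)
      min (u ∷ us) l eq with compare m u
      ... | tri< m<u _ _ = this m<u
      ... | tri> _ _ u<m = contradiction u<m (least u (complete u) u-factors)
        where
        u-factors : FactorsInto (proj₁ u ⁻¹ ∙ w) k
        u-factors = us , ℕ.suc-injective l ,
          trans (sym (cancel′ (proj₁ u) (prod us))) (∙-congˡ (trans eq m∷ts′≈w))
      ... | tri≈ _ m≈u _ = next m≈u (min′ us (ℕ.suc-injective l) (begin
        prod us                               ≈⟨ cancel′ (proj₁ u) _ ⟨
        proj₁ u ⁻¹ ∙ (proj₁ u ∙ prod us)      ≈⟨ ∙-cong (⁻¹-cong (sym m≈u)) eq ⟩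
        proj₁ m ⁻¹ ∙ (proj₁ m ∙ prod ts′)     ≈⟨ cancel′ (proj₁ m) _ ⟩
        prod ts′                              ∎))

    module _ (involutive : ∀ {w} → IsRefl w → w ∙ w ≈ ε) where

      -- A descent t₁ > t₂ would be removed by t₁ t₂ = t₂ (t₂⁻¹ t₁ t₂).
      lexMinimal⇒rising : ∀ ts → Reduced ts → LexMinimal ts → Linked _<_ ts
      lexMinimal⇒rising []       _ _ = []
      lexMinimal⇒rising (t ∷ []) _ _ = [-]
      lexMinimal⇒rising (t ∷ s ∷ ts) red min = t<s ∷ lexMinimal⇒rising (s ∷ ts)
        (λ us e → ℕ.s≤s⁻¹ (red (t ∷ us) (∙-congˡ e))) tail-min
        where
        tail-min : LexMinimal (s ∷ ts)
        tail-min us l e with min (t ∷ us) (≡.cong suc l) (∙-congˡ e)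
        ... | this t<t = contradiction t<t (<-irrefl refl)
        ... | next _ r = r

        swapped : prod (s ∷ conjugate (proj₁ s ⁻¹) t ∷ ts) ≈ prod (t ∷ s ∷ ts)
        swapped = trans (sym (assoc _ _ _)) (trans (∙-congʳ (swap-conjugate (proj₁ s) t)) (assoc _ _ _))

        t<s : t < s
        t<s with compare t s
        ... | tri< t<s _ _ = t<s
        -- Equal neighbours cancel, which contradicts minimal length.
        ... | tri≈ _ t≈s _ = contradiction (red ts (begin
                prod ts                            ≈⟨ identityˡ _ ⟨
                ε ∙ prod ts                        ≈⟨ ∙-congʳ (involutive (proj₂ s)) ⟨
                proj₁ s ∙ proj₁ s ∙ prod ts        ≈⟨ assoc _ _ _ ⟩
                proj₁ s ∙ (proj₁ s ∙ prod ts)      ≈⟨ ∙-congʳ t≈s ⟨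
                proj₁ t ∙ (proj₁ s ∙ prod ts)      ∎))
              (ℕ.<⇒≱ (ℕ.m≤n⇒m≤1+n ℕ.≤-refl))
        ... | tri> _ t≉s s<t with min (s ∷ conjugate (proj₁ s ⁻¹) t ∷ ts) ≡.refl swapped
        ...   | this t<s   = t<s
        ...   | next t≈s _ = contradiction t≈s t≉s

    prefix-length : ∀ {x v i j} → lT[ v ]≡ (i ℕ.+ j) → x IsProductOf i → x ⁻¹ ∙ v IsProductOf j → lT[ x ]≡ i
    prefix-length {i = i} {j} (_ , v-min) x-prod q-prod = x-prod , λ {k} x-prod′ →
      ℕ.+-cancelʳ-≤ j i k (v-min (prod-quot x-prod′ q-prod))

    prefix-⪯ : ∀ {x v i j} → lT[ v ]≡ (i ℕ.+ j) → x IsProductOf i → x ⁻¹ ∙ v IsProductOf j → x ⪯ v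
    prefix-⪯ {i = i} {j} v-len x-prod q-prod = i , j , i ℕ.+ j , prefix-length v-len x-prod q-prod ,
      (q-prod , λ {k} q-prod′ → ℕ.+-cancelˡ-≤ i j k (proj₂ v-len (prod-quot x-prod q-prod′))) , v-len , ≡.refl

    -- The complement `rest` is explicit so that two factorizations of one element can be extended
    -- to `γ` by the same list.
    record Completes (γ : Carrier) (ts rest : List T) : Set where
      constructor _,_
      field
        factorizes : prod ts ∙ prod rest ≈ γ
        shortest   : lT[ γ ]≡ (length ts ℕ.+ length rest)

    ExtendsTo : Carrier → Pred (List T) 0ℓ
    ExtendsTo γ ts = ∃[ rest ] Completes γ ts rest

    ExtendsTo⇒InNC : ∀ {γ} ts → ExtendsTo γ ts → InNC γ (prod ts)
    ExtendsTo⇒InNC {γ} ts (rest , e , γ-len) =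
      ε⪯ (prefix-length γ-len (prod-IsProductOf ts) rest-prod) , prefix-⪯ γ-len (prod-IsProductOf ts) rest-prod
      where
      rest-prod : prod ts ⁻¹ ∙ γ IsProductOf length rest
      rest-prod = prod-resp (trans (sym (cancel′ (prod ts) (prod rest))) (∙-congˡ e)) (prod-IsProductOf rest)

    private
      length-shift : ∀ k (rest : List T) t → suc k ℕ.+ length rest ≡ k ℕ.+ length (rest ++ [ t ])
      length-shift k rest t = ≡.sym (≡.trans (≡.cong (k ℕ.+_) (≡.trans (length-++ rest) (ℕ.+-comm (length rest) 1)))
        (ℕ.+-suc k (length rest)))

    -- Cyclic rotation: `γ = t u` gives `γ = u (γ⁻¹ t γ)` with the same number of factors, so the
    -- tail again begins a shortest factorization of `γ`.
    Completes-tail : ∀ {γ t ts rest} → Completes γ (t ∷ ts) rest → Completes γ ts (rest ++ [ conjugate (γ ⁻¹) t ])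
    Completes-tail {γ} {t} {ts} {rest} (e , γ-len) = (begin
        prod ts ∙ prod (rest ++ [ conjugate (γ ⁻¹) t ])
          ≈⟨ ∙-congˡ (trans (prod-++ rest _) (∙-congˡ (identityʳ _))) ⟩
        prod ts ∙ (prod rest ∙ proj₁ (conjugate (γ ⁻¹) t))
          ≈⟨ assoc _ _ _ ⟨
        prod ts ∙ prod rest ∙ proj₁ (conjugate (γ ⁻¹) t)
          ≈⟨ ∙-congʳ (trans (sym (cancel′ (proj₁ t) _)) (∙-congˡ (trans (sym (assoc _ _ _)) e))) ⟩
        (proj₁ t ⁻¹ ∙ γ) ∙ proj₁ (conjugate (γ ⁻¹) t)
          ≈⟨ trans (assoc _ _ _) (∙-congˡ (swap-conjugate γ t)) ⟩
        proj₁ t ⁻¹ ∙ (proj₁ t ∙ γ)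
          ≈⟨ cancel′ _ _ ⟩
        γ ∎) , ≡.subst (lT[ γ ]≡_) (length-shift (length ts) rest _) γ-len

    -- A Hurwitz move: `s u = u (u⁻¹ s u)` carries the second factor past all later ones to the end.
    Completes-drop : ∀ {γ t s ts rest} → Completes γ (t ∷ s ∷ ts) rest → ExtendsTo γ (t ∷ ts)
    Completes-drop {γ} {t} {s} {ts} {rest} (e , γ-len) = rest ++ [ s′ ] , (begin
        (proj₁ t ∙ prod ts) ∙ prod (rest ++ [ s′ ])
          ≈⟨ ∙-congˡ (trans (prod-++ rest _) (∙-congˡ (identityʳ _))) ⟩
        (proj₁ t ∙ prod ts) ∙ (prod rest ∙ proj₁ s′)
          ≈⟨ trans (assoc _ _ _) (∙-congˡ (sym (assoc _ _ _))) ⟩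
        proj₁ t ∙ (prod ts ∙ prod rest ∙ proj₁ s′)
          ≈⟨ ∙-congˡ (swap-conjugate _ s) ⟩
        proj₁ t ∙ (proj₁ s ∙ (prod ts ∙ prod rest))
          ≈⟨ trans (assoc _ _ _) (∙-congˡ (assoc _ _ _)) ⟨
        (proj₁ t ∙ (proj₁ s ∙ prod ts)) ∙ prod rest
          ≈⟨ e ⟩
        γ ∎) , ≡.subst (lT[ γ ]≡_) (length-shift (suc (length ts)) rest s′) γ-len
      where
      s′ : T
      s′ = conjugate ((prod ts ∙ prod rest) ⁻¹) s

    Completes-truncate : ∀ {γ t s ts rest} → Completes γ (t ∷ s ∷ ts) rest → ExtendsTo γ (t ∷ s ∷ [])
    Completes-truncate {γ} {t} {s} {ts} {rest} (e , γ-len) = ts ++ rest ,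
      trans (∙-cong (∙-congˡ (identityʳ _)) (prod-++ ts rest))
        (trans (trans (sym (assoc _ _ _)) (∙-congʳ (assoc _ _ _))) e) ,
      ≡.subst (lT[ γ ]≡_) (≡.cong (2 ℕ.+_) (≡.sym (length-++ ts))) γ-len

    -- Rotating away the factors before `t` and moving away those between `t` and `s` puts any two
    -- factors in front. Their product then lies in `NC γ`, which compatibility asks for.
    Completes⇒pairs : ∀ {γ ts rest} → Completes γ ts rest → AllPairs (λ t s → ExtendsTo γ (t ∷ s ∷ [])) ts
    Completes⇒pairs {ts = []}     _    = []
    Completes⇒pairs {γ} {t ∷ ts}  comp = with-head ts (_ , comp) ∷ Completes⇒pairs (Completes-tail comp)
      where
      with-head : ∀ ts → ExtendsTo γ (t ∷ ts) → All (λ s → ExtendsTo γ (t ∷ s ∷ [])) ts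
      with-head []       _          = []
      with-head (s ∷ ts) (_ , comp) = Completes-truncate comp ∷ with-head ts (Completes-drop comp)

    -- Once the heads agree, they are rotated to the back of `rest`. Both tails are then completed
    -- by lists of the same product, so the comparison of heads applies again with the same `γ`.
    rising-unique : ∀ {γ} →
      (∀ {t ts s ss rest} → Linked _<_ (t ∷ ts) → Linked _<_ (s ∷ ss) →
        Completes γ (t ∷ ts) rest → Completes γ (s ∷ ss) rest → t ≈ᵀ s) →
      ∀ ts ss {rest} → Linked _<_ ts → Linked _<_ ss → Completes γ ts rest → Completes γ ss rest →
      Pointwise _≈ᵀ_ ts ss
    rising-unique heads []       []       _ _ _ _ = []
    rising-unique heads []       (s ∷ ss) _ _ (_ , l) (_ , l′) =
      contradiction (length-unique l l′) (ℕ.m≢1+n+m _)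
    rising-unique heads (t ∷ ts) []       _ _ (_ , l) (_ , l′) =
      contradiction (length-unique l′ l) (ℕ.m≢1+n+m _)
    rising-unique {γ} heads (t ∷ ts) (s ∷ ss) {rest} t↗ s↗ t-comp s-comp =
      t≈s ∷ rising-unique heads ts ss (Linked.tail t↗) (Linked.tail s↗) (Completes-tail t-comp) s-comp′
      where
      t≈s = heads t↗ s↗ t-comp s-comp

      s-comp′ : Completes γ ss (rest ++ [ conjugate (γ ⁻¹) t ])
      s-comp′ with Completes-tail {ts = ss} s-comp
      ... | e , l = trans (∙-congˡ (trans (prod-++ rest [ conjugate (γ ⁻¹) t ]) (trans
                            (∙-congˡ (∙-congʳ (∙-congʳ (∙-congˡ t≈s)))) (sym (prod-++ rest [ conjugate (γ ⁻¹) s ]))))) e ,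
                    ≡.subst (lT[ γ ]≡_) (≡.cong (length ss ℕ.+_) (≡.trans (length-++ rest) (≡.sym (length-++ rest)))) l

    module Chains (γ : Carrier) (label : ∀ u v → Covering._⋖_ (NC γ) u v → T)
      (label-≈ : ∀ u v u⋖v → proj₁ (label u v u⋖v) ≈ proj₁ u ⁻¹ ∙ proj₁ v)
      (involutive : ∀ {w} → IsRefl w → w ∙ w ≈ ε) where

      open Covering (NC γ)

      L : StrictTotalOrder 0ℓ 0ℓ 0ℓ
      L = record { isStrictTotalOrder = isTotal }

      open EdgeLabelings (NC γ) L label
      private
        NCγ : Set
        NCγ = ∃ (InNC γ)
        infix 4 _<ᴺ_
        _<ᴺ_ : Rel NCγ 0ℓ
        _<ᴺ_ = PosetProperties._<_ (NC γ)

      cover-length : ∀ {u v a} → u ⋖ v → lT[ proj₁ u ]≡ a → lT[ proj₁ v ]≡ suc a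
      cover-length {u} {v} {a} u⋖v@(((a′ , b , c , u-len , q-len , v-len , l) , u≉v) , _) u-len′
        with length-unique u-len u-len′
      ... | ≡.refl = ≡.subst (lT[ proj₁ v ]≡_) (≡.trans (≡.sym l) (≡.trans (≡.cong (a ℕ.+_) b≡1) (ℕ.+-comm a 1))) v-len
        where
        b≤1 : b ℕ.≤ 1
        b≤1 = proj₂ q-len (proj₁ τ ∷ [] , proj₂ τ ∷ [] , ≡.refl ,
                sym (trans (identityʳ _) (label-≈ u v u⋖v)))
          where
          τ : T
          τ = label u v u⋖v
        b≢0 : ¬ (b ≡ 0)
        b≢0 ≡.refl = u≉v (quot-ε (length-0 q-len))
        b≡1 : b ≡ 1
        b≡1 = ℕ.≤-antisym b≤1 (ℕ.n≢0⇒n>0 b≢0)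

      labels-length : ∀ {u v a} (d : MaximalChain u v) → lT[ proj₁ u ]≡ a → lT[ proj₁ v ]≡ (length (labels d) ℕ.+ a)
      labels-length done                     u-len = u-len
      labels-length {u} {v} {a} (_◅_ {j = x} u⋖x d) u-len =
        ≡.subst (lT[ proj₁ v ]≡_) (ℕ.+-suc _ a) (labels-length d (cover-length {u} {x} u⋖x u-len))

      labels-prod : ∀ {u v} (d : MaximalChain u v) → prod (labels d) ≈ proj₁ u ⁻¹ ∙ proj₁ v
      labels-prod {u} done              = sym (inverseˡ _)
      labels-prod {u} {v} (_◅_ {j = x} u⋖x d) = trans (∙-cong (label-≈ u x u⋖x) (labels-prod d))
        (telescope (proj₁ u) (proj₁ x) (proj₁ v))

      cover : ∀ (u v : NCγ) {a} → lT[ proj₁ u ]≡ a → lT[ proj₁ v ]≡ suc a → proj₁ u ⁻¹ ∙ proj₁ v IsProductOf 1 → u ⋖ v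
      cover u v {a} u-len v-len q-prod =
        (prefix-⪯ (≡.subst (lT[ proj₁ v ]≡_) (ℕ.+-comm 1 a) v-len) (proj₁ u-len) q-prod ,
         λ u≈v → ℕ.1+n≢n (length-unique v-len (length-resp u≈v u-len))) ,
        λ z (u<z , z<v) → between z u<z z<v
        where
        longer : ∀ {x y i} → x <ᴺ y → lT[ proj₁ x ]≡ i → ∃[ j ] lT[ proj₁ y ]≡ j × i ℕ.< j
        longer {x} {y} {i} ((i′ , b , j , x-len , q-len , y-len , l) , x≉y) x-len′ with length-unique x-len x-len′
        ... | ≡.refl = j , y-len , ≡.subst (i ℕ.<_) l (ℕ.m<m+n i (ℕ.n≢0⇒n>0 λ { ≡.refl → x≉y (quot-ε (length-0 q-len)) }))
        between : ∀ z → u <ᴺ z → ¬ (z <ᴺ v)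
        between z u<z z<v with longer {u} {z} u<z u-len
        ... | j , z-len , a<j with longer {z} {v} z<v z-len
        ...   | k , v-len′ , j<k with length-unique v-len v-len′
        ...     | ≡.refl = ℕ.<⇒≱ j<k a<j

      intermediate : ∀ {a} (u v : NCγ) t ts → lT[ proj₁ u ]≡ a → lT[ proj₁ v ]≡ (suc a ℕ.+ length ts) →
        prod (t ∷ ts) ≈ proj₁ u ⁻¹ ∙ proj₁ v →
        Σ[ x ∈ NCγ ] proj₁ u ⁻¹ ∙ proj₁ x ≈ proj₁ t × prod ts ≈ proj₁ x ⁻¹ ∙ proj₁ v ×
          lT[ proj₁ x ]≡ suc a × u ⋖ x
      intermediate {a} u v t ts u-len v-len e = x , cancel′ (proj₁ u) (proj₁ t) , x-prod , x-len ,
        cover u x u-len x-len (prod-resp (trans (identityʳ _) (sym (cancel′ (proj₁ u) (proj₁ t)))) (prod-IsProductOf (t ∷ [])))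
        where
        ut : Carrier
        ut = proj₁ u ∙ proj₁ t

        x-prod : prod ts ≈ ut ⁻¹ ∙ proj₁ v
        x-prod = begin
          prod ts                                             ≈⟨ cancel′ (proj₁ t) _ ⟨
          proj₁ t ⁻¹ ∙ prod (t ∷ ts)                          ≈⟨ ∙-congˡ e ⟩
          proj₁ t ⁻¹ ∙ (proj₁ u ⁻¹ ∙ proj₁ v)                 ≈⟨ assoc _ _ _ ⟨
          proj₁ t ⁻¹ ∙ proj₁ u ⁻¹ ∙ proj₁ v                   ≈⟨ ∙-congʳ (⁻¹-anti-homo-∙ _ _) ⟨
          ut ⁻¹ ∙ proj₁ v                                     ∎

        ut-prod : ut IsProductOf suc a
        ut-prod = ≡.subst (ut IsProductOf_) (ℕ.+-comm a 1)
          (prod-∙ (proj₁ u-len) (prod-resp (identityʳ _) (prod-IsProductOf (t ∷ []))))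

        q-prod : ut ⁻¹ ∙ proj₁ v IsProductOf length ts
        q-prod = prod-resp x-prod (prod-IsProductOf ts)

        x-len : lT[ ut ]≡ suc a
        x-len = prefix-length v-len ut-prod q-prod

        x : NCγ
        x = ut , ε⪯ x-len , ⪯-trans (prefix-⪯ v-len ut-prod q-prod) (proj₂ (proj₂ v))

      -- The vertices are `u` times the partial products; minimal length places them in the interval
      -- and makes consecutive ones covers.
      chain-from-factorization : ∀ {a} (u v : NCγ) t ts → lT[ proj₁ u ]≡ a → lT[ proj₁ v ]≡ (suc a ℕ.+ length ts) →
        prod (t ∷ ts) ≈ proj₁ u ⁻¹ ∙ proj₁ v → Σ[ d ∈ MaximalChain u v ] Pointwise _≈ᵀ_ (labels d) (t ∷ ts)
      chain-from-factorization {a} u v t [] u-len v-len e =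
        u⋖v ◅ done , trans (label-≈ u v u⋖v) (trans (sym e) (identityʳ _)) ∷ []
        where
        u⋖v : u ⋖ v
        u⋖v = cover u v u-len (≡.subst (lT[ proj₁ v ]≡_) (ℕ.+-identityʳ (suc a)) v-len)
          (prod-resp e (prod-IsProductOf (t ∷ [])))
      chain-from-factorization {a} u v t ts@(s ∷ ts′) u-len v-len e = extend (intermediate u v t ts u-len v-len e)
        where
        extend : (Σ[ x ∈ NCγ ] proj₁ u ⁻¹ ∙ proj₁ x ≈ proj₁ t × prod ts ≈ proj₁ x ⁻¹ ∙ proj₁ v ×
                    lT[ proj₁ x ]≡ suc a × u ⋖ x) →
          Σ[ d ∈ MaximalChain u v ] Pointwise _≈ᵀ_ (labels d) (t ∷ ts)
        extend (x , u⁻¹x≈t , x-prod , x-len , u⋖x) =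
          let d , d≈ts = chain-from-factorization x v s ts′ x-len
                (≡.subst (lT[ proj₁ v ]≡_) (ℕ.+-suc (suc a) (length ts′)) v-len) x-prod
          in u⋖x ◅ d , trans (label-≈ u x u⋖x) u⁻¹x≈t ∷ d≈ts

      labels-determine-vertices : ∀ {u v u′ v′} (c : MaximalChain u v) (d : MaximalChain u′ v′) →
        proj₁ u ≈ proj₁ u′ → Pointwise _≈ᵀ_ (labels c) (labels d) →
        Pointwise (_≈_ on proj₁) (vertices c) (vertices d)
      labels-determine-vertices done done u≈u′ [] = u≈u′ ∷ []
      labels-determine-vertices {u} {v} {u′} {v′} (_◅_ {j = x} e c) (_◅_ {j = x′} e′ d) u≈u′ (t≈t′ ∷ ts≈ts′) =
        u≈u′ ∷ labels-determine-vertices c d (begin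
          proj₁ x                                 ≈⟨ cancel (proj₁ u) (proj₁ x) ⟨
          proj₁ u ∙ (proj₁ u ⁻¹ ∙ proj₁ x)        ≈⟨ ∙-congˡ (label-≈ u x e) ⟨
          proj₁ u ∙ proj₁ (label u x e)           ≈⟨ ∙-cong u≈u′ t≈t′ ⟩
          proj₁ u′ ∙ proj₁ (label u′ x′ e′)       ≈⟨ ∙-congˡ (label-≈ u′ x′ e′) ⟩
          proj₁ u′ ∙ (proj₁ u′ ⁻¹ ∙ proj₁ x′)     ≈⟨ cancel (proj₁ u′) (proj₁ x′) ⟩
          proj₁ x′                                ∎) ts≈ts′

      lexSmallest-chain : ∀ {u v} → u <ᴺ v →
        Σ[ c ∈ MaximalChain u v ] LexSmallest c × (∀ d → LexSmallest d → d ≋ c) × Rising c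
      lexSmallest-chain {u} {v} ((a , b , _ , u-len , q-len , v-len , ≡.refl) , u≉v)
        with lexMinimal b (proj₁ u ⁻¹ ∙ proj₁ v) (IsProductOf⇒FactorsInto (proj₁ q-len))
      ... | [] , ≡.refl , e , _ = contradiction (quot-ε (sym e)) u≉v
      ... | ts@(t ∷ ts′) , ≡.refl , e , min with chain-from-factorization u v t ts′ u-len
              (≡.subst (lT[ proj₁ v ]≡_) (ℕ.+-suc a (length ts′)) v-len) e
      ... | c , c≈ts = c , c-smallest , unique , rising
        where
        len : ∀ (d : MaximalChain u v) → length (labels d) ≡ length ts
        len d = ℕ.+-cancelʳ-≡ a _ _ (≡.trans (length-unique (labels-length d u-len) v-len) (ℕ.+-comm a _))

        ts-smallest : ∀ d → Lex-≤ _≈ᵀ_ _<_ ts (labels d)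
        ts-smallest d = min (labels d) (len d) (trans (labels-prod d) (sym e))

        c-smallest : LexSmallest c
        c-smallest d = proj₂ (Lex.≤-respects₂ ≈ᵀ.isEquivalence <-resp-≈)
          (Pointwise.symmetric (λ {x} {y} → ≈ᵀ.sym {x} {y}) c≈ts) (ts-smallest d)

        unique : ∀ d → LexSmallest d → d ≋ c
        unique d d-smallest = labels-determine-vertices d c refl
          (Lex.≤-antisymmetric (λ {x} {y} → ≈ᵀ.sym {x} {y}) (λ {x} {y} → <-irrefl {x} {y})
            (λ {x} {y} → <-asym {x} {y}) (d-smallest c) (c-smallest d))

        rising : Rising c
        rising = Linked-resp (lexMinimal⇒rising involutive ts reduced min) (Pointwise.symmetric (λ {x} {y} → ≈ᵀ.sym {x} {y}) c≈ts)
          where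
          reduced : Reduced ts
          reduced us eq = proj₂ q-len (prod-resp (trans eq e) (prod-IsProductOf us))

          Linked-resp : ∀ {xs ys} → Linked _<_ xs → Pointwise _≈ᵀ_ xs ys → Linked _<_ ys
          Linked-resp []       []             = []
          Linked-resp [-]      (_ ∷ [])       = [-]
          Linked-resp (r ∷ rs) (p ∷ ps@(q ∷ _)) = <-respˡ-≈ p (<-respʳ-≈ q r) ∷ Linked-resp rs ps

      -- `(u⁻¹ v) (v⁻¹ γ) (γ⁻¹ u γ) = γ`, and the lengths add up. The last two blocks depend on the
      -- interval only, so one list serves all its chains.
      interval-completion : ∀ {u v} → u <ᴺ v → ∃[ rest ] (∀ (d : MaximalChain u v) → Completes γ (labels d) rest)
      interval-completion {u} {v} ((a , b , _ , u-len , q-len , v-len , ≡.refl) , u≉v)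
        with proj₂ (proj₂ v) | IsProductOf⇒FactorsInto (proj₁ u-len)
      ... | a+b′ , k , _ , v-len′ , r-len , γ-len , ≡.refl | us , ≡.refl , us≈u
        with IsProductOf⇒FactorsInto (proj₁ r-len) | length-unique v-len v-len′
      ... | ws , ≡.refl , ws≈v⁻¹γ | ≡.refl = ws ++ map (conjugate (γ ⁻¹)) us , λ d →
        (begin
          prod (labels d) ∙ prod (ws ++ map (conjugate (γ ⁻¹)) us)
            ≈⟨ ∙-cong (labels-prod d) (trans (prod-++ ws _) (∙-cong ws≈v⁻¹γ (prod-conjugate (γ ⁻¹) us))) ⟩
          (proj₁ u ⁻¹ ∙ proj₁ v) ∙ ((proj₁ v ⁻¹ ∙ γ) ∙ (γ ⁻¹ ∙ prod us ∙ γ ⁻¹ ⁻¹))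
            ≈⟨ assoc _ _ _ ⟨
          ((proj₁ u ⁻¹ ∙ proj₁ v) ∙ (proj₁ v ⁻¹ ∙ γ)) ∙ (γ ⁻¹ ∙ prod us ∙ γ ⁻¹ ⁻¹)
            ≈⟨ ∙-cong (telescope _ _ _) (∙-cong (∙-congˡ us≈u) (⁻¹-involutive γ)) ⟩
          (proj₁ u ⁻¹ ∙ γ) ∙ (γ ⁻¹ ∙ proj₁ u ∙ γ)
            ≈⟨ ∙-congˡ (assoc _ _ _) ⟩
          (proj₁ u ⁻¹ ∙ γ) ∙ (γ ⁻¹ ∙ (proj₁ u ∙ γ))
            ≈⟨ telescope _ _ _ ⟩
          proj₁ u ⁻¹ ∙ (proj₁ u ∙ γ)
            ≈⟨ cancel′ _ _ ⟩
          γ ∎) , ≡.subst (lT[ γ ]≡_) (len d) γ-len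
        where
        len : ∀ d → (length us ℕ.+ b) ℕ.+ length ws ≡ length (labels d) ℕ.+ length (ws ++ map (conjugate (γ ⁻¹)) us)
        len d = ≡.trans (≡.cong (ℕ._+ length ws) (length-unique v-len (labels-length d u-len)))
          (≡.trans (ℕ.+-assoc (length (labels d)) (length us) (length ws)) (≡.cong (length (labels d) ℕ.+_)
            (≡.trans (ℕ.+-comm (length us) (length ws)) (≡.sym (≡.trans (length-++ ws)
              (≡.cong (length ws ℕ.+_) (length-map (conjugate (γ ⁻¹)) us)))))))

-- Well-foundedness from a map to a finite set.

private
  accessible-via : ∀ {A : Set} {N} {R : Rel A 0ℓ} (g : A → Fin N) {_⊏_ : Rel (Fin N) 0ℓ} →
    (∀ {a b} → R a b → g a ⊏ g b) → ∀ {a} → Acc _⊏_ (g a) → Acc R a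
  accessible-via g mono (acc rs) = acc λ Rba → accessible-via g mono (rs (mono Rba))

-- Elements of `A` carry proofs and are compared up to a setoid equality, so `A` need not be finite
-- as a type. The target of `g` is finite, and since the left argument of `R` matters only through
-- `g`, a strict partial order is induced there.
finite-wellFounded : ∀ {A : Set} {N} (g : A → Fin N) (R : Rel A 0ℓ) →
  (∀ {a b c} → R a b → R b c → R a c) → (∀ {a} → ¬ R a a) →
  (∀ {a b c} → g a ≡ g b → R a c → R b c) → WellFounded R
finite-wellFounded {A} {N} g R R-trans R-irrefl R-resp a =
  accessible-via g (λ {a} {b} Rab → a , b , ≡.refl , ≡.refl , Rab) (FinInduction.spo-wellFounded isSPO (g a))
  where
  _⊏_ : Rel (Fin N) 0ℓ
  i ⊏ j = ∃[ a ] ∃[ b ] g a ≡ i × g b ≡ j × R a b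

  isSPO : IsStrictPartialOrder _≡_ _⊏_
  isSPO = record
    { isEquivalence = ≡.isEquivalence
    ; irrefl   = λ { ≡.refl (a , b , ≡.refl , gb≡ga , Rab) → R-irrefl (R-resp (≡.sym gb≡ga) Rab) }
    ; trans    = λ { (a , b , ga≡i , gb≡j , Rab) (b′ , c , gb′≡j , gc≡k , Rb′c) →
                     a , c , ga≡i , gc≡k , R-trans Rab (R-resp (≡.trans gb′≡j (≡.sym gb≡j)) Rb′c) }
    ; <-resp-≈ = (λ { ≡.refl r → r }) , (λ { ≡.refl r → r })
    }

-- Roots and coroots, and their integrality over a simple system.

module Roots {ℝ : Reals} {dim : ℕ} {E : EuclideanSpace ℝ dim} {𝑾 : ReflectionGroup E} (𝚽 : RootSystem 𝑾) where
  open OrderedField ℝ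
  open EuclideanSpace E
  open EuclideanLemmas E
  open ReflectionProducts E
  open RootGeometry E
  open ReflectionGroup 𝑾 using (W; ·-congˡ; ·-orthogonal; _ActsAsReflectionIn_; finite)
  private module 𝐖 = ReflectionGroup 𝑾
  open ReflectionGroupLemmas 𝑾
  open RootSystem 𝚽
  open SimpleSystems E

  neg-*ₗ : ∀ x → -ᴹ x ≈ᴹ (- 1#) *ₗ x
  neg-*ₗ x = vector-≈ (⊖ ‵ x) ((- 1#) ⊛ ‵ x) λ z → solve 1 (λ x → :- x := (:- con (+ 1)) :* x) refl ⟨ x , z ⟩

  neg-involutive : ∀ x → -ᴹ (-ᴹ x) ≈ᴹ x
  neg-involutive x = vector-≈ (⊖ ⊖ ‵ x) (‵ x) λ z → -‿involutive _

  neg-nonzero : ∀ {x} → ¬ (x ≈ᴹ 0ᴹ) → ¬ (-ᴹ x ≈ᴹ 0ᴹ)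
  neg-nonzero {x} x≉0 -x≈0 = x≉0 (≈ᴹ-trans (≈ᴹ-sym (neg-involutive x))
    (≈ᴹ-trans (-ᴹ‿cong -x≈0) (≈ᴹ-trans (neg-*ₗ 0ᴹ) (*ₗ-zeroʳ _))))

  coroot-cong : ∀ {x y} → x ≈ᴹ y → coroot x ≈ᴹ coroot y
  coroot-cong x≈y = *ₗ-cong (*-congˡ (⁻¹-cong (⟨⟩-cong x≈y x≈y))) x≈y

  coroot-neg : ∀ x → coroot (-ᴹ x) ≈ᴹ (- 1#) *ₗ coroot x
  coroot-neg x = ≈ᴹ-trans (*ₗ-congʳ (*-congˡ (⁻¹-cong (trans ⟨⟦ ⊖ ‵ x ⟧, -ᴹ x ⟩
      (trans (-‿cong ⟨ x ,⟦ ⊖ ‵ x ⟧⟩) (-‿involutive _))))))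
    (vector-≈ (_ ⊛ ⊖ ‵ x) ((- 1#) ⊛ (2# * ⟨ x , x ⟩ ⁻¹) ⊛ ‵ x)
      λ z → solve 2 (λ k x → k :* (:- x) := (:- con (+ 1)) :* (k :* x)) refl (2# * ⟨ x , x ⟩ ⁻¹) ⟨ x , z ⟩)

  acts-parallel : ∀ {w α β k} → ¬ (α ≈ᴹ 0ᴹ) → α ≈ᴹ k *ₗ β → w ActsAsReflectionIn β → w ActsAsReflectionIn α
  acts-parallel α≉0 α≈kβ acts x = ≈ᴹ-trans (acts x) (≈ᴹ-sym (reflect-parallel α≉0 α≈kβ x))

  reflect-root : ∀ {α x} → α ∈ Φ → x ∈ Φ → reflect α x ∈ Φ
  reflect-root α∈Φ x∈Φ with root⇒refl α∈Φ
  ... | w , acts = Φ-resp (acts _) (Φ-invariant w x∈Φ)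

  reflect-norm : ∀ {α} x → α ∈ Φ → ⟨ reflect α x , reflect α x ⟩ ≈ ⟨ x , x ⟩
  reflect-norm x α∈Φ with root⇒refl α∈Φ
  ... | w , acts = trans (⟨⟩-cong (≈ᴹ-sym (acts x)) (≈ᴹ-sym (acts x))) (·-orthogonal w x x)

  -- Reflections preserve lengths, so coroots are reflected like roots; the induction on height can
  -- treat both lattices at once.
  coroot-reflect : ∀ {α x} → α ∈ Φ → coroot (reflect α x) ≈ᴹ coroot x +ᴹ (- ⟨ α , coroot x ⟩) *ₗ coroot α
  coroot-reflect {α} {x} α∈Φ = ≈ᴹ-trans (*ₗ-cong (*-congˡ (⁻¹-cong (reflect-norm x α∈Φ))) (reflect≈transvection α x))
    (vector-≈ (k ⊛ (‵ x ⊕ ⊖ ⟨ x , coroot α ⟩ ⊛ ‵ α)) (k ⊛ ‵ x ⊕ (- ⟨ α , coroot x ⟩) ⊛ l ⊛ ‵ α) λ z → begin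
      k * (⟨ x , z ⟩ - ⟨ x , coroot α ⟩ * ⟨ α , z ⟩)
        ≈⟨ *-congˡ (+-congˡ (-‿cong (*-congʳ (⟨⟩-corootʳ x α)))) ⟩
      k * (⟨ x , z ⟩ - l * ⟨ x , α ⟩ * ⟨ α , z ⟩)
        ≈⟨ solve 5 (λ k l xz xa az → k :* (xz :- l :* xa :* az) := k :* xz :+ (:- (k :* xa)) :* (l :* az)) refl
             k l ⟨ x , z ⟩ ⟨ x , α ⟩ ⟨ α , z ⟩ ⟩
      k * ⟨ x , z ⟩ + (- (k * ⟨ x , α ⟩)) * (l * ⟨ α , z ⟩)
        ≈⟨ +-congˡ (*-congʳ (-‿cong (sym (trans (⟨⟩-corootʳ α x) (*-congˡ (⟨⟩-sym α x)))))) ⟩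
      k * ⟨ x , z ⟩ + (- ⟨ α , coroot x ⟩) * (l * ⟨ α , z ⟩) ∎)
    where
    open import Relation.Binary.Reasoning.Setoid setoid
    k l : Carrier
    k = 2# * ⟨ x , x ⟩ ⁻¹
    l = 2# * ⟨ α , α ⟩ ⁻¹

  parallel-roots : ∀ {α β k} → α ∈ Φ → β ∈ Φ → α ≈ᴹ k *ₗ β → α ≈ᴹ β ⊎ α ≈ᴹ -ᴹ β
  parallel-roots α∈Φ β∈Φ α≈kβ with root⇒refl β∈Φ
  ... | w , acts = one-pair β∈Φ α∈Φ acts (acts-parallel (Φ-nonzero α∈Φ) α≈kβ acts)

  cartan-integer : Crystallographic → ∀ {α β} → α ∈ Φ → β ∈ Φ → IsInteger ⟨ β , coroot α ⟩
  cartan-integer crystallographic {α} {β} α∈Φ β∈Φ = Int-resp (trans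
    (solve 3 (λ t b a → t :* b :* a := t :* a :* b) refl 2# ⟨ α , β ⟩ (⟨ α , α ⟩ ⁻¹))
    (sym (trans (⟨⟩-corootʳ β α) (*-congˡ (⟨⟩-sym β α))))) (crystallographic α∈Φ β∈Φ)

  IntegerSpan-neg : ∀ {n} {v : Vector V n} {x} → IntegerSpan v x → IntegerSpan v (-ᴹ x)
  IntegerSpan-neg x∈ = IntegerSpan-resp (≈ᴹ-sym (neg-*ₗ _)) (IntegerSpan-* (Int-neg Int-1) x∈)

  index : W → Fin _
  index w = Any.index (finite w)

  index-injective : ∀ {u w} → index u ≡ index w → u ≈ᵂ w
  index-injective {u} {w} eq = go (finite u) (finite w) eq
    where
    go : ∀ {ws} (p : Any (u ≈ᵂ_) ws) (q : Any (w ≈ᵂ_) ws) → Any.index p ≡ Any.index q → u ≈ᵂ w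
    go (here u≈x) (here w≈x) _  = 𝐖.trans u≈x (𝐖.sym w≈x)
    go (there p)  (there q)  eq = go p q (suc-injective eq)

  module SimpleSystem {n : ℕ} {Δ : Vector V n} (simple : IsSimpleSystem Φ Δ) where
    open IsSimpleSystem simple

    perp-simple⇒0 : ∀ x → (∀ i → ⟨ x , Δ i ⟩ ≈ 0#) → x ≈ᴹ 0ᴹ
    perp-simple⇒0 x x⊥Δ with Φ-spans x
    ... | m , v , v∈Φ , c , x≈cv = ⟨⟩-def (trans (⟨⟩-cong x≈cv ≈ᴹ-refl)
          (trans (⟨⟩-combinationˡ c v x) (sum-zero _ λ i → trans (*-congˡ (root⊥x (v∈Φ i))) (zeroʳ _))))
      where
      cone⊥x : ∀ {y} → Cone Δ y → ⟨ y , x ⟩ ≈ 0#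
      cone⊥x (c , _ , y≈cΔ) = trans (⟨⟩-cong y≈cΔ ≈ᴹ-refl) (trans (⟨⟩-combinationˡ c Δ x)
        (sum-zero _ λ i → trans (*-congˡ (trans (⟨⟩-sym _ _) (x⊥Δ i))) (zeroʳ _)))
      root⊥x : ∀ {y} → y ∈ Φ → ⟨ y , x ⟩ ≈ 0#
      root⊥x {y} y∈Φ with same-sign y∈Φ
      ... | inj₁ y∈C  = cone⊥x y∈C
      ... | inj₂ -y∈C = trans (sym (-‿involutive _)) (trans (-‿cong (trans (sym (⟨⟩-negˡ y x)) (cone⊥x -y∈C))) -0#≈0#)

    abstract
      dual : DualBasis Δ
      dual = dualBasis Δ Δ independent ℕ.≤-refl perp-simple⇒0

    open DualBasis dual

    -- `Cone Δ` read off from the dual basis, which makes the coefficients canonical.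
    Positive : Pred V 0ℓ
    Positive x = ∀ i → 0# ≤ ⟨ x , ω i ⟩

    Cone⇒Positive : ∀ {x} → Cone Δ x → Positive x
    Cone⇒Positive (c , 0≤c , x≈cΔ) i = ≤-respʳ (sym (trans (⟨⟩-cong x≈cΔ ≈ᴹ-refl) (coordinate c i))) (0≤c i)

    Positive⇒Cone : ∀ {x} → Positive x → Cone Δ x
    Positive⇒Cone {x} x⁺ = (λ i → ⟨ x , ω i ⟩) , x⁺ , expand x

    sign : ∀ {x} → x ∈ Φ → Positive x ⊎ Positive (-ᴹ x)
    sign x∈Φ with same-sign x∈Φ
    ... | inj₁ x∈C  = inj₁ (Cone⇒Positive x∈C)
    ... | inj₂ -x∈C = inj₂ (Cone⇒Positive -x∈C)

    positive-negative⇒0 : ∀ {x} → Positive x → Positive (-ᴹ x) → x ≈ᴹ 0ᴹ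
    positive-negative⇒0 {x} x⁺ -x⁺ = ≈ᴹ-trans (expand x) (combination-0 Δ λ i →
      ≤-antisym (neg-nonneg⇒nonpos (≤-respʳ (⟨⟩-negˡ x (ω i)) (-x⁺ i))) (x⁺ i))

    private
      PositiveRoot : Set
      PositiveRoot = ∃[ x ] x ∈ Φ × Positive x

      -- The sum of the dual basis: pairing with it gives the height, the sum of the simple
      -- coordinates.
      ρ : V
      ρ = combination (λ _ → 1#) ω

      _⊏_ : Rel PositiveRoot 0ℓ
      (x , _) ⊏ (y , _) = ⟨ x , ρ ⟩ < ⟨ y , ρ ⟩

      simple-height : ∀ i → ⟨ Δ i , ρ ⟩ ≈ 1#
      simple-height i = trans (⟨⟩-combinationʳ _ ω (Δ i)) (trans
        (sum-single _ i λ j j≢i → trans (*-identityˡ _) (trans (⟨⟩-sym _ _) (ω-offdiag j i (j≢i ∘ ≡.sym))))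
        (trans (*-identityˡ _) (trans (⟨⟩-sym _ _) (ω-diagonal i))))

      -- Heights are real numbers, so descent rests on finiteness: a positive root is determined by
      -- its reflection, and `index` numbers the elements of `W`.
      ⊏-wellFounded : WellFounded _⊏_
      ⊏-wellFounded = finite-wellFounded (λ (x , x∈Φ , _) → index (proj₁ (root⇒refl x∈Φ))) _⊏_
        <-trans (<-irrefl refl) λ {a} {b} {c} eq → <-respˡ-≈ (⟨⟩-cong (same-root a b eq) ≈ᴹ-refl)
        where
        same-root : ∀ ((x , x∈Φ , _) (y , y∈Φ , _) : PositiveRoot) →
          index (proj₁ (root⇒refl x∈Φ)) ≡ index (proj₁ (root⇒refl y∈Φ)) → x ≈ᴹ y
        same-root (x , x∈Φ , x⁺) (y , y∈Φ , y⁺) eq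
          with one-pair y∈Φ x∈Φ (proj₂ (root⇒refl y∈Φ)) (λ z →
                 ≈ᴹ-trans (·-congˡ (𝐖.sym (index-injective eq)) z) (proj₂ (root⇒refl x∈Φ) z))
        ... | inj₁ x≈y  = x≈y
        ... | inj₂ x≈-y = contradiction (positive-negative⇒0 y⁺ λ i → ≤-respʳ (⟨⟩-cong x≈-y ≈ᴹ-refl) (x⁺ i)) (Φ-nonzero y∈Φ)

    module _ (crystallographic : Crystallographic) where

      Integral : Pred V 0ℓ
      Integral x = IntegerSpan Δ x × IntegerSpan (coroot ∘ Δ) (coroot x)

      private
        Integral-resp : ∀ {x y} → x ≈ᴹ y → Integral x → Integral y
        Integral-resp x≈y (p , q) = IntegerSpan-resp x≈y p , IntegerSpan-resp (coroot-cong x≈y) q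

        Integral-neg : ∀ {x} → Integral x → Integral (-ᴹ x)
        Integral-neg {x} (p , q) = IntegerSpan-neg p ,
          IntegerSpan-resp (≈ᴹ-sym (coroot-neg x)) (IntegerSpan-* (Int-neg Int-1) q)

        Integral-simple : ∀ i → Integral (Δ i)
        Integral-simple i = IntegerSpan-basis i , IntegerSpan-basis i

        -- The positive number `⟨ x , x ⟩` is the sum of the `⟨ x , ω i ⟩ ⟨ Δ i , x ⟩`, whose first
        -- factors are nonnegative; so some second factor is positive.
        descent-direction : ∀ {x} → x ∈ Φ → Positive x → ∃[ i ] 0# < ⟨ Δ i , x ⟩
        descent-direction {x} x∈Φ x⁺ with any? (λ i → 0# <? ⟨ Δ i , x ⟩)
        ... | yes found = found
        ... | no ∄ = contradiction (norm-pos (Φ-nonzero x∈Φ)) (≤⇒≯ (≤-respˡ (sym (⟨⟩-expand x x))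
                (sum-nonpos _ λ i → *-nonneg-nonpos (x⁺ i) (≮⇒≥ λ 0<Δx → ∄ (i , 0<Δx)))))

        -- Reflecting in `Δ i` lowers the height and alters only the coordinate along `Δ i`. If the
        -- result `y` is positive, induction applies to it. If it is negative, all other coordinates
        -- of `x` vanish, so `x` is plus or minus `Δ i`.
        module Step {x : V} (x∈Φ : x ∈ Φ) (x⁺ : Positive x) (i : Fin n) (0<Δx : 0# < ⟨ Δ i , x ⟩)
          (lower-integral : ∀ y (y∈Φ : y ∈ Φ) (y⁺ : Positive y) → ⟨ y , ρ ⟩ < ⟨ x , ρ ⟩ → Integral y) where
          m : Carrier
          m = ⟨ x , coroot (Δ i) ⟩

          y : V
          y = reflect (Δ i) x

          y∈Φ : y ∈ Φ
          y∈Φ = reflect-root (roots i) x∈Φ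

          y-pairing : ∀ z → ⟨ y , z ⟩ ≈ ⟨ x , z ⟩ - m * ⟨ Δ i , z ⟩
          y-pairing z = trans (⟨⟩-cong (reflect≈transvection (Δ i) x) ≈ᴹ-refl) ⟨⟦ ‵ x ⊕ ⊖ m ⊛ ‵ Δ i ⟧, z ⟩

          0<m : 0# < m
          0<m = *-cancelˡ-pos (norm-pos (Φ-nonzero (roots i))) (<-respʳ-≈
            (trans (sym (coroot-norm x (Φ-nonzero (roots i)))) (*-comm _ _))
            (*-pos 0<2 (<-respʳ-≈ (⟨⟩-sym _ _) 0<Δx)))

          lower : ⟨ y , ρ ⟩ < ⟨ x , ρ ⟩
          lower = 0<y-x⇒x<y (<-respʳ-≈ (sym (trans (+-congˡ (-‿cong (y-pairing ρ)))
            (trans (solve 3 (λ x m r → x :- (x :- m :* r) := m :* r) refl ⟨ x , ρ ⟩ m ⟨ Δ i , ρ ⟩)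
                   (trans (*-congˡ (simple-height i)) (*-identityʳ m))))) 0<m)

          reflect-integral : Integral y → Integral (reflect (Δ i) y)
          reflect-integral (y-int , y∨-int) =
            IntegerSpan-resp (≈ᴹ-sym (≈ᴹ-trans (reflect≈transvection (Δ i) y)
                (+ᴹ-congˡ (vector-≈ (⊖ (⟨ y , coroot (Δ i) ⟩ ⊛ ‵ Δ i)) ((- ⟨ y , coroot (Δ i) ⟩) ⊛ ‵ Δ i) λ z → -‿distribˡ-* _ _))))
              (IntegerSpan-+ y-int (IntegerSpan-* (Int-neg (cartan-integer crystallographic (roots i) y∈Φ)) (IntegerSpan-basis i))) ,
            IntegerSpan-resp (≈ᴹ-sym (coroot-reflect (roots i)))
              (IntegerSpan-+ y∨-int (IntegerSpan-* (Int-neg (cartan-integer crystallographic y∈Φ (roots i))) (IntegerSpan-basis i)))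

          vanish : Positive (-ᴹ y) → ∀ j → ¬ (j ≡ i) → ⟨ x , ω j ⟩ ≈ 0#
          vanish -y⁺ j j≢i = ≤-antisym (neg-nonneg⇒nonpos (≤-respʳ (trans (⟨⟩-negˡ y (ω j)) (-‿cong yω≈xω)) (-y⁺ j))) (x⁺ j)
            where
            Δω≈0 : m * ⟨ Δ i , ω j ⟩ ≈ 0#
            Δω≈0 = trans (*-congˡ (trans (⟨⟩-sym _ _) (ω-offdiag j i (j≢i ∘ ≡.sym)))) (zeroʳ m)
            yω≈xω : ⟨ y , ω j ⟩ ≈ ⟨ x , ω j ⟩
            yω≈xω = trans (y-pairing (ω j)) (trans (+-congˡ (trans (-‿cong Δω≈0) -0#≈0#)) (+-identityʳ _))

          simple-integral : x ≈ᴹ Δ i ⊎ x ≈ᴹ -ᴹ Δ i → Integral x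
          simple-integral (inj₁ x≈Δ)  = Integral-resp (≈ᴹ-sym x≈Δ) (Integral-simple i)
          simple-integral (inj₂ x≈-Δ) = Integral-resp (≈ᴹ-sym x≈-Δ) (Integral-neg (Integral-simple i))

          by-sign : Positive y ⊎ Positive (-ᴹ y) → Integral x
          by-sign (inj₁ y⁺)  = Integral-resp (reflect-involutive (Φ-nonzero (roots i)) x)
            (reflect-integral (lower-integral y y∈Φ y⁺ lower))
          by-sign (inj₂ -y⁺) = simple-integral (parallel-roots x∈Φ (roots i) (≈ᴹ-trans (expand x)
            (combination-single (λ j → ⟨ x , ω j ⟩) Δ i (vanish -y⁺))))

          integral : Integral x
          integral = by-sign (sign y∈Φ)

        positive-integral : ∀ x (x∈Φ : x ∈ Φ) (x⁺ : Positive x) → Acc _⊏_ (x , x∈Φ , x⁺) → Integral x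
        positive-integral x x∈Φ x⁺ (acc rs) = Step.integral x∈Φ x⁺ (proj₁ direction) (proj₂ direction)
          λ y y∈Φ y⁺ lower → positive-integral y y∈Φ y⁺ (rs lower)
          where
          direction : ∃[ i ] 0# < ⟨ Δ i , x ⟩
          direction = descent-direction x∈Φ x⁺

      root-integral : ∀ {x} → x ∈ Φ → Integral x
      root-integral {x} x∈Φ with sign x∈Φ
      ... | inj₁ x⁺  = positive-integral x x∈Φ x⁺ (⊏-wellFounded _)
      ... | inj₂ -x⁺ = Integral-resp (neg-involutive x)
        (Integral-neg (positive-integral (-ᴹ x) (Φ-neg x∈Φ) -x⁺ (⊏-wellFounded _)))

-- Shortest factorizations of a Coxeter element as lattice bases.

module CoxeterFactorizations {ℝ : Reals} {dim : ℕ} {E : EuclideanSpace ℝ dim} {𝑾 : ReflectionGroup E} (𝚽 : RootSystem 𝑾)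
  (crystallographic : RootSystem.Crystallographic 𝚽)
  (root : ReflectionGroup.T 𝑾 → EuclideanSpace.V E) (root∈Φ : ∀ τ → root τ ∈ RootSystem.Φ 𝚽)
  (root-acts : ∀ τ → ReflectionGroup._ActsAsReflectionIn_ 𝑾 (proj₁ τ) (root τ))
  where
  open EuclideanSpace E
  open RootSystem 𝚽
  private module 𝐖 = ReflectionGroup 𝑾
  open OrderedField ℝ
  open EuclideanLemmas E
  open ReflectionProducts E
  open RootGeometry E
  open ReflectionGroup 𝑾 using (W; _·_; ·-congˡ; ·-compose; ·-identity; _ActsAsReflectionIn_; IsReflection; T; _∙_; ε)
  open ReflectionGroupLemmas 𝑾
  open SimpleSystems E
  open AbsoluteOrder 𝐖.group IsReflection using (product)
  open Roots 𝚽

  coroot-perp : ∀ {x α} → ¬ (α ≈ᴹ 0ᴹ) → ⟨ x , coroot α ⟩ ≈ 0# → ⟨ x , α ⟩ ≈ 0#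
  coroot-perp {x} {α} α≉0 x⊥α∨ = x*y≈0⇒y≈0 (<⇒≉ 0<2)
    (trans (sym (coroot-norm x α≉0)) (trans (*-congʳ x⊥α∨) (zeroˡ _)))

  perp-coroot : ∀ {x α} → ⟨ x , α ⟩ ≈ 0# → ⟨ x , coroot α ⟩ ≈ 0#
  perp-coroot {x} {α} x⊥α = trans (⟨⟩-corootʳ x α) (trans (*-congˡ x⊥α) (zeroʳ _))

  coroots-independent : ∀ {m} (α : Vector V m) → (∀ i → ¬ (α i ≈ᴹ 0ᴹ)) → Independent α → Independent (coroot ∘ α)
  coroots-independent α α≉0 ind c c·α∨≈0 i = x*y≈0⇒y≈0 (<⇒≉ (*-pos 0<2 (⁻¹-pos (norm-pos (α≉0 i)))))
    (trans (*-comm _ _) (ind (λ i → c i * (2# * ⟨ α i , α i ⟩ ⁻¹)) (≈ᴹ-trans (⟨⟩-ext λ z →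
      trans (⟨⟩-combinationˡ _ α z) (trans (sum-cong-≋ λ i → trans (*-assoc _ _ _) (*-congˡ (sym (⟨⟩-*ˡ _ (α i) z))))
        (sym (⟨⟩-combinationˡ c (coroot ∘ α) z)))) c·α∨≈0) i))

  transvection-cong : ∀ a b {x y} → x ≈ᴹ y → transvection a b x ≈ᴹ transvection a b y
  transvection-cong a b x≈y = +ᴹ-cong x≈y (-ᴹ‿cong (*ₗ-congʳ (⟨⟩-cong x≈y ≈ᴹ-refl)))

  -- Used with (A , B) = (coroot , id) and (id , coroot), for the statements on
  -- the coroot and on the root lattice.
  module _ (A B : V → V) (reflect≈ : ∀ α x → reflect α x ≈ᴹ transvection (A α) (B α) x) where

    act-step : ∀ {w α} u x y → w ActsAsReflectionIn α → u · x ≈ᴹ y → (w ∙ u) · x ≈ᴹ transvection (A α) (B α) y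
    act-step {w} {α} u x y acts ux≈y = ≈ᴹ-trans (·-compose w u x) (≈ᴹ-trans (acts (u · x))
      (≈ᴹ-trans (reflect≈ α (u · x)) (transvection-cong _ _ ux≈y)))

    product-act : ∀ {m} (ws : Vector W m) (α : Vector V m) → (∀ i → ws i ActsAsReflectionIn α i) →
      ∀ x → product ws · x ≈ᴹ transvections (A ∘ α) (B ∘ α) x
    product-act {zero}  ws α acts x = ·-identity x
    product-act {suc m} ws α acts x = act-step (product (ws ∘ suc)) x _ (acts zero)
      (product-act (ws ∘ suc) (α ∘ suc) (acts ∘ suc) x)

    list-act : ∀ (L : List T) x → foldr _∙_ ε (map proj₁ L) · x ≈ᴹ
      transvections (λ i → A (root (lookup L i))) (λ i → B (root (lookup L i))) x
    list-act []      x = ·-identity x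
    list-act (τ ∷ L) x = act-step (foldr _∙_ ε (map proj₁ L)) x _ (root-acts τ) (list-act L x)

  module _ {n : ℕ} {Δ : Vector V n} (simple : IsSimpleSystem Φ Δ) (γ : W)
    (γ≈ : γ ≈ᵂ product (λ i → proj₁ (t (IsSimpleSystem.roots simple i)))) where
    open IsSimpleSystem simple
    open SimpleSystem simple using (perp-simple⇒0; root-integral)

    private
      Δ∨ : Vector V n
      Δ∨ = coroot ∘ Δ

      Δ≉0 : ∀ i → ¬ (Δ i ≈ᴹ 0ᴹ)
      Δ≉0 i = Φ-nonzero (roots i)

      γ-act : ∀ A B (reflect≈ : ∀ α x → reflect α x ≈ᴹ transvection (A α) (B α) x) x →
        γ · x ≈ᴹ transvections (A ∘ Δ) (B ∘ Δ) x
      γ-act A B reflect≈ x = ≈ᴹ-trans (·-congˡ γ≈ x)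
        (product-act A B reflect≈ (λ i → proj₁ (t (roots i))) Δ (λ i → proj₂ (root⇒refl (roots i))) x)

    γ-fixed⇒0 : ∀ x → γ · x ≈ᴹ x → x ≈ᴹ 0ᴹ
    γ-fixed⇒0 x γx≈x = perp-simple⇒0 x λ i → coroot-perp (Δ≉0 i) (fixed⇒perp Δ∨ Δ independent
      (≈ᴹ-trans (≈ᴹ-sym (γ-act coroot (λ α → α) reflect≈transvection x)) γx≈x) i)

    module Frame (L : List T) (L≈γ : foldr _∙_ ε (map proj₁ L) ≈ᵂ γ) (L≤n : length L ℕ.≤ n) where
      F F∨ : Vector V (length L)
      F i  = root (lookup L i)
      F∨ i = coroot (F i)

      F∈Φ : ∀ i → F i ∈ Φ
      F∈Φ i = root∈Φ (lookup L i)

      F≉0 : ∀ i → ¬ (F i ≈ᴹ 0ᴹ)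
      F≉0 i = Φ-nonzero (F∈Φ i)

      private
        same-act : ∀ A B (reflect≈ : ∀ α x → reflect α x ≈ᴹ transvection (A α) (B α) x) x →
          transvections (A ∘ Δ) (B ∘ Δ) x ≈ᴹ transvections (A ∘ F) (B ∘ F) x
        same-act A B reflect≈ x = ≈ᴹ-trans (≈ᴹ-sym (γ-act A B reflect≈ x))
          (≈ᴹ-trans (≈ᴹ-sym (·-congˡ L≈γ x)) (list-act A B reflect≈ L x))

      -- Such a vector is fixed by every factor, hence by the product `γ`. With `L≤n` this makes the
      -- `F i` a basis.
      perp-F⇒0 : ∀ x → (∀ i → ⟨ x , F i ⟩ ≈ 0#) → x ≈ᴹ 0ᴹ
      perp-F⇒0 x x⊥F = γ-fixed⇒0 x (≈ᴹ-trans (≈ᴹ-sym (·-congˡ L≈γ x))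
        (≈ᴹ-trans (list-act coroot (λ α → α) reflect≈transvection L x)
                  (transvections-fix F∨ F λ i → perp-coroot (x⊥F i))))

      abstract
        basis-F : DualBasis F
        basis-F = dualBasis F Δ independent L≤n perp-F⇒0

      open DualBasis basis-F public

      private
        half : Carrier
        half = 2# ⁻¹

        2*half : 2# * half ≈ 1#
        2*half = ⁻¹-inverseʳ (<⇒≉ 0<2)

        -- The basis dual to the coroots: `F∨ i` is `F i` times `2 / ⟨ F i , F i ⟩`, so `ω i` is
        -- scaled by the inverse factor.
        ω∨ : Vector V (length L)
        ω∨ i = (⟨ F i , F i ⟩ * half) *ₗ ω i

        kronecker : ∀ i j → IsInteger ⟨ ω i , F j ⟩
        kronecker i j with j ≟ᶠ i
        ... | yes ≡.refl = Int-resp (sym (ω-diagonal i)) Int-1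
        ... | no  j≢i    = Int-resp (sym (ω-offdiag i j j≢i)) Int-0

        ω∨-pairing : ∀ i {x} → ¬ (x ≈ᴹ 0ᴹ) → ⟨ ω∨ i , coroot x ⟩ * ⟨ x , x ⟩ ≈ ⟨ ω i , x ⟩ * ⟨ F i , F i ⟩
        ω∨-pairing i {x} x≉0 = begin
          ⟨ ω∨ i , coroot x ⟩ * ⟨ x , x ⟩                        ≈⟨ *-congʳ (⟨⟩-*ˡ _ _ _) ⟩
          (A * half * ⟨ ω i , coroot x ⟩) * ⟨ x , x ⟩            ≈⟨ *-assoc _ _ _ ⟩
          A * half * (⟨ ω i , coroot x ⟩ * ⟨ x , x ⟩)            ≈⟨ *-congˡ (coroot-norm (ω i) x≉0) ⟩
          A * half * (2# * ⟨ ω i , x ⟩)                          ≈⟨ solve 4 (λ A h t x → A :* h :* (t :* x) := (t :* h) :* (x :* A)) refl A half 2# ⟨ ω i , x ⟩ ⟩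
          (2# * half) * (⟨ ω i , x ⟩ * A)                        ≈⟨ *-congʳ 2*half ⟩
          1# * (⟨ ω i , x ⟩ * A)                                 ≈⟨ *-identityˡ _ ⟩
          ⟨ ω i , x ⟩ * A                                        ∎
          where
          open import Relation.Binary.Reasoning.Setoid setoid
          A : Carrier
          A = ⟨ F i , F i ⟩

        kronecker∨ : ∀ i j → IsInteger ⟨ ω∨ i , F∨ j ⟩
        kronecker∨ i j with j ≟ᶠ i
        ... | yes ≡.refl = Int-resp (sym (x∙y⁻¹≈ε⇒x≈y _ _ (x*y≈0⇒y≈0 (<⇒≉ (norm-pos (F≉0 i)))
                (trans (solve 2 (λ a b → a :* (b :- con (+ 1)) := b :* a :- a) refl ⟨ F i , F i ⟩ ⟨ ω∨ i , F∨ i ⟩)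
                (trans (+-congʳ (trans (ω∨-pairing i (F≉0 i)) (trans (*-congʳ (ω-diagonal i)) (*-identityˡ _))))
                       (-‿inverseʳ _)))))) Int-1
        ... | no  j≢i    = Int-resp (sym (trans (⟨⟩-*ˡ _ _ _) (trans (*-congˡ (perp-coroot (ω-offdiag i j j≢i))) (zeroʳ _)))) Int-0

        -- `ω j` pairs with the `F i` to 0 or 1, so its displacement under `γ` lies in the coroot
        -- lattice, and the system of the simple roots can be solved over ℤ. Consequently roots have
        -- integral coordinates along `F`.
        ω-integral : ∀ j i → IsInteger ⟨ ω j , Δ i ⟩
        ω-integral j = integral-transfer Δ Δ∨ F F∨ (same-act (λ α → α) coroot reflect≈transvectionᵛ)
          (coroots-independent Δ Δ≉0 independent) (λ i → proj₂ (root-integral crystallographic (F∈Φ i)))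
          (λ i k → Int-resp (⟨⟩-sym _ _) (cartan-integer crystallographic (roots i) (roots k)))
          (λ i k → Int-resp (⟨⟩-sym _ _) (cartan-integer crystallographic (F∈Φ i) (F∈Φ k)))
          (ω j) (kronecker j)

        ω∨-integral : ∀ j i → IsInteger ⟨ ω∨ j , Δ∨ i ⟩
        ω∨-integral j = integral-transfer Δ∨ Δ F∨ F (same-act coroot (λ α → α) reflect≈transvection)
          independent (λ i → proj₁ (root-integral crystallographic (F∈Φ i)))
          (λ i k → cartan-integer crystallographic (roots k) (roots i))
          (λ i k → cartan-integer crystallographic (F∈Φ k) (F∈Φ i))
          (ω∨ j) (kronecker∨ j)

      coordinate-integral : ∀ {x} → x ∈ Φ → ∀ j → IsInteger ⟨ x , ω j ⟩
      coordinate-integral x∈Φ j = IntegerSpan-pairing (proj₁ (root-integral crystallographic x∈Φ))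
        λ i → Int-resp (⟨⟩-sym _ _) (ω-integral j i)

      -- The coordinates of `coroot x` in the basis `F∨`; they serve as the multipliers `c′` of
      -- `obtuse⇒same-sign`.
      cocoordinate : V → Vector Carrier (length L)
      cocoordinate x j = ⟨ coroot x , ω∨ j ⟩

      cocoordinate-integral : ∀ {x} → x ∈ Φ → ∀ j → IsInteger (cocoordinate x j)
      cocoordinate-integral x∈Φ j = IntegerSpan-pairing (proj₂ (root-integral crystallographic x∈Φ))
        λ i → Int-resp (⟨⟩-sym _ _) (ω∨-integral j i)

      coordinate-cocoordinate : ∀ {x} → x ∈ Φ → ∀ j → ⟨ x , ω j ⟩ * ⟨ F j , F j ⟩ ≈ cocoordinate x j * ⟨ x , x ⟩
      coordinate-cocoordinate {x} x∈Φ j = trans (*-congʳ (⟨⟩-sym _ _))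
        (trans (sym (ω∨-pairing j (Φ-nonzero x∈Φ))) (*-congʳ (⟨⟩-sym _ _)))

      coordinates-same-sign : ∀ {x} → x ∈ Φ →
        (∀ i j → ¬ (i ≡ j) → ¬ (⟨ x , ω i ⟩ ≈ 0#) → ¬ (⟨ x , ω j ⟩ ≈ 0#) → ⟨ F i , F j ⟩ ≤ 0#) →
        (∀ i → 0# ≤ ⟨ x , ω i ⟩) ⊎ (∀ i → ⟨ x , ω i ⟩ ≤ 0#)
      coordinates-same-sign {x} x∈Φ = obtuse⇒same-sign F (λ i → ⟨ x , ω i ⟩) (cocoordinate x) (Φ-nonzero x∈Φ)
        f-independent (expand x) F≉0 (λ i j → cartan-integer crystallographic (F∈Φ i) (F∈Φ j))
        (coordinate-integral x∈Φ) (cocoordinate-integral x∈Φ) (coordinate-cocoordinate x∈Φ)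

-- Indices of a prefix within a longer list.

embed : ∀ {A : Set} (xs ys : List A) → Fin (length xs) → Fin (length (xs ++ ys))
embed (x ∷ xs) ys zero    = zero
embed (x ∷ xs) ys (suc i) = suc (embed xs ys i)

lookup-embed : ∀ {A : Set} (xs ys : List A) i → lookup (xs ++ ys) (embed xs ys i) ≡ lookup xs i
lookup-embed (x ∷ xs) ys zero    = ≡.refl
lookup-embed (x ∷ xs) ys (suc i) = lookup-embed xs ys i

embed-injective : ∀ {A : Set} (xs ys : List A) {i j} → embed xs ys i ≡ embed xs ys j → i ≡ j
embed-injective (x ∷ xs) ys {zero}  {zero}  _  = ≡.refl
embed-injective (x ∷ xs) ys {suc i} {suc j} eq = ≡.cong suc (embed-injective xs ys (suc-injective eq))

embed? : ∀ {A : Set} (xs ys : List A) k → (∃[ i ] k ≡ embed xs ys i) ⊎ (∀ i → ¬ (k ≡ embed xs ys i))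
embed? xs ys k with any? (λ i → k ≟ᶠ embed xs ys i)
... | yes found = inj₁ found
... | no  ∄     = inj₂ λ i eq → ∄ (i , eq)

AllPairs-lookup : ∀ {A : Set} {R : Rel A 0ℓ} → (∀ {x y} → R x y → R y x) → ∀ {xs} → AllPairs R xs →
  ∀ i j → ¬ (i ≡ j) → R (lookup xs i) (lookup xs j)
AllPairs-lookup R-sym (px ∷ pxs) zero    zero    i≢j = contradiction ≡.refl i≢j
AllPairs-lookup R-sym (px ∷ pxs) zero    (suc j) i≢j = All.lookup px (∈-lookup j)
AllPairs-lookup R-sym (px ∷ pxs) (suc i) zero    i≢j = R-sym (All.lookup px (∈-lookup i))
AllPairs-lookup R-sym (px ∷ pxs) (suc i) (suc j) i≢j = AllPairs-lookup R-sym pxs i j (i≢j ∘ ≡.cong suc)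

-- The positive root of each reflection.

module PositiveRoots {ℝ : Reals} {dim : ℕ} {E : EuclideanSpace ℝ dim} {𝑾 : ReflectionGroup E} (𝚽 : RootSystem 𝑾)
  (Φ⁺ : Pred (EuclideanSpace.V E) 0ℓ) (isPositive : SimpleSystems.IsPositiveSystem E (RootSystem.Φ 𝚽) Φ⁺) where
  open EuclideanSpace E
  open RootSystem 𝚽
  open SimpleSystems E
  open OrderedField ℝ
  open EuclideanLemmas E
  open ReflectionGroup 𝑾 using (·-faithful; _ActsAsReflectionIn_; T; _≈ᵀ_)
  open Roots 𝚽
  private
    module S⁺ = IsSimpleSystemOf (proj₂ (proj₂ isPositive))
    open SimpleSystem S⁺.isSimpleSystem
    open DualBasis dual using (ω)

  Φ⁺⊆Φ : Φ⁺ ⊆ Φ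
  Φ⁺⊆Φ = positive⇒root isPositive

  Φ⁺-intro : ∀ {x} → x ∈ Φ → Positive x → x ∈ Φ⁺
  Φ⁺-intro x∈Φ x⁺ = Equivalence.from S⁺.positive (x∈Φ , Positive⇒Cone x⁺)

  Φ⁺-elim : ∀ {x} → x ∈ Φ⁺ → Positive x
  Φ⁺-elim x∈Φ⁺ = Cone⇒Positive (proj₂ (Equivalence.to S⁺.positive x∈Φ⁺))

  Φ⁺-sign : ∀ {x} → x ∈ Φ → x ∈ Φ⁺ ⊎ -ᴹ x ∈ Φ⁺
  Φ⁺-sign x∈Φ with sign x∈Φ
  ... | inj₁ x⁺  = inj₁ (Φ⁺-intro x∈Φ x⁺)
  ... | inj₂ -x⁺ = inj₂ (Φ⁺-intro (Φ-neg x∈Φ) -x⁺)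

  Φ⁺-asym : ∀ {x} → x ∈ Φ⁺ → ¬ (-ᴹ x ∈ Φ⁺)
  Φ⁺-asym x∈Φ⁺ -x∈Φ⁺ = Φ-nonzero (Φ⁺⊆Φ x∈Φ⁺) (positive-negative⇒0 (Φ⁺-elim x∈Φ⁺) (Φ⁺-elim -x∈Φ⁺))

  Φ⁺-combination : ∀ {m x} c (v : Vector V m) → x ∈ Φ → x ≈ᴹ combination c v →
    (∀ i → 0# ≤ c i) → (∀ i → v i ∈ Φ⁺) → x ∈ Φ⁺
  Φ⁺-combination c v x∈Φ x≈cv 0≤c v∈Φ⁺ = Φ⁺-intro x∈Φ λ j →
    ≤-respʳ (sym (trans (⟨⟩-cong x≈cv ≈ᴹ-refl) (⟨⟩-combinationˡ c v (ω j))))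
      (sum-nonneg _ λ i → *-nonneg (0≤c i) (Φ⁺-elim (v∈Φ⁺ i) j))

  abstract
    positiveRoot : ∀ (τ : T) → ∃[ α ] α ∈ Φ⁺ × proj₁ τ ActsAsReflectionIn α
    positiveRoot (w , w∈T) with refl⇒root w∈T
    ... | α , α∈Φ , acts with Φ⁺-sign α∈Φ
    ... | inj₁ α∈Φ⁺  = α , α∈Φ⁺ , acts
    ... | inj₂ -α∈Φ⁺ = -ᴹ α , -α∈Φ⁺ , acts-parallel (neg-nonzero (Φ-nonzero α∈Φ)) (neg-*ₗ α) acts

  root : T → V
  root τ = proj₁ (positiveRoot τ)

  root∈Φ⁺ : ∀ τ → root τ ∈ Φ⁺
  root∈Φ⁺ τ = proj₁ (proj₂ (positiveRoot τ))

  root∈Φ : ∀ τ → root τ ∈ Φ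
  root∈Φ τ = Φ⁺⊆Φ (root∈Φ⁺ τ)

  root-acts : ∀ τ → proj₁ τ ActsAsReflectionIn root τ
  root-acts τ = proj₂ (proj₂ (positiveRoot τ))

  same-reflection : ∀ (τ σ : T) {α} → proj₁ τ ActsAsReflectionIn α → proj₁ σ ActsAsReflectionIn α → τ ≈ᵀ σ
  same-reflection τ σ τ-acts σ-acts = ·-faithful λ x → ≈ᴹ-trans (τ-acts x) (≈ᴹ-sym (σ-acts x))

  t-root : ∀ τ → t (Φ⁺⊆Φ (root∈Φ⁺ τ)) ≈ᵀ τ
  t-root τ = same-reflection (t (Φ⁺⊆Φ (root∈Φ⁺ τ))) τ (proj₂ (root⇒refl (Φ⁺⊆Φ (root∈Φ⁺ τ)))) (root-acts τ)

-- Rising factorizations under a compatible reflection ordering.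

module RisingFactorizations
  {ℝ : Reals} {dim : ℕ} {E : EuclideanSpace ℝ dim} {𝑾 : ReflectionGroup E} (𝚽 : RootSystem 𝑾)
  (Φ⁺ : Pred (EuclideanSpace.V E) 0ℓ) (isPositive : SimpleSystems.IsPositiveSystem E (RootSystem.Φ 𝚽) Φ⁺)
  (γ : ReflectionGroup.W 𝑾) (coxeter : NoncrossingPartitions.IsCoxeterElement 𝚽 γ)
  (_<ᵀ_ : Rel (ReflectionGroup.T 𝑾) 0ℓ) (isTotal : IsStrictTotalOrder (ReflectionGroup._≈ᵀ_ 𝑾) _<ᵀ_)
  (crystallographic : RootSystem.Crystallographic 𝚽)
  (reflectionOrdering : NoncrossingPartitions.IsReflectionOrdering 𝚽 (SimpleSystems.positive⇒root E isPositive) _<ᵀ_)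
  (compatible : NoncrossingPartitions.IsCompatible 𝚽 (SimpleSystems.positive⇒root E isPositive) _<ᵀ_ γ)
  where
  open EuclideanSpace E
  open RootSystem 𝚽
  open SimpleSystems E
  private
    module 𝐖 = ReflectionGroup 𝑾
    module N = NoncrossingPartitions 𝚽
  open OrderedField ℝ
  open EuclideanLemmas E
  open ReflectionProducts E
  open RootGeometry E
  open ReflectionGroup 𝑾 using (_·_; ·-congˡ; _ActsAsReflectionIn_; IsReflection; T; _≈ᵀ_; _∙_; ∙-cong; ∙-congˡ; ∙-congʳ)
  open ReflectionGroupLemmas 𝑾
  open N using (_IsProductOf_; InNC; product; ⪯-refl; ⪯-trans; length-resp; ε⪯; prod-∙; prod-resp)
  open Roots 𝚽
  open PositiveRoots 𝚽 Φ⁺ isPositive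
  open ReflectionFactorizations.Enumerated 𝐖.group IsReflection IsReflection-conjugate _≟ᵂ_ reflections reflections-complete
    _<ᵀ_ isTotal
  private module <ᵀ = IsStrictTotalOrder isTotal

  private
    n : ℕ
    n = proj₁ coxeter
    Δ : Vector V n
    Δ = proj₁ (proj₂ coxeter)
    simple : IsSimpleSystem Φ Δ
    simple = proj₁ (proj₂ (proj₂ coxeter))

    product-IsProductOf : ∀ {m} (τ : Vector T m) → product (proj₁ ∘ τ) IsProductOf m
    product-IsProductOf {zero}  τ = [] , [] , ≡.refl , 𝐖.refl
    product-IsProductOf {suc m} τ = prod-∙ (prod-resp (𝐖.identityʳ _) (prod-IsProductOf [ τ zero ])) (product-IsProductOf (τ ∘ suc))

  open CoxeterFactorizations 𝚽 crystallographic root root∈Φ root-acts hiding (module Frame)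

  module Framed (ts rest : List T) (completes : Completes γ ts rest) where
    private
      -- `γ` is a product of `n` simple reflections, which bounds its shortest factorizations.
      L≤n : length (ts ++ rest) ℕ.≤ n
      L≤n = ≡.subst (ℕ._≤ n) (≡.sym (length-++ ts)) (proj₂ (Completes.shortest completes)
        (prod-resp (𝐖.sym (proj₂ (proj₂ (proj₂ coxeter)))) (product-IsProductOf (λ i → t (IsSimpleSystem.roots simple i)))))

    open CoxeterFactorizations.Frame 𝚽 crystallographic root root∈Φ root-acts simple γ (proj₂ (proj₂ (proj₂ coxeter)))
      (ts ++ rest) (𝐖.trans (prod-++ ts rest) (Completes.factorizes completes)) L≤n public

    F-embed : ∀ i → F (embed ts rest i) ≡ root (lookup ts i)
    F-embed i = ≡.cong root (lookup-embed ts rest i)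

    ω-embed-diagonal : ∀ i → ⟨ ω (embed ts rest i) , root (lookup ts i) ⟩ ≈ 1#
    ω-embed-diagonal i = ≡.subst (λ x → ⟨ ω (embed ts rest i) , x ⟩ ≈ 1#) (F-embed i) (ω-diagonal (embed ts rest i))

    ω-embed-offdiag : ∀ k i → ¬ (k ≡ embed ts rest i) → ⟨ ω k , root (lookup ts i) ⟩ ≈ 0#
    ω-embed-offdiag k i k≢i = ≡.subst (λ x → ⟨ ω k , x ⟩ ≈ 0#) (F-embed i) (ω-offdiag k (embed ts rest i) (k≢i ∘ ≡.sym))

    prefix-independent : Independent (root ∘ lookup ts)
    prefix-independent = biorthogonal⇒independent (root ∘ lookup ts) (ω ∘ embed ts rest) ω-embed-diagonal
      λ i j j≢i → ω-embed-offdiag (embed ts rest i) j (j≢i ∘ ≡.sym ∘ embed-injective ts rest)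

  module Pair {τ σ : T} {rest : List T} (completes : Completes γ (τ ∷ σ ∷ []) rest) where
    open Framed (τ ∷ σ ∷ []) rest completes

    private
      a b : V
      a = root τ
      b = root σ
      ab : Vector V 2
      ab = a Vector.∷ b Vector.∷ Vector.[]
      Φ′ : Pred V 0ℓ
      Φ′ = Φ ∩ Span ab

    φ ψ : V
    φ = ω zero
    ψ = ω (suc zero)

    aφ : ⟨ a , φ ⟩ ≈ 1#
    aφ = trans (⟨⟩-sym _ _) (ω-diagonal zero)

    bφ : ⟨ b , φ ⟩ ≈ 0#
    bφ = trans (⟨⟩-sym _ _) (ω-offdiag zero (suc zero) λ ())

    aψ : ⟨ a , ψ ⟩ ≈ 0#
    aψ = trans (⟨⟩-sym _ _) (ω-offdiag (suc zero) zero λ ())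

    bψ : ⟨ b , ψ ⟩ ≈ 1#
    bψ = trans (⟨⟩-sym _ _) (ω-diagonal (suc zero))

    private
      ⟨combination,_⟩ : ∀ z (c : Vector Carrier 2) →
        ⟨ combination c ab , z ⟩ ≈ c zero * ⟨ a , z ⟩ + c (suc zero) * ⟨ b , z ⟩
      ⟨combination, z ⟩ c = trans (⟨⟩-combinationˡ c ab z) (+-congˡ (+-identityʳ _))

      coefficient : ∀ c i → ⟨ combination c ab , ω i ⟩ ≈ c zero * ⟨ a , ω i ⟩ + c (suc zero) * ⟨ b , ω i ⟩
      coefficient c i = ⟨combination, ω i ⟩ c

      coefficient₀ : ∀ c → ⟨ combination c ab , φ ⟩ ≈ c zero
      coefficient₀ c = trans (coefficient c zero) (trans (+-cong (trans (*-congˡ aφ) (*-identityʳ _)) (trans (*-congˡ bφ) (zeroʳ _))) (+-identityʳ _))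

      coefficient₁ : ∀ c → ⟨ combination c ab , ψ ⟩ ≈ c (suc zero)
      coefficient₁ c = trans (coefficient c (suc zero)) (trans (+-cong (trans (*-congˡ aψ) (zeroʳ _)) (trans (*-congˡ bψ) (*-identityʳ _))) (+-identityˡ _))

      coefficient₂ : ∀ c i → ⟨ combination c ab , ω (suc (suc i)) ⟩ ≈ 0#
      coefficient₂ c i = trans (coefficient c (suc (suc i))) (trans
        (+-cong (trans (*-congˡ (trans (⟨⟩-sym _ _) (ω-offdiag (suc (suc i)) zero λ ()))) (zeroʳ _))
                (trans (*-congˡ (trans (⟨⟩-sym _ _) (ω-offdiag (suc (suc i)) (suc zero) λ ()))) (zeroʳ _)))
        (+-identityʳ 0#))

      ab-independent : Independent ab
      ab-independent c c·ab≈0 zero       = trans (sym (coefficient₀ c)) (trans (⟨⟩-cong c·ab≈0 ≈ᴹ-refl) (⟨⟩-zeroˡ _))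
      ab-independent c c·ab≈0 (suc zero) = trans (sym (coefficient₁ c)) (trans (⟨⟩-cong c·ab≈0 ≈ᴹ-refl) (⟨⟩-zeroˡ _))

      ab∈Φ⁺ : ∀ i → ab i ∈ Φ⁺
      ab∈Φ⁺ zero       = root∈Φ⁺ τ
      ab∈Φ⁺ (suc zero) = root∈Φ⁺ σ

      ab∈Span : ∀ i → ab i ∈ Span ab
      ab∈Span i = proj₁ (IntegerSpan-basis {v = ab} i) , proj₂ (proj₂ (IntegerSpan-basis {v = ab} i))

      module _ (obtuse : ⟨ a , b ⟩ ≤ 0#) where

        -- The frame extends `a`, `b` to a basis of `V` in which vectors of their span have no other
        -- coordinates, so the one obtuse pair suffices for `coordinates-same-sign`.
        same-sign : ∀ {x} c → x ∈ Φ → x ≈ᴹ combination c ab → (∀ i → 0# ≤ c i) ⊎ (∀ i → c i ≤ 0#)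
        same-sign {x} c x∈Φ x≈c = by-sign (coordinates-same-sign x∈Φ F-obtuse)
          where
          xω : ∀ i → ⟨ x , ω i ⟩ ≈ ⟨ combination c ab , ω i ⟩
          xω i = ⟨⟩-cong x≈c ≈ᴹ-refl

          F-obtuse : ∀ i j → ¬ (i ≡ j) → ¬ (⟨ x , ω i ⟩ ≈ 0#) → ¬ (⟨ x , ω j ⟩ ≈ 0#) → ⟨ F i , F j ⟩ ≤ 0#
          F-obtuse zero          zero          i≢j _    _    = contradiction ≡.refl i≢j
          F-obtuse zero          (suc zero)    _   _    _    = obtuse
          F-obtuse (suc zero)    zero          _   _    _    = ≤-respˡ (⟨⟩-sym _ _) obtuse
          F-obtuse (suc zero)    (suc zero)    i≢j _    _    = contradiction ≡.refl i≢j
          F-obtuse (suc (suc i)) _             _   xω≉0 _    = contradiction (trans (xω _) (coefficient₂ c i)) xω≉0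
          F-obtuse zero          (suc (suc j)) _   _    xω≉0 = contradiction (trans (xω _) (coefficient₂ c j)) xω≉0
          F-obtuse (suc zero)    (suc (suc j)) _   _    xω≉0 = contradiction (trans (xω _) (coefficient₂ c j)) xω≉0

          by-sign : (∀ i → 0# ≤ ⟨ x , ω i ⟩) ⊎ (∀ i → ⟨ x , ω i ⟩ ≤ 0#) → (∀ i → 0# ≤ c i) ⊎ (∀ i → c i ≤ 0#)
          by-sign (inj₁ 0≤) = inj₁ λ { zero       → ≤-respʳ (trans (xω _) (coefficient₀ c)) (0≤ zero)
                                     ; (suc zero) → ≤-respʳ (trans (xω _) (coefficient₁ c)) (0≤ (suc zero)) }
          by-sign (inj₂ ≤0) = inj₂ λ { zero       → ≤-respˡ (trans (xω _) (coefficient₀ c)) (≤0 zero)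
                                     ; (suc zero) → ≤-respˡ (trans (xω _) (coefficient₁ c)) (≤0 (suc zero)) }

        neg-combination : ∀ {x} c → x ≈ᴹ combination c ab → -ᴹ x ≈ᴹ combination (λ i → - 1# * c i) ab
        neg-combination {x} c x≈c = ≈ᴹ-trans (neg-*ₗ x) (≈ᴹ-trans (*ₗ-congˡ x≈c) (≈ᴹ-sym (combination-* (- 1#) c ab)))

        nonneg-neg : ∀ {y} → y ≤ 0# → 0# ≤ - 1# * y
        nonneg-neg {y} y≤0 = ≤-respʳ (solve 1 (λ y → :- y := :- con (+ 1) :* y) refl y) (nonpos⇒neg-nonneg y≤0)

        pair-simple : IsSimpleSystemOf Φ′ (Φ′ ∩ Φ⁺) ab
        pair-simple = record
          { isSimpleSystem = record
            { roots       = λ i → Φ⁺⊆Φ (ab∈Φ⁺ i) , ab∈Span i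
            ; independent = ab-independent
            ; same-sign   = λ (x∈Φ , c , x≈c) → in-cone c x≈c (same-sign c x∈Φ x≈c)
            }
          ; positive = mk⇔ (λ ((x∈Φ , c , x≈c) , x∈Φ⁺) → (x∈Φ , c , x≈c) , positive-in-cone c x∈Φ x≈c x∈Φ⁺ (same-sign c x∈Φ x≈c))
                           (λ (x∈Φ′ , c , 0≤c , x≈c) → x∈Φ′ , Φ⁺-combination c ab (proj₁ x∈Φ′) x≈c 0≤c ab∈Φ⁺)
          }
          where
          in-cone : ∀ {x} c → x ≈ᴹ combination c ab → (∀ i → 0# ≤ c i) ⊎ (∀ i → c i ≤ 0#) → Cone ab x ⊎ Cone ab (-ᴹ x)
          in-cone c x≈c (inj₁ 0≤c) = inj₁ (c , 0≤c , x≈c)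
          in-cone c x≈c (inj₂ c≤0) = inj₂ (_ , (λ i → nonneg-neg (c≤0 i)) , neg-combination c x≈c)

          positive-in-cone : ∀ {x} c → x ∈ Φ → x ≈ᴹ combination c ab → x ∈ Φ⁺ →
            (∀ i → 0# ≤ c i) ⊎ (∀ i → c i ≤ 0#) → Cone ab x
          positive-in-cone c x∈Φ x≈c x∈Φ⁺ (inj₁ 0≤c) = c , 0≤c , x≈c
          positive-in-cone c x∈Φ x≈c x∈Φ⁺ (inj₂ c≤0) = contradiction
            (Φ⁺-combination _ ab (Φ-neg x∈Φ) (neg-combination c x≈c) (λ i → nonneg-neg (c≤0 i)) ab∈Φ⁺)
            (Φ⁺-asym x∈Φ⁺)

      -- Non-orthogonal `a` and `b` lie in the same part of an orthogonal splitting. The other part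
      -- is then orthogonal to the plane containing it, so its elements would vanish.
      irreducible : ¬ (⟨ a , b ⟩ ≈ 0#) → Irreducible Φ′
      irreducible ab≉0 = (a , root∈Φ τ , ab∈Span zero) , λ
        { (A , B , A⊆Φ′ , B⊆Φ′ , (x , x∈A) , (y , y∈B) , cover , A⊥B) →
          let y⊥ : a ∈ A → b ∈ A → ⟨ y , y ⟩ ≈ 0#
              y⊥ a∈A b∈A = orthogonal (proj₂ (B⊆Φ′ y∈B)) (A⊥B a∈A y∈B) (A⊥B b∈A y∈B)
              x⊥ : a ∈ B → b ∈ B → ⟨ x , x ⟩ ≈ 0#
              x⊥ a∈B b∈B = orthogonal (proj₂ (A⊆Φ′ x∈A)) (trans (⟨⟩-sym _ _) (A⊥B x∈A a∈B)) (trans (⟨⟩-sym _ _) (A⊥B x∈A b∈B))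
          in case-split A B A⊥B (λ p q → Φ-nonzero (proj₁ (B⊆Φ′ y∈B)) (⟨⟩-def (y⊥ p q)))
               (λ p q → Φ-nonzero (proj₁ (A⊆Φ′ x∈A)) (⟨⟩-def (x⊥ p q)))
               (cover (root∈Φ τ , ab∈Span zero)) (cover (root∈Φ σ , ab∈Span (suc zero))) }
        where
        orthogonal : ∀ {z} → z ∈ Span ab → ⟨ a , z ⟩ ≈ 0# → ⟨ b , z ⟩ ≈ 0# → ⟨ z , z ⟩ ≈ 0#
        orthogonal {z} (c , z≈c) az≈0 bz≈0 = trans (⟨⟩-cong z≈c ≈ᴹ-refl) (trans (⟨combination, z ⟩ c)
          (trans (+-cong (trans (*-congˡ az≈0) (zeroʳ _)) (trans (*-congˡ bz≈0) (zeroʳ _))) (+-identityʳ 0#)))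

        case-split : ∀ (A B : Pred V 0ℓ) → (∀ {x y} → x ∈ A → y ∈ B → ⟨ x , y ⟩ ≈ 0#) →
          (a ∈ A → b ∈ A → ⊥) → (a ∈ B → b ∈ B → ⊥) → a ∈ A ⊎ a ∈ B → b ∈ A ⊎ b ∈ B → ⊥
        case-split A B A⊥B AA BB (inj₁ a∈A) (inj₁ b∈A) = AA a∈A b∈A
        case-split A B A⊥B AA BB (inj₂ a∈B) (inj₂ b∈B) = BB a∈B b∈B
        case-split A B A⊥B AA BB (inj₁ a∈A) (inj₂ b∈B) = ab≉0 (A⊥B a∈A b∈B)
        case-split A B A⊥B AA BB (inj₂ a∈B) (inj₁ b∈A) = ab≉0 (trans (⟨⟩-sym _ _) (A⊥B b∈A a∈B))

    τ′ σ′ : T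
    τ′ = t (Φ⁺⊆Φ (root∈Φ⁺ τ))
    σ′ = t (Φ⁺⊆Φ (root∈Φ⁺ σ))

    -- Strict obtuseness makes the plane irreducible with simple roots `a`, `b`, and the product of
    -- the reflections begins a shortest factorization of `γ`; so compatibility applies.
    obtuse⇒ordered : ⟨ a , b ⟩ < 0# → τ <ᵀ σ
    obtuse⇒ordered ab<0 = <ᵀ.<-respˡ-≈ {σ} {τ′} {τ} (t-root τ) (<ᵀ.<-respʳ-≈ {τ′} {σ′} {σ} (t-root σ)
      (compatible (root∈Φ τ) (root∈Φ σ) ab-independent (irreducible λ ab≈0 → <-irrefl ab≈0 ab<0)
        (root∈Φ⁺ τ) (root∈Φ⁺ σ) (pair-simple (inj₁ ab<0)) (InNC-resp τσ≈ (ExtendsTo⇒InNC (τ ∷ σ ∷ []) (rest , completes)))))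
      where
      τσ≈ : prod (τ ∷ σ ∷ []) ≈ᵂ proj₁ τ′ ∙ proj₁ σ′
      τσ≈ = ∙-cong (𝐖.sym (t-root τ)) (𝐖.trans (𝐖.identityʳ _) (𝐖.sym (t-root σ)))

      InNC-resp : ∀ {u w} → u ≈ᵂ w → InNC γ u → InNC γ w
      InNC-resp u≈w (_ , u⪯γ@(_ , _ , _ , u-len , _)) =
        ε⪯ (length-resp u≈w u-len) , ⪯-trans (⪯-refl (length-resp u≈w u-len) (𝐖.sym u≈w)) u⪯γ

  private
    t-order : ∀ τ σ → t (Φ⁺⊆Φ (root∈Φ⁺ τ)) <ᵀ t (Φ⁺⊆Φ (root∈Φ⁺ σ)) → τ <ᵀ σ
    t-order τ σ τ′<σ′ = <ᵀ.<-respˡ-≈ {σ} {t (Φ⁺⊆Φ (root∈Φ⁺ τ))} {τ} (t-root τ)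
      (<ᵀ.<-respʳ-≈ {t (Φ⁺⊆Φ (root∈Φ⁺ τ))} {t (Φ⁺⊆Φ (root∈Φ⁺ σ))} {σ} (t-root σ) τ′<σ′)

    <ᵀ-asym : ∀ {τ σ} → τ <ᵀ σ → ¬ (σ <ᵀ τ)
    <ᵀ-asym {τ} {σ} = <ᵀ.asym {τ} {σ}

    _>ᵀ_ : Rel T 0ℓ
    τ >ᵀ σ = σ <ᵀ τ

    >ᵀ-wellFounded : WellFounded _>ᵀ_
    >ᵀ-wellFounded = finite-wellFounded (index ∘ proj₁) _>ᵀ_ (λ {a} {b} {c} b<a c<b → <ᵀ.trans {c} {b} {a} c<b b<a)
      (λ {a} → <ᵀ.irrefl {a} 𝐖.refl) (λ {a} {b} {c} eq → <ᵀ.<-respʳ-≈ {c} {a} {b} (index-injective eq))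

    -- If ⟨ a , b ⟩ > 0, then t_a t_b = t_b t_d with d = ± t_b a.  For d = t_b a the
    -- pair (b , d) is obtuse, so b < d by compatibility, although a lies between
    -- b and d.  For d = - t_b a the pair (b , d) is again acute, and b < d since b
    -- lies between a and d; this can be repeated only finitely often.
    module Rotate {τ σ : T} {rest : List T} (completes : Completes γ (τ ∷ σ ∷ []) rest)
      (τ<σ : τ <ᵀ σ) (0<ab : 0# < ⟨ root τ , root σ ⟩) where
      open Pair completes using (φ; aφ; bφ)

      a b d ta : V
      m : Carrier
      δ : T
      a  = root τ
      b  = root σ
      m  = ⟨ a , coroot b ⟩
      δ  = conjugate (proj₁ σ ⁻¹ᵂ) τ
      d  = root δ
      ta = reflect b a

      b≉0 : ¬ (b ≈ᴹ 0ᴹ)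
      b≉0 = Φ-nonzero (root∈Φ σ)

      rotated : Completes γ (σ ∷ δ ∷ []) rest
      rotated = 𝐖.trans (∙-congʳ (𝐖.trans (∙-congˡ (𝐖.identityʳ _)) (𝐖.trans (swap-conjugate (proj₁ σ) τ)
          (∙-congˡ (𝐖.sym (𝐖.identityʳ _)))))) (Completes.factorizes completes) ,
        Completes.shortest completes

      δ-acts : proj₁ δ ActsAsReflectionIn ta
      δ-acts x = ≈ᴹ-trans (acts-conjugate (proj₁ σ ⁻¹ᵂ) (root-acts τ) x)
        (reflect-parallel (·-nonzero (proj₁ σ ⁻¹ᵂ) (Φ-nonzero (root∈Φ τ))) (≈ᴹ-trans σ⁻¹a≈ta (≈ᴹ-sym (*ₗ-identityˡ ta))) x)
        where
        σ≈σ⁻¹ : proj₁ σ ≈ᵂ proj₁ σ ⁻¹ᵂ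
        σ≈σ⁻¹ = GroupProperties.inverseʳ-unique 𝐖.group _ _ (reflection-involutive (proj₂ σ))
        σ⁻¹a≈ta : (proj₁ σ ⁻¹ᵂ) · a ≈ᴹ ta
        σ⁻¹a≈ta = ≈ᴹ-trans (·-congˡ (𝐖.sym σ≈σ⁻¹) a) (root-acts σ a)

      d≈±ta : d ≈ᴹ ta ⊎ d ≈ᴹ -ᴹ ta
      d≈±ta = one-pair (reflect-root (root∈Φ σ) (root∈Φ τ)) (root∈Φ δ) δ-acts (root-acts δ)

      0<m : 0# < m
      0<m = *-cancelˡ-pos (norm-pos b≉0) (<-respʳ-≈ (trans (sym (coroot-norm a b≉0)) (*-comm _ _)) (*-pos 0<2 0<ab))

      ta-pairing : ∀ z → ⟨ ta , z ⟩ ≈ ⟨ a , z ⟩ - m * ⟨ b , z ⟩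
      ta-pairing z = trans (⟨⟩-cong (reflect≈transvection b a) ≈ᴹ-refl) ⟨⟦ ‵ a ⊕ ⊖ m ⊛ ‵ b ⟧, z ⟩

      ta-b : ⟨ ta , b ⟩ ≈ - ⟨ a , b ⟩
      ta-b = trans (ta-pairing b) (trans (+-congˡ (-‿cong (coroot-norm a b≉0)))
        (solve 1 (λ x → x :- con (+ 2) :* x := :- x) refl ⟨ a , b ⟩))

      ta-φ : ⟨ ta , φ ⟩ ≈ 1#
      ta-φ = trans (ta-pairing φ) (trans (+-cong aφ (trans (-‿cong (trans (*-congˡ bφ) (zeroʳ m))) -0#≈0#)) (+-identityʳ 1#))

      separated : ∀ {x y r s} → ⟨ x , φ ⟩ ≈ r → ⟨ y , φ ⟩ ≈ s → ¬ (r ≈ s) → ¬ (x ≈ᴹ y)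
      separated xφ yφ r≉s x≈y = r≉s (trans (sym xφ) (trans (⟨⟩-cong x≈y ≈ᴹ-refl) yφ))

      1≉0 : ¬ (1# ≈ 0#)
      1≉0 = <⇒≉ 0<1

      obtuse-case : d ≈ᴹ ta → ⊥
      obtuse-case d≈ta = by-order (reflectionOrdering (root∈Φ⁺ τ) (root∈Φ⁺ δ) (root∈Φ⁺ σ)
          a≉d (separated aφ bφ 1≉0) (separated (trans (⟨⟩-cong d≈ta ≈ᴹ-refl) ta-φ) bφ 1≉0) 0<1 0<m a≈d+mb)
        where
        bd<0 : ⟨ b , d ⟩ < 0#
        bd<0 = <-respˡ-≈ (sym (trans (⟨⟩-sym b d) (trans (⟨⟩-cong d≈ta ≈ᴹ-refl) ta-b))) (pos-neg 0<ab)

        -- Both have `φ`-coordinate 1; the sign of the pairing with `b` tells them apart.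
        a≉d : ¬ (a ≈ᴹ d)
        a≉d a≈d = <-irrefl refl (<-trans 0<ab (<-respˡ-≈ (trans (⟨⟩-sym b d) (⟨⟩-cong (≈ᴹ-sym a≈d) ≈ᴹ-refl)) bd<0))

        a≈d+mb : a ≈ᴹ 1# *ₗ d +ᴹ m *ₗ b
        a≈d+mb = ⟨⟩-ext λ z → sym (trans ⟨⟦ 1# ⊛ ‵ d ⊕ m ⊛ ‵ b ⟧, z ⟩
          (trans (+-congʳ (*-congˡ (trans (⟨⟩-cong d≈ta ≈ᴹ-refl) (ta-pairing z))))
                 (solve 2 (λ a mb → con (+ 1) :* (a :- mb) :+ mb := a) refl ⟨ a , z ⟩ (m * ⟨ b , z ⟩))))

        σ<δ : σ <ᵀ δ
        σ<δ = Pair.obtuse⇒ordered rotated bd<0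

        by-order : _ → ⊥
        by-order (inj₁ (δ<τ , _)) = <ᵀ-asym {σ} {δ} σ<δ (<ᵀ.trans {δ} {τ} {σ} (t-order δ τ δ<τ) τ<σ)
        by-order (inj₂ (σ<τ , _)) = <ᵀ-asym {τ} {σ} τ<σ (t-order σ τ σ<τ)

      acute-case : d ≈ᴹ -ᴹ ta → σ <ᵀ δ × 0# < ⟨ b , d ⟩
      acute-case d≈-ta = by-order (reflectionOrdering (root∈Φ⁺ σ) (root∈Φ⁺ δ) (root∈Φ⁺ τ)
          (separated bφ dφ (λ 0≈-1 → <-irrefl (sym 0≈-1) (pos-neg 0<1))) (separated bφ aφ (1≉0 ∘ sym)) (separated dφ aφ -1≉1)
          (⁻¹-pos 0<m) (⁻¹-pos 0<m) b≈) , 0<bd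
        where
        d-pairing : ∀ z → ⟨ d , z ⟩ ≈ - ⟨ ta , z ⟩
        d-pairing z = trans (⟨⟩-cong d≈-ta ≈ᴹ-refl) (⟨⟩-negˡ ta z)

        0<bd : 0# < ⟨ b , d ⟩
        0<bd = <-respʳ-≈ (sym (trans (⟨⟩-sym b d) (trans (d-pairing b) (trans (-‿cong ta-b) (-‿involutive _))))) 0<ab

        dφ : ⟨ d , φ ⟩ ≈ - 1#
        dφ = trans (d-pairing φ) (-‿cong ta-φ)

        -1≉1 : ¬ (- 1# ≈ 1#)
        -1≉1 -1≈1 = <-irrefl -1≈1 (<-trans (pos-neg 0<1) 0<1)

        -- From `d = m b - a`.
        b≈ : b ≈ᴹ (m ⁻¹) *ₗ d +ᴹ (m ⁻¹) *ₗ a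
        b≈ = ⟨⟩-ext λ z → sym (trans ⟨⟦ (m ⁻¹) ⊛ ‵ d ⊕ (m ⁻¹) ⊛ ‵ a ⟧, z ⟩
          (trans (+-congʳ (*-congˡ (trans (d-pairing z) (-‿cong (ta-pairing z)))))
          (trans (solve 4 (λ m m′ a b → m′ :* (:- (a :- m :* b)) :+ m′ :* a := (m :* m′) :* b) refl m (m ⁻¹) ⟨ a , z ⟩ ⟨ b , z ⟩)
          (trans (*-congʳ (⁻¹-inverseʳ (<⇒≉ 0<m))) (*-identityˡ _)))))

        by-order : _ → σ <ᵀ δ
        by-order (inj₁ (_ , σ<τ)) = contradiction (t-order σ τ σ<τ) (<ᵀ-asym {τ} {σ} τ<σ)
        by-order (inj₂ (_ , σ<δ)) = t-order σ δ σ<δ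

    ¬acute : ∀ {τ σ} → Acc _>ᵀ_ σ → ExtendsTo γ (τ ∷ σ ∷ []) → τ <ᵀ σ → ¬ (0# < ⟨ root τ , root σ ⟩)
    ¬acute {τ} {σ} (acc rs) (rest , completes) τ<σ 0<ab = by-cases R.d≈±ta
      where
      module R = Rotate completes τ<σ 0<ab
      by-cases : R.d ≈ᴹ R.ta ⊎ R.d ≈ᴹ -ᴹ R.ta → ⊥
      by-cases (inj₁ d≈ta)  = R.obtuse-case d≈ta
      -- The second factor moves strictly up, from `σ` to `δ`, and `W` has finitely many
      -- reflections.
      by-cases (inj₂ d≈-ta) = ¬acute (rs (proj₁ (R.acute-case d≈-ta))) (rest , R.rotated)
        (proj₁ (R.acute-case d≈-ta)) (proj₂ (R.acute-case d≈-ta))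

  obtuse : ∀ {τ σ} → ExtendsTo γ (τ ∷ σ ∷ []) → τ <ᵀ σ → ⟨ root τ , root σ ⟩ ≤ 0#
  obtuse extends τ<σ = ≮⇒≥ (¬acute (>ᵀ-wellFounded _) extends τ<σ)

  private
    prefix-obtuse : ∀ {ts rest} → Linked _<ᵀ_ ts → Completes γ ts rest → ∀ i j → ¬ (i ≡ j) →
      ⟨ root (lookup ts i) , root (lookup ts j) ⟩ ≤ 0#
    prefix-obtuse rising completes = AllPairs-lookup (λ {τ} {σ} → ≤-respˡ (⟨⟩-sym (root τ) (root σ)))
      (AllPairs.map (λ (extends , τ<σ) → obtuse extends τ<σ)
        (AllPairs.zip (Completes⇒pairs completes , Linked⇒AllPairs (λ {a} {b} {c} → <ᵀ.trans {a} {b} {c}) rising)))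

    module Compare {ts ts′ rest : List T} (rising : Linked _<ᵀ_ ts)
      (completes : Completes γ ts rest) (completes′ : Completes γ ts′ rest) where
      open Framed ts rest completes
      private module F′ = Framed ts′ rest completes′

      same-product : prod ts ≈ᵂ prod ts′
      same-product = GroupProperties.∙-cancelʳ 𝐖.group (prod rest) (prod ts) (prod ts′)
        (𝐖.trans (Completes.factorizes completes) (𝐖.sym (Completes.factorizes completes′)))

      -- `ω k` is orthogonal to the roots of `ts`, hence fixed by `prod ts`, which equals
      -- `prod ts′`. The roots of `ts′` are independent, so `ω k` is orthogonal to them too.
      outside : ∀ k → (∀ i → ¬ (k ≡ embed ts rest i)) → ∀ j → ⟨ root (lookup ts′ j) , ω k ⟩ ≈ 0#
      outside k k∉ts j = trans (⟨⟩-sym _ _) (coroot-perp (Φ-nonzero (root∈Φ (lookup ts′ j)))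
        (fixed⇒perp _ (root ∘ lookup ts′) F′.prefix-independent fixed′ j))
        where
        fixed : prod ts · ω k ≈ᴹ ω k
        fixed = ≈ᴹ-trans (list-act coroot (λ α → α) reflect≈transvection ts (ω k))
          (transvections-fix _ _ λ i → perp-coroot (ω-embed-offdiag k i (k∉ts i)))

        fixed′ : transvections (coroot ∘ root ∘ lookup ts′) (root ∘ lookup ts′) (ω k) ≈ᴹ ω k
        fixed′ = ≈ᴹ-trans (≈ᴹ-sym (list-act coroot (λ α → α) reflect≈transvection ts′ (ω k)))
          (≈ᴹ-trans (≈ᴹ-sym (·-congˡ same-product (ω k))) fixed)

      -- By `outside` only coordinates along `ts` can be nonzero, and there the roots are obtuse, so
      -- all coordinates of `β` have one sign. Nonpositive ones would make `-ᴹ β` a positive root.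
      nonneg : ∀ j k → 0# ≤ ⟨ root (lookup ts′ j) , ω k ⟩
      nonneg j = by-sign (coordinates-same-sign (root∈Φ (lookup ts′ j)) λ i i′ → F-obtuse i i′ (embed? ts rest i) (embed? ts rest i′))
        where
        β : V
        β = root (lookup ts′ j)

        F-obtuse : ∀ i i′ → (∃[ k ] i ≡ embed ts rest k) ⊎ (∀ k → ¬ (i ≡ embed ts rest k)) →
          (∃[ k ] i′ ≡ embed ts rest k) ⊎ (∀ k → ¬ (i′ ≡ embed ts rest k)) →
          ¬ (i ≡ i′) → ¬ (⟨ β , ω i ⟩ ≈ 0#) → ¬ (⟨ β , ω i′ ⟩ ≈ 0#) → ⟨ F i , F i′ ⟩ ≤ 0#
        F-obtuse i i′ (inj₂ i∉ts) _ _ βω≉0 _ = contradiction (outside i i∉ts j) βω≉0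
        F-obtuse i i′ (inj₁ _) (inj₂ i′∉ts) _ _ βω≉0 = contradiction (outside i′ i′∉ts j) βω≉0
        F-obtuse _ _ (inj₁ (k , ≡.refl)) (inj₁ (k′ , ≡.refl)) i≢i′ _ _ =
          ≡.subst₂ (λ x y → ⟨ x , y ⟩ ≤ 0#) (≡.sym (F-embed k)) (≡.sym (F-embed k′))
            (prefix-obtuse rising completes k k′ (i≢i′ ∘ ≡.cong (embed ts rest)))

        by-sign : (∀ i → 0# ≤ ⟨ β , ω i ⟩) ⊎ (∀ i → ⟨ β , ω i ⟩ ≤ 0#) → ∀ k → 0# ≤ ⟨ β , ω k ⟩
        by-sign (inj₁ 0≤) = 0≤
        by-sign (inj₂ ≤0) = contradiction
          (Φ⁺-combination (λ i → - 1# * ⟨ β , ω i ⟩) F (Φ-neg (root∈Φ (lookup ts′ j)))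
            (≈ᴹ-trans (neg-*ₗ β) (≈ᴹ-trans (*ₗ-congˡ (expand β)) (≈ᴹ-sym (combination-* (- 1#) (λ i → ⟨ β , ω i ⟩) F))))
            (λ i → ≤-respʳ (solve 1 (λ y → :- y := :- con (+ 1) :* y) refl ⟨ β , ω i ⟩) (nonpos⇒neg-nonneg (≤0 i)))
            (λ i → root∈Φ⁺ (lookup (ts ++ rest) i)))
          (Φ⁺-asym (root∈Φ⁺ (lookup ts′ j)))

    -- The root α of τ is a nonnegative combination of the roots of the second
    -- factorization; pairing with the dual vectors other than that of α shows
    -- that those occurring in it are multiples of α.
    head-occurs : ∀ {τ ts ts′ rest} → Linked _<ᵀ_ (τ ∷ ts) → Linked _<ᵀ_ ts′ →
      Completes γ (τ ∷ ts) rest → Completes γ ts′ rest → ∃[ j ] lookup ts′ j ≈ᵀ τ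
    head-occurs {τ} {ts} {ts′} {rest} rising rising′ completes completes′ = by-index (any? λ j → ¬? (⟨ α , B.ω j ⟩ ≟ 0#))
      where
      module A = Framed (τ ∷ ts) rest completes
      module B = Framed ts′ rest completes′
      module AB = Compare {τ ∷ ts} {ts′} rising completes completes′
      module BA = Compare {ts′} {τ ∷ ts} rising′ completes′ completes

      α : V
      α = root τ

      α≉0 : ¬ (α ≈ᴹ 0ᴹ)
      α≉0 = Φ-nonzero (root∈Φ τ)

      term-nonneg : ∀ k j → 0# ≤ ⟨ α , B.ω j ⟩ * ⟨ B.F j , A.ω k ⟩
      term-nonneg k j = by-embed (embed? ts′ rest j)
        where
        by-embed : (∃[ i ] j ≡ embed ts′ rest i) ⊎ (∀ i → ¬ (j ≡ embed ts′ rest i)) →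
          0# ≤ ⟨ α , B.ω j ⟩ * ⟨ B.F j , A.ω k ⟩
        by-embed (inj₁ (i , ≡.refl)) = *-nonneg (BA.nonneg zero (embed ts′ rest i))
          (≡.subst (λ x → 0# ≤ ⟨ x , A.ω k ⟩) (≡.sym (B.F-embed i)) (AB.nonneg i k))
        by-embed (inj₂ j∉ts′) = inj₂ (sym (trans (*-congʳ (BA.outside j j∉ts′ zero)) (zeroˡ _)))

      parallel : ∀ j → ¬ (⟨ α , B.ω j ⟩ ≈ 0#) → B.F j ≈ᴹ ⟨ B.F j , A.ω zero ⟩ *ₗ α
      parallel j αω≉0 = ≈ᴹ-trans (A.expand (B.F j)) (combination-single (λ k → ⟨ B.F j , A.ω k ⟩) A.F zero λ k k≢0 →
        x*y≈0⇒y≈0 αω≉0 (sum-nonneg-zero _ (term-nonneg k)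
          (trans (sym (B.⟨⟩-expand α (A.ω k))) (trans (⟨⟩-sym _ _) (A.ω-offdiag k zero (k≢0 ∘ ≡.sym)))) j))

      by-index : Dec (∃[ j ] ¬ (⟨ α , B.ω j ⟩ ≈ 0#)) → ∃[ j ] lookup ts′ j ≈ᵀ τ
      by-index (no ∄j) = contradiction (≈ᴹ-trans (B.expand α) (combination-0 B.F λ j → ≟-stable j)) α≉0
        where
        ≟-stable : ∀ j → ⟨ α , B.ω j ⟩ ≈ 0#
        ≟-stable j = decidable-stable (⟨ α , B.ω j ⟩ ≟ 0#) λ ne → ∄j (j , ne)
      by-index (yes (j , αω≉0)) = by-embed (embed? ts′ rest j)
        where
        by-embed : (∃[ i ] j ≡ embed ts′ rest i) ⊎ (∀ i → ¬ (j ≡ embed ts′ rest i)) → ∃[ i ] lookup ts′ i ≈ᵀ τ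
        by-embed (inj₂ j∉ts′) = contradiction (BA.outside j j∉ts′ zero) αω≉0
        by-embed (inj₁ (i , ≡.refl)) = i , same-reflection (lookup ts′ i) τ
          (≡.subst (λ σ → proj₁ σ ActsAsReflectionIn B.F (embed ts′ rest i)) (lookup-embed ts′ rest i)
            (root-acts (lookup (ts′ ++ rest) (embed ts′ rest i))))
          (acts-parallel (B.F≉0 _) (parallel _ αω≉0) (root-acts τ))

    head-least : ∀ {σ ss} → Linked _<ᵀ_ (σ ∷ ss) → ∀ j → ¬ (lookup (σ ∷ ss) j <ᵀ σ)
    head-least {σ} rising zero    = <ᵀ.irrefl {σ} 𝐖.refl
    head-least {σ} {ss} rising (suc j) τ<σ with Linked⇒AllPairs (λ {a} {b} {c} → <ᵀ.trans {a} {b} {c}) rising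
    ... | σ<ss ∷ _ = <ᵀ-asym {lookup ss j} {σ} τ<σ (All.lookup σ<ss (∈-lookup j))

  -- Each head occurs in the other list, so the smaller of two different heads would lie below the
  -- least entry of a rising list containing it.
  heads-agree : ∀ {τ ts σ ss rest} → Linked _<ᵀ_ (τ ∷ ts) → Linked _<ᵀ_ (σ ∷ ss) →
    Completes γ (τ ∷ ts) rest → Completes γ (σ ∷ ss) rest → τ ≈ᵀ σ
  heads-agree {τ} {ts} {σ} {ss} τ↗ σ↗ τ-comp σ-comp =
    agree (head-occurs τ↗ σ↗ τ-comp σ-comp) (head-occurs σ↗ τ↗ σ-comp τ-comp) (<ᵀ.compare τ σ)
    where
    agree : (∃[ j ] lookup (σ ∷ ss) j ≈ᵀ τ) → (∃[ j ] lookup (τ ∷ ts) j ≈ᵀ σ) →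
      Tri (τ <ᵀ σ) (τ ≈ᵀ σ) (σ <ᵀ τ) → τ ≈ᵀ σ
    agree _            _            (tri≈ _ τ≈σ _) = τ≈σ
    agree (j , σsⱼ≈τ)  _            (tri< τ<σ _ _) = contradiction
      (<ᵀ.<-respˡ-≈ {σ} {τ} {lookup (σ ∷ ss) j} (𝐖.sym σsⱼ≈τ) τ<σ) (head-least σ↗ j)
    agree _            (j , τsⱼ≈σ)  (tri> _ _ σ<τ) = contradiction
      (<ᵀ.<-respˡ-≈ {τ} {σ} {lookup (τ ∷ ts) j} (𝐖.sym τsⱼ≈σ) σ<τ) (head-least τ↗ j)

open PosetProperties using (_<_)

theorem3p5 :
    (ℝ : Reals) (ℓ : ℕ) (E : EuclideanSpace ℝ ℓ) (𝑾 : ReflectionGroup E) (𝚽 : RootSystem 𝑾) →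
    let open EuclideanSpace E
        open ReflectionGroup 𝑾
        open RootSystem 𝚽
        open SimpleSystems E
        open NoncrossingPartitions 𝚽
    in
    (Φ⁺ : Pred V 0ℓ) (isPositive : IsPositiveSystem Φ Φ⁺) (γ : W) → IsCoxeterElement γ →
    (_<ᵀ_ : Rel T 0ℓ) (isTotal : IsStrictTotalOrder _≈ᵀ_ _<ᵀ_) →
    let open Covering (NC γ)
        open EdgeLabelings (NC γ) (T-strictTotalOrder isTotal) (natural γ)
    in
    (∀ {u v} → _<_ (NC γ) u v →
      Σ[ c ∈ MaximalChain u v ] LexSmallest c × (∀ d → LexSmallest d → d ≋ c) × Rising c)
    ×
    (IsReflectionOrdering (positive⇒root isPositive) _<ᵀ_ →
     IsCompatible (positive⇒root isPositive) _<ᵀ_ γ →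
     Crystallographic →
     IsELLabeling)
theorem3p5 ℝ ℓ E 𝑾 𝚽 Φ⁺ isPositive γ coxeter _<ᵀ_ isTotal =
  (λ {u} {v} → lexSmallest-chain {u} {v}) , λ ordering compatible crystallographic {u} {v} u<v →
    let c , smallest , _ , c↗ = lexSmallest-chain {u} {v} u<v
        -- The same `rest` for all chains of the interval, as the comparison of two rising chains
        -- requires.
        rest , completes = interval-completion {u} {v} u<v
        heads-agree = RisingFactorizations.heads-agree 𝚽 Φ⁺ isPositive γ coxeter _<ᵀ_ isTotal
                        crystallographic ordering compatible
    in c , c↗ ,
       (λ d d↗ → labels-determine-vertices d c refl
          (rising-unique heads-agree _ _ d↗ c↗ (completes d) (completes c))) ,
       smallest
  where
  open ReflectionGroup 𝑾 using (group; IsReflection; refl)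
  open ReflectionGroupLemmas 𝑾
  open ReflectionFactorizations.Enumerated group IsReflection IsReflection-conjugate _≟ᵂ_ reflections reflections-complete
    _<ᵀ_ isTotal
  open Chains γ (NoncrossingPartitions.natural 𝚽 γ) (λ _ _ _ → refl) reflection-involutive
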